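{- Let $G$ be a finite group with $d(G)=3$. Then one of the following holds: (i) $G$ is generalized dihedral; (ii) $G$ admits an ORR; (iii) $G$ is isomorphic to one of: $C_4\times C_2^2$; $C_3\times C_2^3$; $\langle x,y,z\mid x^4=y^4=z^4=(xy)^2=(xy^{ -1})^2=(xz)^2=(xz^{ -1})^2=(yz)^2=(yz^{ -1})^2=x^2y^2z^2=1\rangle$; $\langle x,y,z\mid x^4=y^4=z^4=(yx)^2=(yx^{ -1})^2=(yz)^2=(yz^{ -1})^2=1,\ x^2=z^2,\ x^z=x^{ -1},\ x^2=y^2\rangle$. Furthermore, the groups in (i) and (iii) admit no ORR.
   Context: $d(G)$ is the minimum cardinality of a generating set of $G$. $x^z=z^{ -1}xz$. $G$ is generalized dihedral if it contains an abelian subgroup $A$ of index $2$ and an element $\tau\in G\setminus A$ with $\tau^2=1$ and $\tau a\tau=a^{ -1}$ for all $a\in A$. The Cayley digraph $\mathrm{Cay}(G,S)$ has vertex set $G$ and arcs $(x,y)$ with $yx^{ -1}\in S$. $G$ admits an ORR if there is $S\subseteq G$ with $S\cap S^{ -1}=\emptyset$ and the full automorphism group of $\mathrm{Cay}(G,S)$ equal to the right regular representation of $G$. -}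

module Defs where

open import Data.Nat using (ℕ; zero; suc; _*_; _<_)
open import Data.Fin using (Fin)
import Data.Fin.Subset as Sub
open import Data.Fin.Subset using (Subset; ∣_∣)
open import Data.Fin.Permutation using (Permutation′; _⟨$⟩ʳ_)
open import Data.Product using (Σ; ∃; _×_; _,_)
open import Data.Sum using (_⊎_)
open import Data.List using (List)
open import Data.List.Relation.Unary.All using (All)
open import Relation.Nullary using (¬_)
open import Relation.Binary.PropositionalEquality using (_≡_)
open import Function.Bundles using (_⇔_)
open import Algebra.Structures using (IsGroup)

record FinGroup : Set where
  infixl 7 _∙_
  infix 8 _⁻¹
  field
    order   : ℕ
    _∙_     : Fin order → Fin order → Fin order
    ε       : Fin order
    _⁻¹     : Fin order → Fin order
    isGroup : IsGroup _≡_ _∙_ ε _⁻¹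

  Carrier : Set
  Carrier = Fin order

open FinGroup public using (order; Carrier)

module _ (G : FinGroup) where
  open FinGroup G hiding (Carrier; order)
  private
    C : Set
    C = Carrier G
    n : ℕ
    n = order G

  data ⟨_⟩ {k : ℕ} (S : Fin k → C) : C → Set where
    gen : ∀ i → ⟨ S ⟩ (S i)
    one : ⟨ S ⟩ ε
    mul : ∀ {a b} → ⟨ S ⟩ a → ⟨ S ⟩ b → ⟨ S ⟩ (a ∙ b)
    inv : ∀ {a} → ⟨ S ⟩ a → ⟨ S ⟩ (a ⁻¹)

  Generates : {k : ℕ} → (Fin k → C) → Set
  Generates S = ∀ g → ⟨ S ⟩ g

  GeneratedBy : ℕ → Set
  GeneratedBy k = Σ (Fin k → C) Generates

  Rank : ℕ → Set
  Rank k = GeneratedBy k × (∀ m → m < k → ¬ GeneratedBy m)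

  IsSubgroup : Subset n → Set
  IsSubgroup A = (ε Sub.∈ A)
               × (∀ a b → a Sub.∈ A → b Sub.∈ A → (a ∙ b) Sub.∈ A)
               × (∀ a → a Sub.∈ A → (a ⁻¹) Sub.∈ A)

  GeneralizedDihedral : Set
  GeneralizedDihedral =
    Σ (Subset n) λ A → IsSubgroup A
      × (∀ a b → a Sub.∈ A → b Sub.∈ A → a ∙ b ≡ b ∙ a)
      × (n ≡ 2 * ∣ A ∣)
      × Σ C λ τ → ¬ (τ Sub.∈ A) × (τ ∙ τ ≡ ε)
          × (∀ a → a Sub.∈ A → τ ∙ a ∙ τ ≡ a ⁻¹)

  Arc : Subset n → C → C → Set
  Arc S x y = (y ∙ x ⁻¹) Sub.∈ S

  IsCayleyAut : Subset n → Permutation′ n → Set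
  IsCayleyAut S φ = ∀ x y → Arc S x y ⇔ Arc S (φ ⟨$⟩ʳ x) (φ ⟨$⟩ʳ y)

  IsDRR : Subset n → Set
  IsDRR S = ∀ φ → IsCayleyAut S φ → Σ C λ g → ∀ x → φ ⟨$⟩ʳ x ≡ x ∙ g

  HasORR : Set
  HasORR = Σ (Subset n) λ S → (∀ s → s Sub.∈ S → ¬ ((s ⁻¹) Sub.∈ S)) × IsDRR S

data Word (k : ℕ) : Set where
  var  : Fin k → Word k
  e    : Word k
  _·_  : Word k → Word k → Word k
  _⁻   : Word k → Word k

infixl 7 _·_
infix 8 _⁻

_^_ : {k : ℕ} → Word k → ℕ → Word k
w ^ zero = e
w ^ suc n = w · (w ^ n)

infixr 9 _^_

_^ᶜ_ : {k : ℕ} → Word k → Word k → Word k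
u ^ᶜ v = v ⁻ · u · v

Relation : ℕ → Set
Relation k = Word k × Word k

eval : (G : FinGroup) {k : ℕ} → (Fin k → Carrier G) → Word k → Carrier G
eval G a (var i) = a i
eval G a e = FinGroup.ε G
eval G a (u · v) = FinGroup._∙_ G (eval G a u) (eval G a v)
eval G a (u ⁻) = FinGroup._⁻¹ G (eval G a u)

Satisfies : (G : FinGroup) {k : ℕ} → (Fin k → Carrier G) → List (Relation k) → Set
Satisfies G a R = All (λ r → eval G a (Data.Product.proj₁ r) ≡ eval G a (Data.Product.proj₂ r)) R
  where import Data.Product

IsHom : (G H : FinGroup) → (Carrier G → Carrier H) → Set
IsHom G H f = ∀ a b → f (FinGroup._∙_ G a b) ≡ FinGroup._∙_ H (f a) (f b)

-- G ≅ ⟨ k generators ∣ R ⟩ : G is generated by elements satisfying R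
-- and has the universal property of the presented group.
IsPresentedBy : (G : FinGroup) (k : ℕ) → List (Relation k) → Set
IsPresentedBy G k R =
  Σ (Fin k → Carrier G) λ a → Generates G a × Satisfies G a R
    × (∀ (H : FinGroup) (b : Fin k → Carrier H) → Satisfies H b R →
         Σ (Carrier G → Carrier H) λ f → IsHom G H f × (∀ i → f (a i) ≡ b i))

open import Data.List using ([]; _∷_)
open import Data.Fin using (zero; suc)

private
  X Y Z : Word 3
  X = var zero
  Y = var (suc zero)
  Z = var (suc (suc zero))

_≐_ : {k : ℕ} → Word k → Word k → Relation k
u ≐ v = u , v
infix 6 _≐_

relC4C2C2 : List (Relation 3)
relC4C2C2 = X ^ 4 ≐ e ∷ Y ^ 2 ≐ e ∷ Z ^ 2 ≐ e
          ∷ X · Y ≐ Y · X ∷ X · Z ≐ Z · X ∷ Y · Z ≐ Z · Y ∷ []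

relC3C2C2C2 : List (Relation 4)
relC3C2C2C2 = a ^ 3 ≐ e ∷ b ^ 2 ≐ e ∷ c ^ 2 ≐ e ∷ d ^ 2 ≐ e
            ∷ a · b ≐ b · a ∷ a · c ≐ c · a ∷ a · d ≐ d · a
            ∷ b · c ≐ c · b ∷ b · d ≐ d · b ∷ c · d ≐ d · c ∷ []
  where
  a b c d : Word 4
  a = var zero
  b = var (suc zero)
  c = var (suc (suc zero))
  d = var (suc (suc (suc zero)))

relG1 : List (Relation 3)
relG1 = X ^ 4 ≐ e ∷ Y ^ 4 ≐ e ∷ Z ^ 4 ≐ e
      ∷ (X · Y) ^ 2 ≐ e ∷ (X · Y ⁻) ^ 2 ≐ e
      ∷ (X · Z) ^ 2 ≐ e ∷ (X · Z ⁻) ^ 2 ≐ e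
      ∷ (Y · Z) ^ 2 ≐ e ∷ (Y · Z ⁻) ^ 2 ≐ e
      ∷ X ^ 2 · Y ^ 2 · Z ^ 2 ≐ e ∷ []

relG2 : List (Relation 3)
relG2 = X ^ 4 ≐ e ∷ Y ^ 4 ≐ e ∷ Z ^ 4 ≐ e
      ∷ (Y · X) ^ 2 ≐ e ∷ (Y · X ⁻) ^ 2 ≐ e
      ∷ (Y · Z) ^ 2 ≐ e ∷ (Y · Z ⁻) ^ 2 ≐ e
      ∷ X ^ 2 ≐ Z ^ 2 ∷ X ^ᶜ Z ≐ X ⁻ ∷ X ^ 2 ≐ Y ^ 2 ∷ []

Exceptional : FinGroup → Set
Exceptional G = IsPresentedBy G 3 relC4C2C2
              ⊎ IsPresentedBy G 4 relC3C2C2C2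
              ⊎ IsPresentedBy G 3 relG1
              ⊎ IsPresentedBy G 3 relG2

{-# OPTIONS --safe #-}
-- If no generating triple x, y, z consists of non-involutions, then some involution inverts an abelian
-- subgroup of index 2.  Otherwise, since no two elements generate G, a word in which some generator
-- occurs exactly once is nontrivial, and so almost all coincidences among products of elements of a
-- small connection set S can be excluded.  If x, y do not commute, S = {x, y, yx, z} gives an ORR unless
-- x and y invert each other ("quaternionic") or xy and xy⁻¹ are involutions ("paired").  Hence every pair
-- in such a triple commutes or is of one of these two types, and comparing with the triples obtained by
-- multiplying generators leaves a few explicit families, each of which has its own S or is exceptional.
--
-- Cay(G,S) is shown to be an ORR by modal formulas that single out elements of S in the digraph rooted at
-- the identity: every automorphism fixing the identity then fixes these elements, and the elements g with
-- ψ(gx) = gψ(x) for all automorphisms ψ and all x form a subgroup.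
--
-- In an exceptional group every S with S ∩ S⁻¹ = ∅ is preserved by a nontrivial group automorphism.

module Submission where

open import Defs
open import Algebra.Bundles using (Group)
import Algebra.Properties.Group as GroupProperties
open import Data.Bool using (Bool; true; false; T; T?; not; _∧_; _∨_; _xor_; if_then_else_)
open import Data.Bool.ListAction using (any; all)
open import Data.Bool.Properties using (T-∧; T-∨; T-≡)
open import Data.Empty using (⊥; ⊥-elim)
open import Data.Fin using (Fin; zero; suc; punchIn; punchOut)
import Data.Fin.Properties as FinP
open import Data.Fin.Properties using (punchIn-punchOut) renaming (_≟_ to _≟F_)
open import Data.Fin.Permutation using (Permutation′; permutation; _⟨$⟩ʳ_; _⟨$⟩ˡ_)
  renaming (inverseʳ to ⟨$⟩-inverseʳ; inverseˡ to ⟨$⟩-inverseˡ)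
import Data.Fin.Subset as Sub
open import Data.Fin.Subset using (Subset; ∣_∣; ∁)
open import Data.Fin.Subset.Properties
  using (∣∁p∣≡n∸∣p∣; ∣p∣≤n; x∉p⇒x∈∁p; x∈∁p⇒x∉p; _∈?_; p⊂q⇒∣p∣<∣q∣; x∈p∧x≢y⇒x∈p-y; x∈p⇒p-x⊂p)
open import Data.List using (List; []; _∷_; _++_; null; take; drop; allFin; length; foldr; map; filter; concatMap)
open import Data.List.Properties using (take++drop≡id)
open import Data.List.Membership.Propositional using (_∈_; lose)
open import Data.List.Membership.Propositional.Properties
  using (∈-allFin; ∈-map⁺; ∈-map⁻; ∈-filter⁺; ∈-filter⁻; ∈-concatMap⁺)
open import Data.List.Relation.Unary.All as All using (All; []; _∷_)
open import Data.List.Relation.Unary.Any using (here; there)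
open import Data.Nat using (ℕ; zero; suc; _+_; _*_; _∸_; _≤_; _<_; z≤n; s≤s)
import Data.Nat.Properties as ℕP
open import Data.Product using (Σ; ∃; _×_; _,_; proj₁; proj₂)
open import Data.Sum using (_⊎_; inj₁; inj₂)
open import Data.Unit using (tt)
open import Data.Vec as Vec using (Vec; []; _∷_; lookup; tabulate; zipWith; replicate)
open import Data.Vec.Properties using (lookup∘tabulate; []=⇒lookup; lookup⇒[]=)
import Data.Vec.Base as Membership using (here; there)
open import Function.Bundles using (Equivalence; mk⇔)
open import Relation.Nullary using (¬_; Dec; yes; no; contradiction)
open import Relation.Nullary.Decidable using (⌊_⌋; ¬?; _×-dec_; toWitness; fromWitness)
open import Relation.Binary.PropositionalEquality
  using (_≡_; _≢_; refl; sym; trans; cong; cong₂; subst; module ≡-Reasoning)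

-- The order of `G` is unbounded, yet elements must be told apart, so inequalities come only from
-- rank three and from a few words, such as `x²`, assumed nontrivial in the case at hand. Equations
-- are settled by reflection: an explicit list of relator insertions takes a word to the empty one,
-- and evaluation checks the list; hence the many side conditions of type `T` that are solved
-- silently or by `tt`. Where nothing bounds the order, only arrows between elements of `S` can be
-- computed, and formulas speak of the digraph induced on `S`. Where the relations force order at
-- most 64, a normal form names every vertex and formulas range over the whole digraph. The
-- exceptional groups are given by a universal property, which extends maps of generators to
-- endomorphisms but makes no word nontrivial; there too, nontriviality has to come from rank three
-- or from a case distinction.

-- Words, free reduction and checked derivations

Letter : ℕ → Set
Letter k = Fin k × Bool

String : ℕ → Set
String k = List (Letter k)

opposite : ∀ {k} → Letter k → Letter k
opposite (i , b) = i , not b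

same : ∀ {k} → Letter k → Letter k → Bool
same (i , true)  (j , true)  = ⌊ i ≟F j ⌋
same (i , false) (j , false) = ⌊ i ≟F j ⌋
same _           _           = false

same-sound : ∀ {k} (l m : Letter k) → T (same l m) → l ≡ m
same-sound (i , true)  (j , true)  t with yes refl ← i ≟F j = refl
same-sound (i , false) (j , false) t with yes refl ← i ≟F j = refl

sameString : ∀ {k} → String k → String k → Bool
sameString []      []      = true
sameString (l ∷ u) (m ∷ v) = same l m ∧ sameString u v
sameString _       _       = false

sameString-sound : ∀ {k} (u v : String k) → T (sameString u v) → u ≡ v
sameString-sound []      []      t = refl
sameString-sound (l ∷ u) (m ∷ v) t with Equivalence.to T-∧ t
... | p , q = cong₂ _∷_ (same-sound l m p) (sameString-sound u v q)

inverse : ∀ {k} → String k → String k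
inverse []      = []
inverse (l ∷ w) = inverse w ++ opposite l ∷ []

flatten : ∀ {k} → Word k → String k
flatten (var i) = (i , true) ∷ []
flatten e       = []
flatten (u · v) = flatten u ++ flatten v
flatten (u ⁻)   = inverse (flatten u)

cancel : ∀ {k} → Letter k → String k → String k
cancel l []      = l ∷ []
cancel l (m ∷ w) = if same (opposite l) m then w else l ∷ m ∷ w

reduce : ∀ {k} → String k → String k
reduce = foldr cancel []

rotate : ∀ {k} → ℕ → String k → String k
rotate n w = drop n w ++ take n w

relator : ∀ {k} → Relation k → String k
relator (u , v) = flatten u ++ inverse (flatten v)

-- An index beyond the list yields the empty word, which is trivial in every group, so derivations
-- stay sound without a bounds check.
nth : ∀ {k} → List (Relation k) → ℕ → String k
nth []      n       = []
nth (r ∷ R) zero    = relator r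
nth (r ∷ R) (suc n) = nth R n

-- (p , i , n , s): insert at position p the i-th relator rotated by n letters (inverted if s is false).
Step : Set
Step = ℕ × ℕ × ℕ × Bool

insertion : ∀ {k} → List (Relation k) → Step → String k → String k
insertion R (p , i , n , true)  w = reduce (take p w ++ rotate n (nth R i) ++ drop p w)
insertion R (p , i , n , false) w = reduce (take p w ++ inverse (rotate n (nth R i)) ++ drop p w)

insertions : ∀ {k} → List (Relation k) → List Step → String k → String k
insertions R []       w = w
insertions R (s ∷ ss) w = insertions R ss (insertion R s w)

-- Inserting a rotated relator anywhere multiplies a word by a conjugate of a relator, so success
-- exhibits `u v⁻¹` as a product of such conjugates. With no relators and no steps this is equality
-- in the free group.
derives : ∀ {k} → List (Relation k) → Relation k → List Step → Bool
derives R r ss = null (insertions R ss (reduce (relator r)))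

derivesAll : ∀ {k} → List (Relation k) → List (Relation k) → List (List Step) → Bool
derivesAll R []       _          = true
derivesAll R (r ∷ rs) []         = derives R r [] ∧ derivesAll R rs []
derivesAll R (r ∷ rs) (ss ∷ sss) = derives R r ss ∧ derivesAll R rs sss

substitute : ∀ {k l} → (Fin k → Word l) → Word k → Word l
substitute f (var i) = f i
substitute f e       = e
substitute f (u · v) = substitute f u · substitute f v
substitute f (u ⁻)   = substitute f u ⁻

occurrences : ∀ {k} → Fin k → String k → ℕ
occurrences g []            = zero
occurrences g ((i , _) ∷ w) = if ⌊ g ≟F i ⌋ then suc (occurrences g w) else occurrences g w

one? : ℕ → Bool
one? (suc zero) = true
one? _          = false

once : ∀ {k} → String k → Bool
once w = any (λ g → one? (occurrences g w)) (allFin _)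

any-witness : ∀ {A : Set} (p : A → Bool) (xs : List A) → T (any p xs) → ∃ λ x → T (p x)
any-witness p (x ∷ xs) t with Equivalence.to T-∨ t
... | inj₁ q = x , q
... | inj₂ q = any-witness p xs q

-- Soundness of derivations in a group

module GroupOf (G : FinGroup) where
  group : Group _ _
  group = record { isGroup = FinGroup.isGroup G }
  open Group group public using (_∙_; ε; _⁻¹; assoc; identityˡ; identityʳ; inverseˡ; inverseʳ)
  open GroupProperties group public
    using (⁻¹-involutive; ⁻¹-anti-homo-∙; ε⁻¹≈ε; ∙-cancelˡ; ∙-cancelʳ; inverseˡ-unique; inverseʳ-unique)

  C : Set
  C = Carrier G

  _≟_ : (g h : C) → Dec (g ≡ h)
  _≟_ = _≟F_

module Eval (G : FinGroup) {k : ℕ} (a : Fin k → Carrier G) where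
  open GroupOf G
  open ≡-Reasoning

  ⟦_⟧ : Word k → C
  ⟦_⟧ = eval G a

  letter : Letter k → C
  letter (i , true)  = a i
  letter (i , false) = a i ⁻¹

  ⟪_⟫ : String k → C
  ⟪ [] ⟫    = ε
  ⟪ l ∷ w ⟫ = letter l ∙ ⟪ w ⟫

  letter-opposite : ∀ l → letter (opposite l) ≡ letter l ⁻¹
  letter-opposite (i , true)  = refl
  letter-opposite (i , false) = sym (⁻¹-involutive (a i))

  ⟪⟫-++ : ∀ u v → ⟪ u ++ v ⟫ ≡ ⟪ u ⟫ ∙ ⟪ v ⟫
  ⟪⟫-++ []      v = sym (identityˡ _)
  ⟪⟫-++ (l ∷ u) v = trans (cong (letter l ∙_) (⟪⟫-++ u v)) (sym (assoc _ _ _))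

  ⟪⟫-inverse : ∀ w → ⟪ inverse w ⟫ ≡ ⟪ w ⟫ ⁻¹
  ⟪⟫-inverse []      = sym ε⁻¹≈ε
  ⟪⟫-inverse (l ∷ w) = begin
    ⟪ inverse w ++ opposite l ∷ [] ⟫       ≡⟨ ⟪⟫-++ (inverse w) _ ⟩
    ⟪ inverse w ⟫ ∙ (letter (opposite l) ∙ ε) ≡⟨ cong₂ _∙_ (⟪⟫-inverse w) (trans (identityʳ _) (letter-opposite l)) ⟩
    ⟪ w ⟫ ⁻¹ ∙ letter l ⁻¹                 ≡⟨ sym (⁻¹-anti-homo-∙ _ _) ⟩
    (letter l ∙ ⟪ w ⟫) ⁻¹                  ∎

  ⟪⟫-flatten : ∀ u → ⟪ flatten u ⟫ ≡ ⟦ u ⟧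
  ⟪⟫-flatten (var i) = identityʳ _
  ⟪⟫-flatten e       = refl
  ⟪⟫-flatten (u · v) = trans (⟪⟫-++ (flatten u) _) (cong₂ _∙_ (⟪⟫-flatten u) (⟪⟫-flatten v))
  ⟪⟫-flatten (u ⁻)   = trans (⟪⟫-inverse (flatten u)) (cong _⁻¹ (⟪⟫-flatten u))

  ⟪⟫-cancel : ∀ l w → ⟪ cancel l w ⟫ ≡ letter l ∙ ⟪ w ⟫
  ⟪⟫-cancel l []      = refl
  ⟪⟫-cancel l (m ∷ w) with same (opposite l) m in eq
  ... | false = refl
  ... | true with refl ← same-sound (opposite l) m (subst T (sym eq) tt) = begin
    ⟪ w ⟫                                     ≡⟨ sym (identityˡ _) ⟩
    ε ∙ ⟪ w ⟫                                 ≡⟨ cong (_∙ ⟪ w ⟫) (sym (inverseʳ _)) ⟩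
    letter l ∙ letter l ⁻¹ ∙ ⟪ w ⟫            ≡⟨ assoc _ _ _ ⟩
    letter l ∙ (letter l ⁻¹ ∙ ⟪ w ⟫)          ≡⟨ cong (λ t → letter l ∙ (t ∙ ⟪ w ⟫)) (sym (letter-opposite l)) ⟩
    letter l ∙ (letter (opposite l) ∙ ⟪ w ⟫)  ∎

  ⟪⟫-reduce : ∀ w → ⟪ reduce w ⟫ ≡ ⟪ w ⟫
  ⟪⟫-reduce []      = refl
  ⟪⟫-reduce (l ∷ w) = trans (⟪⟫-cancel l (reduce w)) (cong (letter l ∙_) (⟪⟫-reduce w))

  ⟪⟫-split : ∀ n w → ⟪ w ⟫ ≡ ⟪ take n w ⟫ ∙ ⟪ drop n w ⟫
  ⟪⟫-split n w = trans (cong ⟪_⟫ (sym (take++drop≡id n w))) (⟪⟫-++ (take n w) (drop n w))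

  conjugate-trivial : ∀ {g h} → g ∙ h ≡ ε → h ∙ g ≡ ε
  conjugate-trivial {g} {h} eq = begin
    h ∙ g         ≡⟨ cong (_∙ g) (inverseʳ-unique g h eq) ⟩
    g ⁻¹ ∙ g      ≡⟨ inverseˡ g ⟩
    ε             ∎

  ⟪⟫-rotate : ∀ n w → ⟪ w ⟫ ≡ ε → ⟪ rotate n w ⟫ ≡ ε
  ⟪⟫-rotate n w eq =
    trans (⟪⟫-++ (drop n w) (take n w)) (conjugate-trivial (trans (sym (⟪⟫-split n w)) eq))

  ⟪⟫-relator : ∀ u v → ⟪ relator (u , v) ⟫ ≡ ⟦ u ⟧ ∙ ⟦ v ⟧ ⁻¹
  ⟪⟫-relator u v = trans (⟪⟫-++ (flatten u) _)
    (cong₂ _∙_ (⟪⟫-flatten u) (trans (⟪⟫-inverse (flatten v)) (cong _⁻¹ (⟪⟫-flatten v))))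

  quotient-trivial : ∀ {g h} → g ∙ h ⁻¹ ≡ ε → g ≡ h
  quotient-trivial {g} {h} eq = trans (inverseˡ-unique g (h ⁻¹) eq) (⁻¹-involutive h)

  trivial-quotient : ∀ {g h} → g ≡ h → g ∙ h ⁻¹ ≡ ε
  trivial-quotient {g} refl = inverseʳ g

  ⟪⟫-nth : ∀ {R} → Satisfies G a R → ∀ n → ⟪ nth R n ⟫ ≡ ε
  ⟪⟫-nth []                n       = refl
  ⟪⟫-nth {(u , v) ∷ R} (p ∷ ps) zero    = trans (⟪⟫-relator u v) (trivial-quotient p)
  ⟪⟫-nth (p ∷ ps)          (suc n) = ⟪⟫-nth ps n

  private
    ⟪⟫-insert : ∀ p r w → ⟪ r ⟫ ≡ ε → ⟪ reduce (take p w ++ r ++ drop p w) ⟫ ≡ ⟪ w ⟫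
    ⟪⟫-insert p r w eq = begin
      ⟪ reduce (take p w ++ r ++ drop p w) ⟫         ≡⟨ ⟪⟫-reduce (take p w ++ r ++ drop p w) ⟩
      ⟪ take p w ++ r ++ drop p w ⟫                  ≡⟨ ⟪⟫-++ (take p w) _ ⟩
      ⟪ take p w ⟫ ∙ ⟪ r ++ drop p w ⟫               ≡⟨ cong (⟪ take p w ⟫ ∙_) (⟪⟫-++ r _) ⟩
      ⟪ take p w ⟫ ∙ (⟪ r ⟫ ∙ ⟪ drop p w ⟫)          ≡⟨ cong (λ t → ⟪ take p w ⟫ ∙ (t ∙ ⟪ drop p w ⟫)) eq ⟩
      ⟪ take p w ⟫ ∙ (ε ∙ ⟪ drop p w ⟫)              ≡⟨ cong (⟪ take p w ⟫ ∙_) (identityˡ _) ⟩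
      ⟪ take p w ⟫ ∙ ⟪ drop p w ⟫                    ≡⟨ sym (⟪⟫-split p w) ⟩
      ⟪ w ⟫                                          ∎

  ⟪⟫-insertion : ∀ {R} → Satisfies G a R → ∀ s w → ⟪ insertion R s w ⟫ ≡ ⟪ w ⟫
  ⟪⟫-insertion {R} sat (p , i , n , true) w =
    ⟪⟫-insert p (rotate n (nth R i)) w (⟪⟫-rotate n (nth R i) (⟪⟫-nth sat i))
  ⟪⟫-insertion {R} sat (p , i , n , false) w =
    ⟪⟫-insert p (inverse (rotate n (nth R i))) w
      (trans (⟪⟫-inverse (rotate n (nth R i)))
        (trans (cong _⁻¹ (⟪⟫-rotate n (nth R i) (⟪⟫-nth sat i))) ε⁻¹≈ε))

  ⟪⟫-insertions : ∀ {R} → Satisfies G a R → ∀ ss w → ⟪ insertions R ss w ⟫ ≡ ⟪ w ⟫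
  ⟪⟫-insertions sat []       w = refl
  ⟪⟫-insertions sat (s ∷ ss) w = trans (⟪⟫-insertions sat ss _) (⟪⟫-insertion sat s w)

  null-trivial : ∀ w → T (null w) → ⟪ w ⟫ ≡ ε
  null-trivial [] t = refl

  -- For concrete words the implicit argument evaluates to the unit type and is filled in
  -- automatically, so an equation costs only its list of steps.
  consequence : ∀ {R} → Satisfies G a R → ∀ (r : Relation k) ss → {_ : T (derives R r ss)} →
                ⟦ proj₁ r ⟧ ≡ ⟦ proj₂ r ⟧
  consequence {R} sat r ss {t} = quotient-trivial (begin
    ⟦ proj₁ r ⟧ ∙ ⟦ proj₂ r ⟧ ⁻¹                 ≡⟨ sym (⟪⟫-relator (proj₁ r) (proj₂ r)) ⟩
    ⟪ relator r ⟫                                ≡⟨ sym (⟪⟫-reduce (relator r)) ⟩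
    ⟪ reduce (relator r) ⟫                       ≡⟨ sym (⟪⟫-insertions sat ss _) ⟩
    ⟪ insertions R ss (reduce (relator r)) ⟫     ≡⟨ null-trivial _ t ⟩
    ε                                            ∎)

  consequences : ∀ {R} → Satisfies G a R → ∀ rs sss → {_ : T (derivesAll R rs sss)} → Satisfies G a rs
  consequences sat []       sss            = []
  consequences {R} sat (r ∷ rs) []         {t} with Equivalence.to (T-∧ {derives R r []}) t
  ... | p , q = consequence sat r [] {p} ∷ consequences sat rs [] {q}
  consequences {R} sat (r ∷ rs) (ss ∷ sss) {t} with Equivalence.to (T-∧ {derives R r ss}) t
  ... | p , q = consequence sat r ss {p} ∷ consequences sat rs sss {q}

  free-identity : ∀ (r : Relation k) → {_ : T (derives [] r [])} → ⟦ proj₁ r ⟧ ≡ ⟦ proj₂ r ⟧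
  free-identity r {t} = consequence [] r [] {t}

-- Substitution and change of generators

eval-substitute : ∀ G {k l} (a : Fin l → Carrier G) (f : Fin k → Word l) u →
                  eval G (λ i → eval G a (f i)) u ≡ eval G a (substitute f u)
eval-substitute G a f (var i) = refl
eval-substitute G a f e       = refl
eval-substitute G a f (u · v) = cong₂ (FinGroup._∙_ G) (eval-substitute G a f u) (eval-substitute G a f v)
eval-substitute G a f (u ⁻)   = cong (FinGroup._⁻¹ G) (eval-substitute G a f u)

module Generation (G : FinGroup) where
  open GroupOf G

  ⟨⟩-map : ∀ {k l} {a : Fin k → C} {b : Fin l → C} → (∀ i → ⟨_⟩ G b (a i)) → ∀ {g} → ⟨_⟩ G a g → ⟨_⟩ G b g
  ⟨⟩-map f (gen i)   = f i
  ⟨⟩-map f one       = one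
  ⟨⟩-map f (mul p q) = mul (⟨⟩-map f p) (⟨⟩-map f q)
  ⟨⟩-map f (inv p)   = inv (⟨⟩-map f p)

  ⟨⟩-eval : ∀ {k} (a : Fin k → C) u → ⟨_⟩ G a (eval G a u)
  ⟨⟩-eval a (var i) = gen i
  ⟨⟩-eval a e       = one
  ⟨⟩-eval a (u · v) = mul (⟨⟩-eval a u) (⟨⟩-eval a v)
  ⟨⟩-eval a (u ⁻)   = inv (⟨⟩-eval a u)

  -- The words `f′` write each old generator in terms of the new ones `f`, which is exactly what
  -- makes the new ones generate; the identities are required to hold in the free group.
  basis : ∀ {k l} → (Fin k → Word l) → (Fin l → Word k) → Bool
  basis f f′ = all (λ i → derives [] (substitute f (f′ i) ≐ var i) []) (allFin _)

  all-lookup : ∀ {n} (p : Fin n → Bool) → T (all p (allFin n)) → ∀ i → T (p i)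
  all-lookup p t i = go _ t (∈-allFin i)
    where
    go : ∀ xs → T (all p xs) → ∀ {i} → i ∈ xs → T (p i)
    go (x ∷ xs) t (here refl) = proj₁ (Equivalence.to T-∧ t)
    go (x ∷ xs) t (there m)   = go xs (proj₂ (Equivalence.to T-∧ t)) m

  change-generators : ∀ {k l} {a : Fin l → C} → Generates G a → (f : Fin k → Word l) (f′ : Fin l → Word k) →
                      {_ : T (basis f f′)} → Generates G (λ i → eval G a (f i))
  change-generators {a = a} gn f f′ {t} g = ⟨⟩-map (λ i → subst (⟨_⟩ G _)
      (trans (eval-substitute G a f (f′ i)) (Eval.free-identity G a (substitute f (f′ i) ≐ var i) {all-lookup _ t i}))
      (⟨⟩-eval _ (f′ i))) (gn g)

-- Independence of three generators

NotGeneratedByTwo : FinGroup → Set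
NotGeneratedByTwo G = ¬ GeneratedBy G 2

module Independence (G : FinGroup) (rank : NotGeneratedByTwo G) (a : Fin 3 → Carrier G) (gn : Generates G a) where
  open GroupOf G
  open Eval G a
  open Generation G
  open ≡-Reasoning

  private
    module _ (g : Fin 3) where
      others : Fin 2 → C
      others j = a (punchIn g j)

      other : ∀ i → g ≢ i → ⟨_⟩ G others (a i)
      other i g≢i = subst (λ t → ⟨_⟩ G others (a t)) (punchIn-punchOut g≢i) (gen (punchOut g≢i))

      other-letter : ∀ i b → g ≢ i → ⟨_⟩ G others (letter (i , b))
      other-letter i true  g≢i = other i g≢i
      other-letter i false g≢i = inv (other i g≢i)

      redundant : ¬ ⟨_⟩ G others (a g)
      redundant p = rank (others , λ h → ⟨⟩-map from-others (gn h))
        where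
        from-others : ∀ i → ⟨_⟩ G others (a i)
        from-others i with g ≟F i
        ... | yes refl = p
        ... | no  g≢i  = other i g≢i

      none : ∀ w → occurrences g w ≡ 0 → ⟨_⟩ G others ⟪ w ⟫
      none []            eq = one
      none ((i , b) ∷ w) eq with g ≟F i
      ... | no g≢i = mul (other-letter i b g≢i) (none w eq)

      unletter : ∀ b → ⟨_⟩ G others (letter (g , b)) → ⟨_⟩ G others (a g)
      unletter true  p = p
      unletter false p = subst (⟨_⟩ G others) (⁻¹-involutive _) (inv p)

      -- Letters before the only occurrence of `g` are divided off on the left, and the rest of the
      -- word on the right. All of these lie in the subgroup of the other two generators, so the
      -- isolated letter does as well.
      single : ∀ w → T (one? (occurrences g w)) → ⟨_⟩ G others ⟪ w ⟫ → ⟨_⟩ G others (a g)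
      single ((i , b) ∷ w) t p with g ≟F i
      ... | yes refl = unletter b (subst (⟨_⟩ G others) eq (mul p (inv (none w (is-zero _ t)))))
        where
        is-zero : ∀ n → T (one? (suc n)) → n ≡ 0
        is-zero zero t = refl
        eq : letter (i , b) ∙ ⟪ w ⟫ ∙ ⟪ w ⟫ ⁻¹ ≡ letter (i , b)
        eq = trans (assoc _ _ _) (trans (cong (letter (i , b) ∙_) (inverseʳ _)) (identityʳ _))
      ... | no g≢i = single w t (subst (⟨_⟩ G others) eq (mul (inv (other-letter i b g≢i)) p))
        where
        eq : letter (i , b) ⁻¹ ∙ (letter (i , b) ∙ ⟪ w ⟫) ≡ ⟪ w ⟫
        eq = trans (sym (assoc _ _ _)) (trans (cong (_∙ ⟪ w ⟫) (inverseˡ _)) (identityˡ _))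

  once-nontrivial : ∀ w → T (once w) → ⟪ w ⟫ ≢ ε
  once-nontrivial w t eq with any-witness (λ g → one? (occurrences g w)) (allFin 3) t
  ... | g , p = redundant g (single g w p (subst (⟨_⟩ G (others g)) (sym eq) one))

  -- A relation in which some generator occurs exactly once would make that generator redundant.
  primitive-≢ : ∀ (r : Relation 3) → {_ : T (once (reduce (relator r)))} → ⟦ proj₁ r ⟧ ≢ ⟦ proj₂ r ⟧
  primitive-≢ r {t} eq = once-nontrivial (reduce (relator r)) t (begin
    ⟪ reduce (relator r) ⟫      ≡⟨ ⟪⟫-reduce (relator r) ⟩
    ⟪ relator r ⟫               ≡⟨ ⟪⟫-relator (proj₁ r) (proj₂ r) ⟩
    ⟦ proj₁ r ⟧ ∙ ⟦ proj₂ r ⟧ ⁻¹ ≡⟨ trivial-quotient eq ⟩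
    ε                           ∎)

-- Boolean reflection and the image of a finite family

T-≡-iff : ∀ {a b} → (T a → T b) → (T b → T a) → a ≡ b
T-≡-iff {true}  {true}  f g = refl
T-≡-iff {true}  {false} f g = ⊥-elim (f tt)
T-≡-iff {false} {true}  f g = ⊥-elim (g tt)
T-≡-iff {false} {false} f g = refl

any-∈ : ∀ {A : Set} (p : A → Bool) {xs} → T (any p xs) → ∃ λ x → x ∈ xs × T (p x)
any-∈ p {x ∷ xs} t with Equivalence.to T-∨ t
... | inj₁ q = x , here refl , q
... | inj₂ q with any-∈ p q
...   | y , m , r = y , there m , r

∈-any : ∀ {A : Set} (p : A → Bool) {xs x} → x ∈ xs → T (p x) → T (any p xs)
∈-any p (here refl) t = Equivalence.from T-∨ (inj₁ t)
∈-any p {y ∷ _} (there m) t = Equivalence.from (T-∨ {p y}) (inj₂ (∈-any p m t))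

all-∈ : ∀ {A : Set} (p : A → Bool) {xs x} → T (all p xs) → x ∈ xs → T (p x)
all-∈ p t (here refl) = proj₁ (Equivalence.to T-∧ t)
all-∈ p {y ∷ _} t (there m) = all-∈ p (proj₂ (Equivalence.to (T-∧ {p y}) t)) m

module Image {n m : ℕ} (s : Fin m → Fin n) where
  image : Subset n
  image = tabulate λ g → ⌊ FinP.any? (λ i → s i FinP.≟ g) ⌋

  ∈-image : ∀ i → s i Sub.∈ image
  ∈-image i = lookup⇒[]= (s i) image
    (trans (lookup∘tabulate _ (s i)) (Equivalence.to T-≡ (fromWitness {a? = FinP.any? λ j → s j FinP.≟ s i} (i , refl))))

  image-∈ : ∀ {g} → g Sub.∈ image → ∃ λ i → s i ≡ g
  image-∈ {g} p = toWitness {a? = FinP.any? λ i → s i FinP.≟ g}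
    (subst T (trans (sym ([]=⇒lookup p)) (lookup∘tabulate _ g)) tt)

-- Automorphisms of Cayley digraphs and modal definability

module Rigidity (G : FinGroup) {m : ℕ} (s : Fin m → Carrier G) where
  open GroupOf G
  open ≡-Reasoning
  open Image s

  -- Arcs are expressed through the family `s`: `forth` sends arcs to arcs, and `back` lifts each
  -- arc that leaves `ψ x`. A function with separate surjectivity and injectivity is easier to
  -- conjugate than a permutation with its inverse.
  record IsAut (ψ : C → C) : Set where
    field
      surjective : ∀ y → ∃ λ x → ψ x ≡ y
      injective  : ∀ {x y} → ψ x ≡ ψ y → x ≡ y
      forth      : ∀ x i → ∃ λ j → ψ (s i ∙ x) ≡ s j ∙ ψ x
      back       : ∀ x j → ∃ λ i → ψ (s i ∙ x) ≡ s j ∙ ψ x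
  open IsAut

  cancelʳ : ∀ g h → g ∙ h ∙ h ⁻¹ ≡ g
  cancelʳ g h = trans (assoc g h _) (trans (cong (g ∙_) (inverseʳ h)) (identityʳ g))

  cancelʳ′ : ∀ g h → g ∙ h ⁻¹ ∙ h ≡ g
  cancelʳ′ g h = trans (assoc g _ h) (trans (cong (g ∙_) (inverseˡ h)) (identityʳ g))

  cancelˡ : ∀ g h → g ⁻¹ ∙ (g ∙ h) ≡ h
  cancelˡ g h = trans (sym (assoc _ g h)) (trans (cong (_∙ h) (inverseˡ g)) (identityˡ h))

  cancelˡ′ : ∀ g h → g ∙ (g ⁻¹ ∙ h) ≡ h
  cancelˡ′ g h = trans (sym (assoc g _ h)) (trans (cong (_∙ h) (inverseʳ g)) (identityˡ h))

  -- Right translations are automorphisms. Composing `ψ` with the translations by `x` and by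
  -- `ψ x ⁻¹` produces an automorphism fixing the identity, so that every question reduces to the
  -- stabiliser.
  conjugate : ∀ {ψ} → IsAut ψ → ∀ x → IsAut (λ y → ψ (y ∙ x) ∙ ψ x ⁻¹)
  conjugate {ψ} A x = record
    { surjective = λ y → let z , eq = surjective A (y ∙ ψ x) in z ∙ x ⁻¹ , (begin
        ψ (z ∙ x ⁻¹ ∙ x) ∙ ψ x ⁻¹ ≡⟨ cong (λ t → ψ t ∙ ψ x ⁻¹) (cancelʳ′ z x) ⟩
        ψ z ∙ ψ x ⁻¹              ≡⟨ cong (_∙ ψ x ⁻¹) eq ⟩
        y ∙ ψ x ∙ ψ x ⁻¹          ≡⟨ cancelʳ y (ψ x) ⟩
        y                         ∎)
    ; injective  = λ eq → ∙-cancelʳ x _ _ (injective A (∙-cancelʳ (ψ x ⁻¹) _ _ eq))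
    ; forth      = λ y i → let j , eq = forth A (y ∙ x) i in j , shift i j y eq
    ; back       = λ y j → let i , eq = back A (y ∙ x) j in i , shift i j y eq
    }
    where
    shift : ∀ i j y → ψ (s i ∙ (y ∙ x)) ≡ s j ∙ ψ (y ∙ x) →
            ψ (s i ∙ y ∙ x) ∙ ψ x ⁻¹ ≡ s j ∙ (ψ (y ∙ x) ∙ ψ x ⁻¹)
    shift i j y eq = begin
      ψ (s i ∙ y ∙ x) ∙ ψ x ⁻¹       ≡⟨ cong (λ t → ψ t ∙ ψ x ⁻¹) (assoc _ y x) ⟩
      ψ (s i ∙ (y ∙ x)) ∙ ψ x ⁻¹     ≡⟨ cong (_∙ ψ x ⁻¹) eq ⟩
      s j ∙ ψ (y ∙ x) ∙ ψ x ⁻¹       ≡⟨ assoc _ _ _ ⟩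
      s j ∙ (ψ (y ∙ x) ∙ ψ x ⁻¹)     ∎

  -- Equivalently: ψ g ≡ g for every automorphism ψ with ψ ε ≡ ε.
  Fixed : C → Set
  Fixed g = ∀ ψ → IsAut ψ → ∀ x → ψ (g ∙ x) ≡ g ∙ ψ x

  fixed-at-ε : ∀ {g} → (∀ ψ → IsAut ψ → ψ ε ≡ ε → ψ g ≡ g) → Fixed g
  fixed-at-ε {g} f ψ A x = begin
    ψ (g ∙ x)                     ≡⟨ sym (cancelʳ′ _ (ψ x)) ⟩
    ψ (g ∙ x) ∙ ψ x ⁻¹ ∙ ψ x      ≡⟨ cong (_∙ ψ x) (f _ (conjugate A x) eq) ⟩
    g ∙ ψ x                       ∎
    where
    eq : ψ (ε ∙ x) ∙ ψ x ⁻¹ ≡ ε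
    eq = trans (cong (λ t → ψ t ∙ ψ x ⁻¹) (identityˡ x)) (inverseʳ (ψ x))

  fixed-point : ∀ {g ψ} → Fixed g → IsAut ψ → ψ ε ≡ ε → ψ g ≡ g
  fixed-point {g} {ψ} f A eq = begin
    ψ g         ≡⟨ cong ψ (sym (identityʳ g)) ⟩
    ψ (g ∙ ε)   ≡⟨ f ψ A ε ⟩
    g ∙ ψ ε     ≡⟨ cong (g ∙_) eq ⟩
    g ∙ ε       ≡⟨ identityʳ g ⟩
    g           ∎

  Fixed-∙ : ∀ {g h} → Fixed g → Fixed h → Fixed (g ∙ h)
  Fixed-∙ {g} {h} p q ψ A x = begin
    ψ (g ∙ h ∙ x)     ≡⟨ cong ψ (assoc g h x) ⟩
    ψ (g ∙ (h ∙ x))   ≡⟨ p ψ A _ ⟩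
    g ∙ ψ (h ∙ x)     ≡⟨ cong (g ∙_) (q ψ A x) ⟩
    g ∙ (h ∙ ψ x)     ≡⟨ sym (assoc g h _) ⟩
    g ∙ h ∙ ψ x       ∎

  Fixed-⁻¹ : ∀ {g} → Fixed g → Fixed (g ⁻¹)
  Fixed-⁻¹ {g} p ψ A x = ∙-cancelˡ g _ _ (begin
    g ∙ ψ (g ⁻¹ ∙ x)     ≡⟨ sym (p ψ A _) ⟩
    ψ (g ∙ (g ⁻¹ ∙ x))   ≡⟨ cong ψ (cancelˡ′ g x) ⟩
    ψ x                  ≡⟨ sym (cancelˡ′ g (ψ x)) ⟩
    g ∙ (g ⁻¹ ∙ ψ x)     ∎)

  Fixed-⟨⟩ : ∀ {k} {b : Fin k → C} → (∀ i → Fixed (b i)) → ∀ {g} → ⟨_⟩ G b g → Fixed g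
  Fixed-⟨⟩ p (gen i)     = p i
  Fixed-⟨⟩ p one ψ A x   = trans (cong ψ (identityˡ x)) (sym (identityˡ _))
  Fixed-⟨⟩ p (mul q r)   = Fixed-∙ (Fixed-⟨⟩ p q) (Fixed-⟨⟩ p r)
  Fixed-⟨⟩ p (inv q)     = Fixed-⁻¹ (Fixed-⟨⟩ p q)

  s-neighbour : ∀ {ψ} → IsAut ψ → ψ ε ≡ ε → ∀ i → ∃ λ j → ψ (s i) ≡ s j
  s-neighbour {ψ} A eq i with forth A ε i
  ... | j , q = j , trans (cong ψ (sym (identityʳ _))) (trans q (trans (cong (s j ∙_) eq) (identityʳ _)))

  -- The image of `s i` is some `s j`. If `j` differs from `i`, then `s j` is also its own image,
  -- and injectivity forces `s i = s j`, so the image is `s i` all the same.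
  fixed-last : ∀ i → (∀ j → j ≢ i → Fixed (s j)) → Fixed (s i)
  fixed-last i p = fixed-at-ε λ ψ A eq → case ψ A eq (s-neighbour A eq i)
    where
    case : ∀ ψ (A : IsAut ψ) → ψ ε ≡ ε → (∃ λ j → ψ (s i) ≡ s j) → ψ (s i) ≡ s i
    case ψ A eq (j , q) with j FinP.≟ i
    ... | yes refl = q
    ... | no j≢i   = trans q (sym (injective A (trans q (sym (fixed-point (p j j≢i) A eq)))))

  Oriented : Set
  Oriented = ∀ i j → s i ∙ s j ≢ ε

  -- Once every element is `Fixed`, `φ x = φ (x ε) = x φ ε`, a right translation. `Oriented` covers
  -- `i = j`, which keeps involutions and the identity out of the set.
  orr : Oriented → ∀ {k} {b : Fin k → C} → Generates G b → (∀ i → Fixed (b i)) → HasORR G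
  orr oriented gn fixed = image , antisymmetric , regular
    where
    antisymmetric : ∀ g → g Sub.∈ image → ¬ ((g ⁻¹) Sub.∈ image)
    antisymmetric g p q with image-∈ p | image-∈ q
    ... | i , refl | j , eq = oriented i j (trans (cong (s i ∙_) eq) (inverseʳ _))

    arc : ∀ i x → Arc G image x (s i ∙ x)
    arc i x = subst (Sub._∈ image) (sym (cancelʳ (s i) x)) (∈-image i)

    arc-∃ : ∀ {x y} → Arc G image x y → ∃ λ i → y ≡ s i ∙ x
    arc-∃ {x} {y} p with image-∈ p
    ... | i , eq = i , trans (sym (cancelʳ′ y x)) (cong (_∙ x) (sym eq))

    aut : ∀ φ → IsCayleyAut G image φ → IsAut (φ ⟨$⟩ʳ_)
    aut φ h = record
      { surjective = λ y → φ ⟨$⟩ˡ y , ⟨$⟩-inverseʳ φ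
      ; injective  = λ {x} {y} eq → trans (sym (⟨$⟩-inverseˡ φ)) (trans (cong (φ ⟨$⟩ˡ_) eq) (⟨$⟩-inverseˡ φ))
      ; forth      = λ x i → arc-∃ (Equivalence.to (h x _) (arc i x))
      ; back       = back′
      }
      where
      back′ : ∀ x j → ∃ λ i → φ ⟨$⟩ʳ (s i ∙ x) ≡ s j ∙ (φ ⟨$⟩ʳ x)
      back′ x j with arc-∃ (Equivalence.from (h x (φ ⟨$⟩ˡ (s j ∙ (φ ⟨$⟩ʳ x))))
                     (subst (Arc G image _) (sym (⟨$⟩-inverseʳ φ)) (arc j _)))
      ... | i , eq = i , trans (cong (φ ⟨$⟩ʳ_) (sym eq)) (⟨$⟩-inverseʳ φ)

    regular : IsDRR G image
    regular φ h = φ ⟨$⟩ʳ ε , λ x → trans (cong (φ ⟨$⟩ʳ_) (sym (identityʳ x)))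
      (Fixed-⟨⟩ fixed (gn x) (φ ⟨$⟩ʳ_) (aut φ h) ε)

  -- Modal definability: subsets of a vertex type V, marked in the Cayley digraph by pt, that are
  -- carried to themselves by every automorphism fixing ε.
  module Definable {V : Set} (pt : V → C) where

    -- Predicates live on names, and several names may denote one vertex; invariance is therefore
    -- required for all names of a vertex and of its image.
    record Invariant : Set where
      field
        holds : V → Bool
        invariant : ∀ {ψ} → IsAut ψ → ψ ε ≡ ε → ∀ {v w} → ψ (pt v) ≡ pt w → holds v ≡ holds w
    open Invariant public

    -- These are the zig and zag conditions of a bisimulation, for the relation `ψ (pt v) = pt w`
    -- between names. Modal formulas are invariant under bisimulation, which is what `◇` relies on.
    record Neighbourhood : Set where
      field
        near : V → List V
        zig  : ∀ {ψ} → IsAut ψ → ψ ε ≡ ε → ∀ {v w} → ψ (pt v) ≡ pt w →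
               ∀ {v′} → v′ ∈ near v → ∃ λ w′ → w′ ∈ near w × ψ (pt v′) ≡ pt w′
        zag  : ∀ {ψ} → IsAut ψ → ψ ε ≡ ε → ∀ {v w} → ψ (pt v) ≡ pt w →
               ∀ {w′} → w′ ∈ near w → ∃ λ v′ → v′ ∈ near v × ψ (pt v′) ≡ pt w′
    open Neighbourhood public

    infixr 8 ◇[_]_ ~_
    infixr 7 _&_

    ◇[_]_ : Neighbourhood → Invariant → Invariant
    ◇[ N ] P = record
      { holds = λ v → any (holds P) (near N v)
      ; invariant = λ A eq z → T-≡-iff
          (λ t → let v′ , m , p = any-∈ (holds P) t
                     w′ , m′ , z′ = zig N A eq z m
                 in ∈-any (holds P) m′ (subst T (invariant P A eq z′) p))
          (λ t → let w′ , m , p = any-∈ (holds P) t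
                     v′ , m′ , z′ = zag N A eq z m
                 in ∈-any (holds P) m′ (subst T (sym (invariant P A eq z′)) p))
      }

    ~_ : Invariant → Invariant
    ~ P = record { holds = λ v → not (holds P v) ; invariant = λ A eq z → cong not (invariant P A eq z) }

    _&_ : Invariant → Invariant → Invariant
    P & Q = record { holds = λ v → holds P v ∧ holds Q v
                   ; invariant = λ A eq z → cong₂ _∧_ (invariant P A eq z) (invariant Q A eq z) }

    everything : Invariant
    everything = record { holds = λ _ → true ; invariant = λ _ _ _ → refl }

    -- The image of `s i` is some `s j`, where `P` holds as it does at `s i`. It is enough that `P`
    -- isolates `s i` within the connection set; it may hold at other vertices.
    fixed-by : (P : Invariant) (vs : Fin m → V) → (∀ i → pt (vs i) ≡ s i) → ∀ i →
               (unique : T (all (λ j → ⌊ j FinP.≟ i ⌋ ∨ not (holds P (vs j))) (allFin m))) →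
               (this : T (holds P (vs i))) → Fixed (s i)
    fixed-by P vs eqs i unique this = fixed-at-ε λ ψ A eq → case ψ A eq (s-neighbour A eq i)
      where
      case : ∀ ψ (A : IsAut ψ) → ψ ε ≡ ε → (∃ λ j → ψ (s i) ≡ s j) → ψ (s i) ≡ s i
      case ψ A eq (j , q) with Equivalence.to (T-∨ {⌊ j FinP.≟ i ⌋}) (all-∈ _ unique (∈-allFin j))
      ... | inj₁ t with refl ← toWitness {a? = j FinP.≟ i} t = q
      ... | inj₂ t = ⊥-elim (not-both _ t (subst T (invariant P A eq
                       (trans (cong ψ (eqs i)) (trans q (sym (eqs j))))) this))
        where
        not-both : ∀ b → T (not b) → T b → ⊥
        not-both false t ()

    -- A nominal of hybrid logic: a vertex already known to be fixed may be named in later formulas.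
    constant : ∀ v₀ → Fixed (pt v₀) → (eq? : V → V → Bool) → (∀ {v w} → T (eq? v w) → pt v ≡ pt w) →
               (∀ {v w} → pt v ≡ pt w → T (eq? v w)) → Invariant
    constant v₀ f eq? sound complete = record
      { holds = eq? v₀
      ; invariant = λ {ψ} A eq {v} {w} z → T-≡-iff
          (λ t → complete (trans (sym (fixed-point f A eq)) (trans (cong ψ (sound t)) z)))
          (λ t → complete (injective A (trans (fixed-point f A eq) (trans (sound t) (sym z)))))
      }

  -- The digraph induced on the connection set itself.
  module Local (E : Fin m → Fin m → Bool)
               (E-sound : ∀ i j → T (E i j) → ∃ λ k → s k ∙ s i ≡ s j)
               (E-complete : ∀ i j k → s k ∙ s i ≡ s j → T (E i j)) where
    open Definable s public

    private
      preimage : ∀ {ψ} → IsAut ψ → ψ ε ≡ ε → ∀ j → ∃ λ i → ψ (s i) ≡ s j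
      preimage {ψ} A eq j with back A ε j
      ... | i , q = i , trans (cong ψ (sym (identityʳ _))) (trans q (trans (cong (s j ∙_) eq) (identityʳ _)))

      E-forth : ∀ {ψ} → IsAut ψ → ∀ {i j i′ j′} → ψ (s i) ≡ s i′ → ψ (s j) ≡ s j′ → T (E i j) → T (E i′ j′)
      E-forth {ψ} A {i} {j} {i′} {j′} p q t with E-sound i j t
      ... | k , eq with forth A (s i) k
      ...   | k′ , eq′ = E-complete i′ j′ k′ (begin
        s k′ ∙ s i′       ≡⟨ cong (s k′ ∙_) (sym p) ⟩
        s k′ ∙ ψ (s i)    ≡⟨ sym eq′ ⟩
        ψ (s k ∙ s i)     ≡⟨ cong ψ eq ⟩
        ψ (s j)           ≡⟨ q ⟩
        s j′              ∎)

      E-back : ∀ {ψ} → IsAut ψ → ∀ {i j i′ j′} → ψ (s i) ≡ s i′ → ψ (s j) ≡ s j′ → T (E i′ j′) → T (E i j)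
      E-back {ψ} A {i} {j} {i′} {j′} p q t with E-sound i′ j′ t
      ... | k , eq with back A (s i) k
      ...   | k′ , eq′ = E-complete i j k′ (injective A (begin
        ψ (s k′ ∙ s i)    ≡⟨ eq′ ⟩
        s k ∙ ψ (s i)     ≡⟨ cong (s k ∙_) p ⟩
        s k ∙ s i′        ≡⟨ eq ⟩
        s j′              ≡⟨ sym q ⟩
        ψ (s j)           ∎))

    out into : Neighbourhood
    out = record
      { near = λ i → filter (λ j → T? (E i j)) (allFin m)
      ; zig  = λ {ψ} A eq {v} {w} z {j} mem → let j′ , q = s-neighbour A eq j in
               j′ , ∈-filter⁺ (λ j → T? (E w j)) (∈-allFin j′) (E-forth A z q (proj₂ (∈-filter⁻ (λ j → T? (E v j)) {xs = allFin m} mem))) , q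
      ; zag  = λ {ψ} A eq {v} {w} z {j′} mem → let j , q = preimage A eq j′ in
               j , ∈-filter⁺ (λ j → T? (E v j)) (∈-allFin j) (E-back A z q (proj₂ (∈-filter⁻ (λ j → T? (E w j)) {xs = allFin m} mem))) , q
      }
    into = record
      { near = λ j → filter (λ i → T? (E i j)) (allFin m)
      ; zig  = λ {ψ} A eq {v} {w} z {j} mem → let j′ , q = s-neighbour A eq j in
               j′ , ∈-filter⁺ (λ i → T? (E i w)) (∈-allFin j′) (E-forth A q z (proj₂ (∈-filter⁻ (λ i → T? (E i v)) {xs = allFin m} mem))) , q
      ; zag  = λ {ψ} A eq {v} {w} z {j′} mem → let j , q = preimage A eq j′ in
               j , ∈-filter⁺ (λ i → T? (E i v)) (∈-allFin j) (E-back A q z (proj₂ (∈-filter⁻ (λ i → T? (E i w)) {xs = allFin m} mem))) , q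
      }

    -- A graded modality, for at least two neighbours. Distinct indices count as distinct vertices
    -- only because `s` is injective.
    branching : (∀ {i j} → s i ≡ s j → i ≡ j) → Neighbourhood → Invariant
    branching s-injective P = record
      { holds = two
      ; invariant = λ {ψ} A eq {v} {w} z → T-≡-iff (two-forth A eq z) (two-back A eq z)
      }
      where
      distinct : Fin m → Fin m → Bool
      distinct i j = not ⌊ i FinP.≟ j ⌋
      two : Fin m → Bool
      two v = any (λ i → any (distinct i) (near P v)) (near P v)
      distinct-≢ : ∀ {i j} → T (distinct i j) → i ≢ j
      distinct-≢ {i} {j} t eq with i FinP.≟ j
      ... | no n = n eq
      ≢-distinct : ∀ {i j} → i ≢ j → T (distinct i j)
      ≢-distinct {i} {j} n with i FinP.≟ j
      ... | yes eq = n eq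
      ... | no _ = tt
      two-forth : ∀ {ψ} → IsAut ψ → ψ ε ≡ ε → ∀ {v w} → ψ (s v) ≡ s w → T (two v) → T (two w)
      two-forth {ψ} A eq z t with any-∈ _ t
      ... | i , i∈ , t′ with any-∈ _ t′ | zig P A eq z i∈
      ...   | j , j∈ , d | i′ , i′∈ , p with zig P A eq z j∈
      ...     | j′ , j′∈ , q = ∈-any _ i′∈ (∈-any _ j′∈ (≢-distinct λ { refl →
                distinct-≢ d (s-injective (injective A (trans p (sym q)))) }))
      two-back : ∀ {ψ} → IsAut ψ → ψ ε ≡ ε → ∀ {v w} → ψ (s v) ≡ s w → T (two w) → T (two v)
      two-back {ψ} A eq z t with any-∈ _ t
      ... | i , i∈ , t′ with any-∈ _ t′ | zag P A eq z i∈
      ...   | j , j∈ , d | i′ , i′∈ , p with zag P A eq z j∈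
      ...     | j′ , j′∈ , q = ∈-any _ i′∈ (∈-any _ j′∈ (≢-distinct λ { refl →
                distinct-≢ d (s-injective (trans (sym p) q)) }))

    fixed-by-local : (P : Invariant) → ∀ i →
      {_ : T (all (λ j → ⌊ j FinP.≟ i ⌋ ∨ not (holds P j)) (allFin m))} → {_ : T (holds P i)} → Fixed (s i)
    fixed-by-local P i {u} {t} = fixed-by P (λ i → i) (λ _ → refl) i u t

  -- The whole Cayley digraph, its vertices named by V.
  module Global {V : Set} (pt : V → C) (pt-surjective : ∀ g → ∃ λ v → pt v ≡ g)
                (after before : Fin m → V → V)
                (pt-after : ∀ i v → pt (after i v) ≡ s i ∙ pt v)
                (pt-before : ∀ i v → pt (before i v) ≡ s i ⁻¹ ∙ pt v) where
    open Definable pt public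

    out into : Neighbourhood
    out = record
      { near = λ v → map (λ i → after i v) (allFin m)
      ; zig  = zig′
      ; zag  = zag′
      }
      where
      zig′ : ∀ {ψ} → IsAut ψ → ψ ε ≡ ε → ∀ {v w} → ψ (pt v) ≡ pt w → ∀ {v′} → v′ ∈ map (λ i → after i v) (allFin m) →
             ∃ λ w′ → w′ ∈ map (λ i → after i w) (allFin m) × ψ (pt v′) ≡ pt w′
      zig′ {ψ} A _ {v} {w} z mem with ∈-map⁻ _ mem
      ... | i , _ , refl with forth A (pt v) i
      ...   | j , eq = after j w , ∈-map⁺ _ (∈-allFin j) ,
        trans (cong ψ (pt-after i v)) (trans eq (trans (cong (s j ∙_) z) (sym (pt-after j w))))
      zag′ : ∀ {ψ} → IsAut ψ → ψ ε ≡ ε → ∀ {v w} → ψ (pt v) ≡ pt w → ∀ {w′} → w′ ∈ map (λ i → after i w) (allFin m) →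
             ∃ λ v′ → v′ ∈ map (λ i → after i v) (allFin m) × ψ (pt v′) ≡ pt w′
      zag′ {ψ} A _ {v} {w} z mem with ∈-map⁻ _ mem
      ... | j , _ , refl with back A (pt v) j
      ...   | i , eq = after i v , ∈-map⁺ _ (∈-allFin i) ,
        trans (cong ψ (pt-after i v)) (trans eq (trans (cong (s j ∙_) z) (sym (pt-after j w))))
    into = record
      { near = λ v → map (λ i → before i v) (allFin m)
      ; zig  = zig′
      ; zag  = zag′
      }
      where
      zig′ : ∀ {ψ} → IsAut ψ → ψ ε ≡ ε → ∀ {v w} → ψ (pt v) ≡ pt w → ∀ {v′} → v′ ∈ map (λ i → before i v) (allFin m) →
             ∃ λ w′ → w′ ∈ map (λ i → before i w) (allFin m) × ψ (pt v′) ≡ pt w′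
      zig′ {ψ} A _ {v} {w} z mem with ∈-map⁻ _ mem
      ... | i , _ , refl with forth A (pt (before i v)) i
      ...   | j , eq = before j w , ∈-map⁺ _ (∈-allFin j) , (begin
        ψ (pt (before i v))                   ≡⟨ sym (cancelˡ (s j) _) ⟩
        s j ⁻¹ ∙ (s j ∙ ψ (pt (before i v)))  ≡⟨ cong (s j ⁻¹ ∙_) (sym eq) ⟩
        s j ⁻¹ ∙ ψ (s i ∙ pt (before i v))    ≡⟨ cong (λ t → s j ⁻¹ ∙ ψ (s i ∙ t)) (pt-before i v) ⟩
        s j ⁻¹ ∙ ψ (s i ∙ (s i ⁻¹ ∙ pt v))    ≡⟨ cong (λ t → s j ⁻¹ ∙ ψ t) (cancelˡ′ (s i) _) ⟩
        s j ⁻¹ ∙ ψ (pt v)                     ≡⟨ cong (s j ⁻¹ ∙_) z ⟩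
        s j ⁻¹ ∙ pt w                         ≡⟨ sym (pt-before j w) ⟩
        pt (before j w)                       ∎)
      zag′ : ∀ {ψ} → IsAut ψ → ψ ε ≡ ε → ∀ {v w} → ψ (pt v) ≡ pt w → ∀ {w′} → w′ ∈ map (λ i → before i w) (allFin m) →
             ∃ λ v′ → v′ ∈ map (λ i → before i v) (allFin m) × ψ (pt v′) ≡ pt w′
      zag′ {ψ} A _ {v} {w} z mem with ∈-map⁻ _ mem
      ... | j , _ , refl with surjective A (pt (before j w))
      ...   | u , eq with back A u j
      ...     | i , eq′ = before i v , ∈-map⁺ _ (∈-allFin i) , trans (cong ψ (trans (pt-before i v) u-eq)) eq
        where
        u-eq : s i ⁻¹ ∙ pt v ≡ u
        u-eq = begin
          s i ⁻¹ ∙ pt v       ≡⟨ cong (s i ⁻¹ ∙_) (sym (injective A (begin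
            ψ (s i ∙ u)                 ≡⟨ eq′ ⟩
            s j ∙ ψ u                   ≡⟨ cong (s j ∙_) (trans eq (pt-before j w)) ⟩
            s j ∙ (s j ⁻¹ ∙ pt w)       ≡⟨ cancelˡ′ (s j) _ ⟩
            pt w                        ≡⟨ sym z ⟩
            ψ (pt v)                    ∎))) ⟩
          s i ⁻¹ ∙ (s i ∙ u)  ≡⟨ cancelˡ (s i) u ⟩
          u                   ∎

-- Deciding coincidences among products of connection elements

pattern 0F = zero
pattern 1F = suc zero
pattern 2F = suc (suc zero)
pattern 3F = suc (suc (suc zero))
pattern 4F = suc (suc (suc (suc zero)))
pattern 5F = suc (suc (suc (suc (suc zero))))

pattern 6F = suc (suc (suc (suc (suc (suc zero)))))
pattern 7F = suc (suc (suc (suc (suc (suc (suc zero))))))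
pattern 8F = suc (suc (suc (suc (suc (suc (suc (suc zero)))))))
pattern 9F = suc (suc (suc (suc (suc (suc (suc (suc (suc zero))))))))

pattern X = var 0F
pattern Y = var 1F
pattern Z = var 2F
pattern W = var 3F
pattern D = var 4F
pattern F = var 5F
pattern J = var 6F
pattern L = var 7F
pattern M = var 8F
pattern N = var 9F

satisfies-++ : ∀ {G k} {a : Fin k → Carrier G} {R R′} → Satisfies G a R → Satisfies G a R′ → Satisfies G a (R ++ R′)
satisfies-++ []       qs = qs
satisfies-++ (p ∷ ps) qs = p ∷ satisfies-++ ps qs

-- Every product `s k s i s j⁻¹` has to be judged with no bound on the order of `G`. The two lists
-- hold the words whose status follows from the case at hand; any other product must reduce freely
-- to the empty word or contain some generator exactly once.
module Symbolic (G : FinGroup) (rank : NotGeneratedByTwo G) (a : Fin 3 → Carrier G) (gn : Generates G a)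
  (trivials : List (Word 3)) (trivial : All (λ u → eval G a u ≡ FinGroup.ε G) trivials)
  (nontrivials : List (Word 3)) (nontrivial : All (λ u → eval G a u ≢ FinGroup.ε G) nontrivials)
  {m : ℕ} (S : Vec (Word 3) m) where

  open GroupOf G
  open Eval G a
  open Independence G rank a gn

  s : Fin m → C
  s i = ⟦ lookup S i ⟧

  matches : String 3 → Word 3 → Bool
  matches w u = sameString w (flatten u) ∨ sameString (inverse w) (flatten u)

  matches-sound : ∀ w u → T (matches w u) → ⟪ w ⟫ ≡ ⟦ u ⟧ ⊎ ⟪ w ⟫ ⁻¹ ≡ ⟦ u ⟧
  matches-sound w u t with Equivalence.to (T-∨ {sameString w (flatten u)}) t
  ... | inj₁ p = inj₁ (trans (cong ⟪_⟫ (sameString-sound w _ p)) (⟪⟫-flatten u))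
  ... | inj₂ p = inj₂ (trans (sym (⟪⟫-inverse w)) (trans (cong ⟪_⟫ (sameString-sound (inverse w) _ p)) (⟪⟫-flatten u)))

  -- Triviality is invariant under conjugation, so the test is tried on every rotation. Reducing
  -- after each rotation also cancels letters that meet around the end of the word.
  spun : (String 3 → Bool) → ℕ → String 3 → Bool
  spun p zero    w = false
  spun p (suc n) w = p w ∨ spun p n (reduce (rotate 1 w))

  vanishing distinct : String 3 → Bool
  vanishing w = null w ∨ any (matches w) trivials
  distinct w = once w ∨ any (matches w) nontrivials

  vanishes survives : Word 3 → Bool
  -- The empty word has length zero and would be given no rotation to test, hence the separate
  -- `null`.
  vanishes u = null (reduce (flatten u)) ∨ spun vanishing (length (reduce (flatten u))) (reduce (flatten u))
  survives u = spun distinct (length (reduce (flatten u))) (reduce (flatten u))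

  any-All : ∀ {P : Word 3 → Set} {us} (p : Word 3 → Bool) → All P us → T (any p us) → ∃ λ u → P u × T (p u)
  any-All p (x ∷ xs) t with Equivalence.to T-∨ t
  ... | inj₁ q = _ , x , q
  ... | inj₂ q = any-All p xs q

  vanishing-sound : ∀ w → T (vanishing w) → ⟪ w ⟫ ≡ ε
  vanishing-sound w t with Equivalence.to (T-∨ {null w}) t
  ... | inj₁ p = null-trivial w p
  ... | inj₂ p with any-All (matches w) trivial p
  ...   | u , eq , q with matches-sound w u q
  ...     | inj₁ r = trans r eq
  ...     | inj₂ r = trans (sym (⁻¹-involutive _)) (trans (cong _⁻¹ (trans r eq)) ε⁻¹≈ε)

  distinct-sound : ∀ w → T (distinct w) → ⟪ w ⟫ ≢ ε
  distinct-sound w t eq with Equivalence.to (T-∨ {once w}) t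
  ... | inj₁ p = once-nontrivial w p eq
  ... | inj₂ p with any-All (matches w) nontrivial p
  ...   | u , ≢ε , q with matches-sound w u q
  ...     | inj₁ r = ≢ε (trans (sym r) eq)
  ...     | inj₂ r = ≢ε (trans (sym r) (trans (cong _⁻¹ eq) ε⁻¹≈ε))

  rotation-trivial : ∀ w → ⟪ w ⟫ ≡ ε → ⟪ reduce (rotate 1 w) ⟫ ≡ ε
  rotation-trivial w eq = trans (⟪⟫-reduce (rotate 1 w)) (⟪⟫-rotate 1 w eq)

  rotation-trivial⁻ : ∀ w → ⟪ reduce (rotate 1 w) ⟫ ≡ ε → ⟪ w ⟫ ≡ ε
  rotation-trivial⁻ w eq = trans (⟪⟫-split 1 w)
    (conjugate-trivial (trans (sym (⟪⟫-++ (drop 1 w) (take 1 w))) (trans (sym (⟪⟫-reduce (rotate 1 w))) eq)))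

  spun-vanishing : ∀ n w → T (spun vanishing n w) → ⟪ w ⟫ ≡ ε
  spun-vanishing (suc n) w t with Equivalence.to (T-∨ {vanishing w}) t
  ... | inj₁ p = vanishing-sound w p
  ... | inj₂ p = rotation-trivial⁻ w (spun-vanishing n _ p)

  spun-distinct : ∀ n w → T (spun distinct n w) → ⟪ w ⟫ ≢ ε
  spun-distinct (suc n) w t eq with Equivalence.to (T-∨ {distinct w}) t
  ... | inj₁ p = distinct-sound w p eq
  ... | inj₂ p = spun-distinct n _ p (rotation-trivial w eq)

  vanishes-sound : ∀ u → T (vanishes u) → ⟦ u ⟧ ≡ ε
  vanishes-sound u t = trans (sym (trans (⟪⟫-reduce (flatten u)) (⟪⟫-flatten u))) (case (Equivalence.to T-∨ t))
    where
    case : T (null (reduce (flatten u))) ⊎ T (spun vanishing (length (reduce (flatten u))) (reduce (flatten u))) →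
           ⟪ reduce (flatten u) ⟫ ≡ ε
    case (inj₁ p) = null-trivial _ p
    case (inj₂ p) = spun-vanishing (length (reduce (flatten u))) (reduce (flatten u)) p

  survives-sound : ∀ u → T (survives u) → ⟦ u ⟧ ≢ ε
  survives-sound u t eq = spun-distinct (length (reduce (flatten u))) (reduce (flatten u)) t (trans (⟪⟫-reduce (flatten u)) (trans (⟪⟫-flatten u) eq))

  product : Fin m → Fin m → Fin m → Word 3
  product k i j = lookup S k · lookup S i · lookup S j ⁻

  arrow : Fin m → Fin m → Bool
  arrow i j = any (λ k → vanishes (product k i j)) (allFin m)

  separated : Bool
  separated = all (λ i → all (λ j → survives (lookup S i · lookup S j)) (allFin m)) (allFin m)

  -- An arrow is recorded only if some product provably vanishes, so the absence of an arrow needs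
  -- evidence of its own: all products that could produce it survive.
  decided : Bool
  decided = all (λ i → all (λ j → arrow i j ∨ all (λ k → survives (product k i j)) (allFin m)) (allFin m)) (allFin m)

  irredundant : Bool
  irredundant = all (λ i → all (λ j → ⌊ i ≟F j ⌋ ∨ survives (lookup S i · lookup S j ⁻)) (allFin m)) (allFin m)

  s-injective : T irredundant → ∀ {i j} → s i ≡ s j → i ≡ j
  s-injective t {i} {j} eq with Equivalence.to (T-∨ {⌊ i ≟F j ⌋}) (all-∈ _ (all-∈ _ t (∈-allFin i)) (∈-allFin j))
  ... | inj₁ p = toWitness {a? = i ≟F j} p
  ... | inj₂ p = ⊥-elim (survives-sound (lookup S i · lookup S j ⁻) p (trivial-quotient eq))

  arrow-sound : ∀ i j → T (arrow i j) → ∃ λ k → s k ∙ s i ≡ s j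
  arrow-sound i j t with any-∈ (λ k → vanishes (product k i j)) {allFin m} t
  ... | k , _ , p = k , quotient-trivial (vanishes-sound (product k i j) p)

  module Decided (sep : T separated) (dec : T decided) where
    open Rigidity G s public using (Oriented; Fixed; Fixed-∙; Fixed-⁻¹; fixed-last; orr)

    oriented : Oriented
    oriented i j = survives-sound (lookup S i · lookup S j) (all-∈ _ (all-∈ _ sep (∈-allFin i)) (∈-allFin j))

    arrow-complete : ∀ i j k → s k ∙ s i ≡ s j → T (arrow i j)
    arrow-complete i j k eq with Equivalence.to (T-∨ {arrow i j}) (all-∈ _ (all-∈ _ dec (∈-allFin i)) (∈-allFin j))
    ... | inj₁ t = t
    ... | inj₂ t = ⊥-elim (survives-sound (product k i j) (all-∈ _ t (∈-allFin k)) (trivial-quotient eq))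

    open Rigidity.Local G s arrow arrow-sound arrow-complete public

    Fixed-by : (u : Word 3) → Fixed ⟦ u ⟧ → ∀ {g} → ⟦ u ⟧ ≡ g → Fixed g
    Fixed-by u p refl = p

-- A connection set for a non-commuting pair

module NonCommutingPair (G : FinGroup) (rank : NotGeneratedByTwo G) (a : Fin 3 → Carrier G) (gn : Generates G a)
  (x²≢ε : eval G a (X · X) ≢ FinGroup.ε G) (y²≢ε : eval G a (Y · Y) ≢ FinGroup.ε G)
  (z²≢ε : eval G a (Z · Z) ≢ FinGroup.ε G) (yx²≢ε : eval G a (Y · X · (Y · X)) ≢ FinGroup.ε G)
  (xy≢yx : eval G a (X · Y · X ⁻ · Y ⁻) ≢ FinGroup.ε G) where

  open GroupOf G
  open Eval G a

  S : Vec (Word 3) 4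
  S = X ∷ Y ∷ (Y · X) ∷ Z ∷ []

  -- The arrow `x → yx` is always present. The first equation says `x (yx) = y` and adds `yx → y`;
  -- the second says `(yx) y = x` and adds `y → x`; nothing else occurs, and `z` is isolated. With
  -- at most one of them the arrows form a path, whose vertices differ in what enters and leaves
  -- them; with both they close to a directed triangle, in which no vertex can be singled out.
  hasORR : ¬ (⟦ Y ⁻ · X · Y · X ⟧ ≡ ε × ⟦ X ⁻ · Y · X · Y ⟧ ≡ ε) → HasORR G
  hasORR notQ with ⟦ Y ⁻ · X · Y · X ⟧ ≟ ε | ⟦ X ⁻ · Y · X · Y ⟧ ≟ ε
  ... | yes p | yes q = ⊥-elim (notQ (p , q))
  ... | no p  | no q  = orr oriented gn λ { 0F → fx ; 1F → fy ; 2F → fixed-last 3F λ { 0F _ → fx ; 1F _ → fy ; 2F _ → fyx ; 3F ≢ → contradiction refl ≢ } }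
    where
    trivials nontrivials : List (Word 3)
    trivials = []
    nontrivials = (X · X) ∷ (Y · Y) ∷ (Z · Z) ∷ (Y · X · (Y · X)) ∷ (X · Y · X ⁻ · Y ⁻) ∷ (Y ⁻ · X · Y · X) ∷ (X ⁻ · Y · X · Y) ∷ []
    trivial : All (λ u → ⟦ u ⟧ ≡ ε) trivials
    trivial = []
    nontrivial : All (λ u → ⟦ u ⟧ ≢ ε) nontrivials
    nontrivial = x²≢ε ∷ y²≢ε ∷ z²≢ε ∷ yx²≢ε ∷ xy≢yx ∷ p ∷ q ∷ []
    open Symbolic G rank a gn trivials trivial nontrivials nontrivial S using (module Decided)
    open Decided tt tt
    fx : Fixed ⟦ X ⟧
    fx = fixed-by-local (◇[ out ] everything) 0F
    fyx : Fixed ⟦ Y · X ⟧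
    fyx = fixed-by-local (◇[ into ] everything) 2F
    fy : Fixed ⟦ Y ⟧
    fy = Fixed-by (Y · X · X ⁻) (Fixed-∙ fyx (Fixed-⁻¹ fx)) (free-identity (Y · X · X ⁻ ≐ Y))
  ... | yes p | no q  = orr oriented gn λ { 0F → fx ; 1F → fy ; 2F → fixed-last 3F λ { 0F _ → fx ; 1F _ → fy ; 2F _ → fyx ; 3F ≢ → contradiction refl ≢ } }
    where
    trivials nontrivials : List (Word 3)
    trivials = (Y ⁻ · X · Y · X) ∷ []
    nontrivials = (X · X) ∷ (Y · Y) ∷ (Z · Z) ∷ (Y · X · (Y · X)) ∷ (X · Y · X ⁻ · Y ⁻) ∷ (X ⁻ · Y · X · Y) ∷ []
    trivial : All (λ u → ⟦ u ⟧ ≡ ε) trivials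
    trivial = p ∷ []
    nontrivial : All (λ u → ⟦ u ⟧ ≢ ε) nontrivials
    nontrivial = x²≢ε ∷ y²≢ε ∷ z²≢ε ∷ yx²≢ε ∷ xy≢yx ∷ q ∷ []
    open Symbolic G rank a gn trivials trivial nontrivials nontrivial S using (module Decided)
    open Decided tt tt
    fx : Fixed ⟦ X ⟧
    fx = fixed-by-local (◇[ out ] ◇[ out ] everything) 0F
    fy : Fixed ⟦ Y ⟧
    fy = fixed-by-local (◇[ into ] ◇[ into ] everything) 1F
    fyx : Fixed ⟦ Y · X ⟧
    fyx = Fixed-∙ fy fx
  ... | no p  | yes q = orr oriented gn λ { 0F → fx ; 1F → fy ; 2F → fixed-last 3F λ { 0F _ → fx ; 1F _ → fy ; 2F _ → Fixed-∙ fy fx ; 3F ≢ → contradiction refl ≢ } }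
    where
    trivials nontrivials : List (Word 3)
    trivials = (X ⁻ · Y · X · Y) ∷ []
    nontrivials = (X · X) ∷ (Y · Y) ∷ (Z · Z) ∷ (Y · X · (Y · X)) ∷ (X · Y · X ⁻ · Y ⁻) ∷ (Y ⁻ · X · Y · X) ∷ []
    trivial : All (λ u → ⟦ u ⟧ ≡ ε) trivials
    trivial = q ∷ []
    nontrivial : All (λ u → ⟦ u ⟧ ≢ ε) nontrivials
    nontrivial = x²≢ε ∷ y²≢ε ∷ z²≢ε ∷ yx²≢ε ∷ xy≢yx ∷ p ∷ []
    open Symbolic G rank a gn trivials trivial nontrivials nontrivial S using (module Decided)
    open Decided tt tt
    fy : Fixed ⟦ Y ⟧
    fy = fixed-by-local (◇[ out ] ◇[ out ] everything) 1F
    fx : Fixed ⟦ X ⟧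
    fx = fixed-by-local (◇[ out ] everything & ◇[ into ] everything) 0F

-- Cardinalities of subsets

enumerate : ∀ {n} (A : Subset n) → Fin ∣ A ∣ → Fin n
enumerate (true  ∷ A) zero    = zero
enumerate (true  ∷ A) (suc i) = suc (enumerate A i)
enumerate (false ∷ A) i       = suc (enumerate A i)

enumerate-∈ : ∀ {n} (A : Subset n) i → enumerate A i Sub.∈ A
enumerate-∈ (true  ∷ A) zero    = Membership.here
enumerate-∈ (true  ∷ A) (suc i) = Membership.there (enumerate-∈ A i)
enumerate-∈ (false ∷ A) i       = Membership.there (enumerate-∈ A i)

enumerate-injective : ∀ {n} (A : Subset n) {i j} → enumerate A i ≡ enumerate A j → i ≡ j
enumerate-injective (true  ∷ A) {zero}  {zero}  eq = refl
enumerate-injective (true  ∷ A) {suc i} {suc j} eq = cong suc (enumerate-injective A (FinP.suc-injective eq))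
enumerate-injective (false ∷ A)         eq = enumerate-injective A (FinP.suc-injective eq)

position : ∀ {n} {A : Subset n} {x} → x Sub.∈ A → Fin ∣ A ∣
position {A = true  ∷ A} Membership.here      = zero
position {A = true  ∷ A} (Membership.there p) = suc (position p)
position {A = false ∷ A} (Membership.there p) = position p

enumerate-position : ∀ {n} {A : Subset n} {x} (p : x Sub.∈ A) → enumerate A (position p) ≡ x
enumerate-position {A = true  ∷ A} Membership.here      = refl
enumerate-position {A = true  ∷ A} (Membership.there p) = cong suc (enumerate-position p)
enumerate-position {A = false ∷ A} (Membership.there p) = cong suc (enumerate-position p)

injection-∣∣ : ∀ {n} {A B : Subset n} (f : Fin n → Fin n) → (∀ {x y} → f x ≡ f y → x ≡ y) →
               (∀ {x} → x Sub.∈ A → f x Sub.∈ B) → ∣ A ∣ ≤ ∣ B ∣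
injection-∣∣ {A = A} {B} f f-injective f-∈ = ℕP.≮⇒≥ λ lt →
  let g = λ i → position (f-∈ (enumerate-∈ A i))
      i , j , i<j , eq = FinP.pigeonhole lt g
  in FinP.<⇒≢ i<j (enumerate-injective A (f-injective
       (trans (sym (enumerate-position (f-∈ (enumerate-∈ A i))))
         (trans (cong (enumerate B) eq) (enumerate-position (f-∈ (enumerate-∈ A j)))))))

half : ∀ n m → m ≤ n → m ≡ n ∸ m → n ≡ 2 * m
half n m m≤n eq = begin
  n             ≡⟨ sym (ℕP.m+[n∸m]≡n m≤n) ⟩
  m + (n ∸ m)   ≡⟨ cong (m +_) (sym eq) ⟩
  m + m         ≡⟨ cong (m +_) (sym (ℕP.+-identityʳ m)) ⟩
  2 * m         ∎
  where open ≡-Reasoning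

-- Recognising generalized dihedral groups

-- The abelian subgroup is `⟨x, y⟩`, with `τ` the third generator `t`. It does not contain `t`, as
-- `G` would then be generated by two elements, and right multiplication by `t` exchanges it with
-- its complement, which gives index two.
inverted-abelian : ∀ G (a : Fin 3 → Carrier G) → Generates G a → NotGeneratedByTwo G →
  Satisfies G a (X · Y ≐ Y · X ∷ Z · Z ≐ e ∷ Z · X · Z ≐ X ⁻ ∷ Z · Y · Z ≐ Y ⁻ ∷ []) → GeneralizedDihedral G
inverted-abelian G a gn rank (xy≡yx ∷ t²≡ε ∷ x-inverted ∷ y-inverted ∷ []) =
  A , (∈A one , (λ g h p q → ∈A (mul (A∈ p) (A∈ q))) , λ g p → ∈A (inv (A∈ p))) ,
  (λ g h p q → commute (A∈ p) (A∈ q)) ,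
  half (order G) ∣ A ∣ (∣p∣≤n A) (trans ∣A∣≡∣∁A∣ (∣∁p∣≡n∸∣p∣ A)) ,
  t , (λ p → t∉ (A∈ p)) , t²≡ε , λ g p → inverted (A∈ p)
  where
  open GroupOf G
  open Rigidity G {0} (λ ()) using (cancelʳ; cancelʳ′; cancelˡ; cancelˡ′)
  open Generation G
  open ≡-Reasoning

  x y t : C
  x = a 0F
  y = a 1F
  t = a 2F

  b : Fin 2 → C
  b 0F = x
  b 1F = y

  K : C → Set
  K = ⟨_⟩ G b

  inverse-commutes : ∀ {g h} → g ∙ h ≡ h ∙ g → g ∙ h ⁻¹ ≡ h ⁻¹ ∙ g
  inverse-commutes {g} {h} eq = ∙-cancelˡ h _ _ (begin
    h ∙ (g ∙ h ⁻¹)   ≡⟨ sym (assoc h g _) ⟩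
    h ∙ g ∙ h ⁻¹     ≡⟨ cong (_∙ h ⁻¹) (sym eq) ⟩
    g ∙ h ∙ h ⁻¹     ≡⟨ cancelʳ g h ⟩
    g                ≡⟨ sym (cancelˡ′ h g) ⟩
    h ∙ (h ⁻¹ ∙ g)   ∎)

  commutes-with : ∀ g → (∀ i → g ∙ b i ≡ b i ∙ g) → ∀ {h} → K h → g ∙ h ≡ h ∙ g
  commutes-with g p (gen i) = p i
  commutes-with g p one     = trans (identityʳ g) (sym (identityˡ g))
  commutes-with g p (mul {h} {k} q r) = begin
    g ∙ (h ∙ k)   ≡⟨ sym (assoc g h k) ⟩
    g ∙ h ∙ k     ≡⟨ cong (_∙ k) (commutes-with g p q) ⟩
    h ∙ g ∙ k     ≡⟨ assoc h g k ⟩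
    h ∙ (g ∙ k)   ≡⟨ cong (h ∙_) (commutes-with g p r) ⟩
    h ∙ (k ∙ g)   ≡⟨ sym (assoc h k g) ⟩
    h ∙ k ∙ g     ∎
  commutes-with g p (inv q) = inverse-commutes (commutes-with g p q)

  commute : ∀ {g h} → K g → K h → g ∙ h ≡ h ∙ g
  commute p = commutes-with _ λ i → sym (commutes-with (b i) (generators i) p)
    where
    generators : ∀ i j → b i ∙ b j ≡ b j ∙ b i
    generators 0F 0F = refl
    generators 0F 1F = xy≡yx
    generators 1F 0F = sym xy≡yx
    generators 1F 1F = refl

  t-cancel : ∀ g → t ∙ (t ∙ g) ≡ g
  t-cancel g = trans (sym (assoc t t g)) (trans (cong (_∙ g) t²≡ε) (identityˡ g))

  t-cancelʳ : ∀ g → g ∙ t ∙ t ≡ g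
  t-cancelʳ g = trans (assoc g t t) (trans (cong (g ∙_) t²≡ε) (identityʳ g))

  t-conjugate : ∀ g h → t ∙ (g ∙ h) ∙ t ≡ t ∙ g ∙ t ∙ (t ∙ h ∙ t)
  t-conjugate g h = begin
    t ∙ (g ∙ h) ∙ t             ≡⟨ cong (λ u → t ∙ (g ∙ u) ∙ t) (sym (t-cancel h)) ⟩
    t ∙ (g ∙ (t ∙ (t ∙ h))) ∙ t ≡⟨ cong (_∙ t) (sym (assoc t g _)) ⟩
    t ∙ g ∙ (t ∙ (t ∙ h)) ∙ t   ≡⟨ cong (_∙ t) (sym (assoc (t ∙ g) t _)) ⟩
    t ∙ g ∙ t ∙ (t ∙ h) ∙ t     ≡⟨ assoc _ _ t ⟩
    t ∙ g ∙ t ∙ (t ∙ h ∙ t)     ∎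

  inverted : ∀ {g} → K g → t ∙ g ∙ t ≡ g ⁻¹
  inverted (gen 0F) = x-inverted
  inverted (gen 1F) = y-inverted
  inverted one = trans (cong (_∙ t) (identityʳ t)) (trans t²≡ε (sym ε⁻¹≈ε))
  inverted (mul {g} {h} p q) = begin
    t ∙ (g ∙ h) ∙ t           ≡⟨ t-conjugate g h ⟩
    t ∙ g ∙ t ∙ (t ∙ h ∙ t)   ≡⟨ cong₂ _∙_ (inverted p) (inverted q) ⟩
    g ⁻¹ ∙ h ⁻¹               ≡⟨ commute (inv p) (inv q) ⟩
    h ⁻¹ ∙ g ⁻¹               ≡⟨ sym (⁻¹-anti-homo-∙ g h) ⟩
    (g ∙ h) ⁻¹                ∎
  inverted (inv {g} p) = inverseʳ-unique (g ⁻¹) (t ∙ g ⁻¹ ∙ t) (begin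
    g ⁻¹ ∙ (t ∙ g ⁻¹ ∙ t)         ≡⟨ cong (_∙ (t ∙ g ⁻¹ ∙ t)) (sym (inverted p)) ⟩
    t ∙ g ∙ t ∙ (t ∙ g ⁻¹ ∙ t)    ≡⟨ sym (t-conjugate g (g ⁻¹)) ⟩
    t ∙ (g ∙ g ⁻¹) ∙ t            ≡⟨ cong (λ u → t ∙ u ∙ t) (inverseʳ g) ⟩
    t ∙ ε ∙ t                     ≡⟨ cong (_∙ t) (identityʳ t) ⟩
    t ∙ t                         ≡⟨ t²≡ε ⟩
    ε                             ∎)

  -- Membership in `K` is inductive and comes with no decision procedure. Following a derivation of
  -- `g` from the three generators tells in which of the two cosets `g` lies.
  side : ∀ {g} → ⟨_⟩ G a g → K g ⊎ K (g ∙ t)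
  side (gen 0F) = inj₁ (gen 0F)
  side (gen 1F) = inj₁ (gen 1F)
  side (gen 2F) = inj₂ (subst K (sym t²≡ε) one)
  side one      = inj₁ one
  side (mul {g} {h} p q) with side p | side q
  ... | inj₁ p′ | inj₁ q′ = inj₁ (mul p′ q′)
  ... | inj₁ p′ | inj₂ q′ = inj₂ (subst K (sym (assoc g h t)) (mul p′ q′))
  ... | inj₂ p′ | inj₁ q′ = inj₂ (subst K (begin
    g ∙ t ∙ h ⁻¹                ≡⟨ cong (g ∙ t ∙_) (sym (inverted q′)) ⟩
    g ∙ t ∙ (t ∙ h ∙ t)         ≡⟨ cong (g ∙ t ∙_) (assoc t h t) ⟩
    g ∙ t ∙ (t ∙ (h ∙ t))       ≡⟨ assoc g t _ ⟩
    g ∙ (t ∙ (t ∙ (h ∙ t)))     ≡⟨ cong (g ∙_) (t-cancel _) ⟩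
    g ∙ (h ∙ t)                 ≡⟨ sym (assoc g h t) ⟩
    g ∙ h ∙ t                   ∎) (mul p′ (inv q′)))
  ... | inj₂ p′ | inj₂ q′ = inj₁ (subst K (begin
    g ∙ t ∙ (h ∙ t) ⁻¹          ≡⟨ cong (g ∙ t ∙_) (sym (inverted q′)) ⟩
    g ∙ t ∙ (t ∙ (h ∙ t) ∙ t)   ≡⟨ cong (g ∙ t ∙_) (trans (assoc t (h ∙ t) t) (cong (t ∙_) (t-cancelʳ h))) ⟩
    g ∙ t ∙ (t ∙ h)             ≡⟨ trans (assoc g t _) (cong (g ∙_) (t-cancel h)) ⟩
    g ∙ h                       ∎) (mul p′ (inv q′)))
  side (inv {g} p) with side p
  ... | inj₁ p′ = inj₁ (inv p′)
  ... | inj₂ p′ = inj₂ (subst K (begin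
    g ∙ t                       ≡⟨ sym (⁻¹-involutive (g ∙ t)) ⟩
    (g ∙ t) ⁻¹ ⁻¹               ≡⟨ sym (inverted (inv p′)) ⟩
    t ∙ (g ∙ t) ⁻¹ ∙ t          ≡⟨ cong (λ u → t ∙ u ∙ t) (⁻¹-anti-homo-∙ g t) ⟩
    t ∙ (t ⁻¹ ∙ g ⁻¹) ∙ t       ≡⟨ cong (_∙ t) (cancelˡ′ t (g ⁻¹)) ⟩
    g ⁻¹ ∙ t                    ∎) p′)

  t∉ : ¬ K t
  t∉ p = rank (b , λ g → ⟨⟩-map (λ { 0F → gen 0F ; 1F → gen 1F ; 2F → p }) (gn g))

  not-both : ∀ {g} → K g → ¬ K (g ∙ t)
  not-both {g} p q = t∉ (subst K (cancelˡ g t) (mul (inv p) q))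

  left : ∀ {P Q : Set} → P ⊎ Q → Bool
  left (inj₁ _) = true
  left (inj₂ _) = false

  -- The subset records the coset reported by `side`; by `not-both` the report cannot depend on the
  -- derivation followed.
  A : Subset (order G)
  A = tabulate λ g → left (side (gn g))

  ∈A : ∀ {g} → K g → g Sub.∈ A
  ∈A {g} p = lookup⇒[]= g A (trans (lookup∘tabulate _ g) (go (side (gn g))))
    where
    go : (d : K g ⊎ K (g ∙ t)) → left d ≡ true
    go (inj₁ _) = refl
    go (inj₂ q) = contradiction q (not-both p)

  A∈ : ∀ {g} → g Sub.∈ A → K g
  A∈ {g} p = go (side (gn g)) (trans (sym (lookup∘tabulate _ g)) ([]=⇒lookup p))
    where
    go : (d : K g ⊎ K (g ∙ t)) → left d ≡ true → K g
    go (inj₁ q) _ = q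

  flip-out : ∀ {g} → g Sub.∈ A → (g ∙ t) Sub.∈ ∁ A
  flip-out p = x∉p⇒x∈∁p λ q → not-both (A∈ p) (A∈ q)

  flip-in : ∀ {g} → g Sub.∈ ∁ A → (g ∙ t) Sub.∈ A
  flip-in {g} p with side (gn g)
  ... | inj₁ q = contradiction (∈A q) (x∈∁p⇒x∉p p)
  ... | inj₂ q = ∈A q

  ∣A∣≡∣∁A∣ : ∣ A ∣ ≡ ∣ ∁ A ∣
  ∣A∣≡∣∁A∣ = ℕP.≤-antisym (injection-∣∣ (_∙ t) (∙-cancelʳ t _ _) flip-out)
                          (injection-∣∣ (_∙ t) (∙-cancelʳ t _ _) flip-in)

-- Generalized dihedral groups admit no ORR

-- Elements outside A are involutions, so a candidate connection set lies in A; then multiplying one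
-- coset of A by an element of A, and leaving the other alone, is a non-regular automorphism.
module _ (G : FinGroup) (rank : ∀ m → m < 3 → ¬ GeneratedBy G m) (gd : GeneralizedDihedral G)
  (S : Subset (order G)) (antisymmetric : ∀ s → s Sub.∈ S → ¬ ((FinGroup._⁻¹ G s) Sub.∈ S)) (regular : IsDRR G S) where

  private
    A = proj₁ gd
    ε∈ = proj₁ (proj₁ (proj₂ gd))
    ∙∈ = proj₁ (proj₂ (proj₁ (proj₂ gd)))
    ⁻¹∈ = proj₂ (proj₂ (proj₁ (proj₂ gd)))
    |G| = proj₁ (proj₂ (proj₂ (proj₂ gd)))
    τ = proj₁ (proj₂ (proj₂ (proj₂ (proj₂ gd))))
    τ∉ = proj₁ (proj₂ (proj₂ (proj₂ (proj₂ (proj₂ gd)))))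
    τ²≡ε = proj₁ (proj₂ (proj₂ (proj₂ (proj₂ (proj₂ (proj₂ gd))))))
    τ-inverts = proj₂ (proj₂ (proj₂ (proj₂ (proj₂ (proj₂ (proj₂ gd))))))

  open GroupOf G
  open Rigidity G {0} (λ ()) using (cancelʳ; cancelʳ′; cancelˡ; cancelˡ′)
  open ≡-Reasoning

  ∈-cancelʳ : ∀ {g h} → h Sub.∈ A → (g ∙ h) Sub.∈ A → g Sub.∈ A
  ∈-cancelʳ {g} {h} p q = subst (Sub._∈ A) (cancelʳ g h) (∙∈ _ _ q (⁻¹∈ h p))

  ∈-cancelˡ : ∀ {g h} → g Sub.∈ A → (g ∙ h) Sub.∈ A → h Sub.∈ A
  ∈-cancelˡ {g} {h} p q = subst (Sub._∈ A) (cancelˡ g h) (∙∈ _ _ (⁻¹∈ g p) q)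

  τ-cancelʳ : ∀ g → g ∙ τ ∙ τ ≡ g
  τ-cancelʳ g = trans (assoc g τ τ) (trans (cong (g ∙_) τ²≡ε) (identityʳ g))

  ∁A : ∣ ∁ A ∣ ≡ ∣ A ∣
  ∁A = trans (∣∁p∣≡n∸∣p∣ A) (trans (cong (_∸ ∣ A ∣) |G|)
         (trans (cong (λ k → ∣ A ∣ + k ∸ ∣ A ∣) (ℕP.+-identityʳ ∣ A ∣)) (ℕP.m+n∸n≡m ∣ A ∣ ∣ A ∣)))

  -- A count: were `x τ` outside `A`, right multiplication by `τ` would inject `A` into the
  -- complement of `A` with `x` removed, which has fewer elements because the index is two.
  outside-coset : ∀ {x} → ¬ (x Sub.∈ A) → (x ∙ τ) Sub.∈ A
  outside-coset {x} x∉ with (x ∙ τ) ∈? A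
  ... | yes p = p
  ... | no xτ∉ = ⊥-elim (ℕP.<-irrefl (sym ∁A) (ℕP.≤-<-trans
        (injection-∣∣ (_∙ τ) (∙-cancelʳ τ _ _) into)
        (p⊂q⇒∣p∣<∣q∣ (x∈p⇒p-x⊂p (x∉p⇒x∈∁p x∉)))))
    where
    into : ∀ {g} → g Sub.∈ A → (g ∙ τ) Sub.∈ (∁ A Sub.- x)
    into {g} p = x∈p∧x≢y⇒x∈p-y (x∉p⇒x∈∁p λ q → τ∉ (∈-cancelˡ p q))
      λ eq → xτ∉ (subst (Sub._∈ A) (trans (sym (τ-cancelʳ g)) (cong (_∙ τ) eq)) p)

  -- As `x τ` lies in `A`, its conjugate `τ (x τ) τ` is its inverse, while
  -- `x x = (x τ) (τ (x τ) τ)`.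
  outside-involution : ∀ {x} → ¬ (x Sub.∈ A) → x ⁻¹ ≡ x
  outside-involution {x} x∉ = sym (inverseˡ-unique x x (begin
    x ∙ x                      ≡⟨ cong (_∙ x) (sym (τ-cancelʳ x)) ⟩
    x ∙ τ ∙ τ ∙ x              ≡⟨ cong (x ∙ τ ∙ τ ∙_) (sym (τ-cancelʳ x)) ⟩
    x ∙ τ ∙ τ ∙ (x ∙ τ ∙ τ)    ≡⟨ assoc (x ∙ τ) τ _ ⟩
    x ∙ τ ∙ (τ ∙ (x ∙ τ ∙ τ))  ≡⟨ cong (x ∙ τ ∙_) (sym (assoc τ (x ∙ τ) τ)) ⟩
    x ∙ τ ∙ (τ ∙ (x ∙ τ) ∙ τ)  ≡⟨ cong (x ∙ τ ∙_) (τ-inverts _ (outside-coset x∉)) ⟩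
    x ∙ τ ∙ (x ∙ τ) ⁻¹         ≡⟨ inverseʳ _ ⟩
    ε                          ∎))

  S⊆A : ∀ {x} → x Sub.∈ S → x Sub.∈ A
  S⊆A {x} p with x ∈? A
  ... | yes q = q
  ... | no x∉ = ⊥-elim (antisymmetric x p (subst (Sub._∈ S) (sym (outside-involution x∉)) p))

  twist : C → C → C
  twist h x with x ∈? A
  ... | yes _ = x
  ... | no  _ = x ∙ h

  twist-inside : ∀ h {x} → x Sub.∈ A → twist h x ≡ x
  twist-inside h {x} p with x ∈? A
  ... | yes _ = refl
  ... | no x∉ = contradiction p x∉

  twist-outside : ∀ h {x} → ¬ (x Sub.∈ A) → twist h x ≡ x ∙ h
  twist-outside h {x} x∉ with x ∈? A
  ... | yes p = contradiction p x∉
  ... | no _ = refl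

  twist-twist : ∀ {h k} → h Sub.∈ A → h ∙ k ≡ ε → ∀ x → twist k (twist h x) ≡ x
  twist-twist {h} {k} p eq x with x ∈? A
  ... | yes q = twist-inside k q
  ... | no x∉ = trans (twist-outside k λ q → x∉ (∈-cancelʳ p q))
                  (trans (assoc x h k) (trans (cong (x ∙_) eq) (identityʳ x)))

  module Twist (g₀ : C) (g₀∈ : g₀ Sub.∈ A) (g₀≢ε : g₀ ≢ ε) where
    φ : Permutation′ (order G)
    φ = permutation (twist g₀) (twist (g₀ ⁻¹))
          (twist-twist (⁻¹∈ _ g₀∈) (inverseˡ g₀))
          (twist-twist g₀∈ (inverseʳ g₀))

    φ-inside : ∀ {x} → x Sub.∈ A → φ ⟨$⟩ʳ x ≡ x
    φ-inside = twist-inside g₀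

    φ-outside : ∀ {x} → ¬ (x Sub.∈ A) → φ ⟨$⟩ʳ x ≡ x ∙ g₀
    φ-outside = twist-outside g₀

    same-side : ∀ {x y} → Arc G S x y → x Sub.∈ A → y Sub.∈ A
    same-side {x} {y} p x∈ = subst (Sub._∈ A) (cancelʳ′ y x) (∙∈ _ _ (S⊆A p) x∈)

    same-side⁻ : ∀ {x y} → Arc G S x y → y Sub.∈ A → x Sub.∈ A
    same-side⁻ {x} {y} p y∈ = subst (Sub._∈ A) (⁻¹-involutive x) (⁻¹∈ _ (∈-cancelˡ y∈ (S⊆A p)))

    quotient-shift : ∀ x y → (y ∙ g₀) ∙ (x ∙ g₀) ⁻¹ ≡ y ∙ x ⁻¹
    quotient-shift x y = begin
      y ∙ g₀ ∙ (x ∙ g₀) ⁻¹         ≡⟨ cong (y ∙ g₀ ∙_) (⁻¹-anti-homo-∙ x g₀) ⟩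
      y ∙ g₀ ∙ (g₀ ⁻¹ ∙ x ⁻¹)      ≡⟨ sym (assoc _ _ _) ⟩
      y ∙ g₀ ∙ g₀ ⁻¹ ∙ x ⁻¹        ≡⟨ cong (_∙ x ⁻¹) (cancelʳ y g₀) ⟩
      y ∙ x ⁻¹                     ∎

    φ-aut : IsCayleyAut G S φ
    φ-aut x y with x ∈? A | y ∈? A
    ... | yes p | yes q = mk⇔ (λ t → t) (λ t → t)
    ... | yes p | no q  = mk⇔ (λ t → contradiction (same-side t p) q)
                              (λ t → contradiction (∈-cancelʳ g₀∈ (same-side t p)) q)
    ... | no p  | yes q = mk⇔ (λ t → contradiction (same-side⁻ t q) p)
                              (λ t → contradiction (∈-cancelʳ g₀∈ (same-side⁻ t q)) p)
    ... | no p  | no q  = mk⇔ (subst (Sub._∈ S) (sym (quotient-shift x y)))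
                              (subst (Sub._∈ S) (quotient-shift x y))

    absurd : ⊥
    -- The twist would be a right translation. It fixes `ε`, so it would be the identity, yet it
    -- sends `τ` to `τ g₀`.
    absurd = g₀≢ε (∙-cancelˡ τ _ _ (trans (sym (φ-outside τ∉)) (trans (proj₂ (regular φ φ-aut) τ) (cong (τ ∙_)
      (trans (sym (identityˡ _)) (trans (sym (proj₂ (regular φ φ-aut) ε)) (φ-inside ε∈)))))))

  -- There is an element to twist by unless `A` is trivial, and then `τ` alone generates `G`,
  -- against rank three.
  generalizedDihedral-noDRR : ⊥
  generalizedDihedral-noDRR with FinP.any? (λ g → (g ∈? A) ×-dec ¬? (g FinP.≟ ε))
  ... | yes (g₀ , g₀∈ , g₀≢ε) = Twist.absurd g₀ g₀∈ g₀≢ε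
  ... | no none = rank 1 (s≤s (s≤s z≤n)) ((λ _ → τ) , generated)
    where
    trivial : ∀ {g} → g Sub.∈ A → g ≡ ε
    trivial {g} p with g FinP.≟ ε
    ... | yes eq = eq
    ... | no ≢ε = contradiction (g , p , ≢ε) none
    generated : ∀ g → ⟨_⟩ G {1} (λ _ → τ) g
    generated g with g ∈? A
    ... | yes p = subst (⟨_⟩ G _) (sym (trivial p)) one
    ... | no g∉ = subst (⟨_⟩ G _) (sym (inverseˡ-unique g τ (trivial (outside-coset g∉)))) (inv (gen zero))

-- Normal forms when squares are central and commutators are products of squares

Bits : Set
Bits = Vec Bool 3

infixl 6 _⊞_

_⊞_ : Bits → Bits → Bits
_⊞_ = zipWith _xor_

_⊡_ : Bool → Bits → Bits
true  ⊡ n = n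
false ⊡ n = replicate 3 false

-- (i ∷ j ∷ k ∷ [] , a ∷ b ∷ c ∷ []) stands for x^i y^j z^k x^2a y^2b z^2c.
Normal : Set
Normal = Bits × Bits

pattern o = false
pattern ı = true

-- Commutators [y,x], [z,x], [z,y], in terms of the squares of x, y, z.
record Commutators : Set where
  constructor commutators
  field yx zx zy : Bits

every : (n : ℕ) → (Vec Bool n → Bool) → Bool
every zero    p = p []
every (suc n) p = every n (λ v → p (true ∷ v)) ∧ every n (λ v → p (false ∷ v))

every-sound : ∀ n p → T (every n p) → ∀ v → T (p v)
every-sound zero    p t []          = t
every-sound (suc n) p t (true  ∷ v) = every-sound n _ (proj₁ (Equivalence.to T-∧ t)) v
every-sound (suc n) p t (false ∷ v) = every-sound n _ (proj₂ (Equivalence.to (T-∧ {every n (λ v → p (true ∷ v))}) t)) v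

bit : ∀ {k} → Word k → Bool → Word k
bit u true  = u
bit u false = e

central : Bits → Word 3
central (a ∷ b ∷ c ∷ []) = bit (X · X) a · bit (Y · Y) b · bit (Z · Z) c

normalWord : Normal → Word 3
normalWord (i ∷ j ∷ k ∷ [] , n) = bit X i · bit Y j · bit Z k · central n

-- The squares generate a central subgroup of exponent two that absorbs all commutators, so 64
-- normal forms exhaust any group generated by such a triple.
quadratic : Commutators → List (Relation 3)
quadratic κ =
    X · X · (X · X) ≐ e ∷ Y · Y · (Y · Y) ≐ e ∷ Z · Z · (Z · Z) ≐ e
  ∷ X · X · Y ≐ Y · (X · X) ∷ X · X · Z ≐ Z · (X · X) ∷ Y · Y · X ≐ X · (Y · Y)
  ∷ Y · Y · Z ≐ Z · (Y · Y) ∷ Z · Z · X ≐ X · (Z · Z) ∷ Z · Z · Y ≐ Y · (Z · Z)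
  ∷ Y · X ≐ X · Y · central yx ∷ Z · X ≐ X · Z · central zx ∷ Z · Y ≐ Y · Z · central zy ∷ []
  where open Commutators κ

module Multiplication (κ : Commutators) where
  open Commutators κ

  -- The factor set of the extension. Equal odd exponents combine to squares; moving `x^i′` left
  -- past `z^k` and `y^j`, and `y^j′` past `z^k`, leaves the commutators.
  cocycle : Bits → Bits → Bits
  cocycle (i ∷ j ∷ k ∷ []) (i′ ∷ j′ ∷ k′ ∷ []) =
    (i ∧ i′ ∷ j ∧ j′ ∷ k ∧ k′ ∷ []) ⊞ ((j ∧ i′) ⊡ yx ⊞ (k ∧ i′) ⊡ zx) ⊞ (k ∧ j′) ⊡ zy

  infixl 6 _⊕_

  _⊕_ : Normal → Normal → Normal
  (v , n) ⊕ (w , m) = v ⊞ w , cocycle v w ⊞ (n ⊞ m)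

  letterNormal : Letter 3 → Normal
  -- Since `x⁴ = 1`, the inverse of `x` is `x x²`; hence the square is present exactly when the sign
  -- is negative.
  letterNormal (0F , c) = ı ∷ o ∷ o ∷ [] , not c ∷ o ∷ o ∷ []
  letterNormal (1F , c) = o ∷ ı ∷ o ∷ [] , o ∷ not c ∷ o ∷ []
  letterNormal (2F , c) = o ∷ o ∷ ı ∷ [] , o ∷ o ∷ not c ∷ []

  fromString : String 3 → Normal
  fromString []      = replicate 3 false , replicate 3 false
  fromString (l ∷ w) = letterNormal l ⊕ fromString w

  normal : Word 3 → Normal
  normal u = fromString (flatten u)

module QuadraticGroup (H : FinGroup) (κ : Commutators) (b : Fin 3 → Carrier H) (sat : Satisfies H b (quadratic κ)) where
  open GroupOf H
  open Eval H b
  open Commutators κ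
  open Multiplication κ
  open ≡-Reasoning

  private
    x = b 0F
    y = b 1F
    z = b 2F

  -- The calculus of words applied to arbitrary elements: here `X`, `Y` and the further letters
  -- stand for the entries of `gs`, so that rearrangements by known commutations become checked
  -- derivations.
  module Elements {k : ℕ} (gs : Vec C k) = Eval H (Vec.lookup gs) using () renaming (consequence to elements-consequence)

  inverse-commutes : ∀ {g h} → g ∙ h ≡ h ∙ g → g ∙ h ⁻¹ ≡ h ⁻¹ ∙ g
  inverse-commutes {g} {h} p = (elements-consequence {R = X · Y ≐ Y · X ∷ []} (p ∷ []) (X · Y ⁻ ≐ Y ⁻ · X) ((0 , 0 , 3 , true) ∷ []))
    where open Elements (g ∷ h ∷ [])

  Commutes : C → Set
  Commutes g = ∀ i → g ∙ b i ≡ b i ∙ g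

  commutes-eval : ∀ {g} → Commutes g → ∀ u → g ∙ ⟦ u ⟧ ≡ ⟦ u ⟧ ∙ g
  commutes-eval {g} p (var i) = p i
  commutes-eval {g} p e       = trans (identityʳ g) (sym (identityˡ g))
  commutes-eval {g} p (u · v) = begin
    g ∙ (⟦ u ⟧ ∙ ⟦ v ⟧)   ≡⟨ sym (assoc g _ _) ⟩
    g ∙ ⟦ u ⟧ ∙ ⟦ v ⟧     ≡⟨ cong (_∙ ⟦ v ⟧) (commutes-eval p u) ⟩
    ⟦ u ⟧ ∙ g ∙ ⟦ v ⟧     ≡⟨ assoc _ g _ ⟩
    ⟦ u ⟧ ∙ (g ∙ ⟦ v ⟧)   ≡⟨ cong (⟦ u ⟧ ∙_) (commutes-eval p v) ⟩
    ⟦ u ⟧ ∙ (⟦ v ⟧ ∙ g)   ≡⟨ sym (assoc _ _ g) ⟩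
    ⟦ u ⟧ ∙ ⟦ v ⟧ ∙ g     ∎
  commutes-eval {g} p (u ⁻) = inverse-commutes (commutes-eval p u)

  Commutes-ε : Commutes ε
  Commutes-ε i = trans (identityˡ _) (sym (identityʳ _))

  Commutes-∙ : ∀ {g h} → Commutes g → Commutes h → Commutes (g ∙ h)
  Commutes-∙ {g} {h} p q i = begin
    g ∙ h ∙ b i     ≡⟨ assoc g h _ ⟩
    g ∙ (h ∙ b i)   ≡⟨ cong (g ∙_) (q i) ⟩
    g ∙ (b i ∙ h)   ≡⟨ sym (assoc g _ h) ⟩
    g ∙ b i ∙ h     ≡⟨ cong (_∙ h) (p i) ⟩
    b i ∙ g ∙ h     ≡⟨ assoc _ g h ⟩
    b i ∙ (g ∙ h)   ∎

  Commutes-bit : ∀ u c → Commutes ⟦ u ⟧ → Commutes ⟦ bit u c ⟧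
  Commutes-bit u true  p = p
  Commutes-bit u false p = Commutes-ε

  x²-commutes : Commutes ⟦ X · X ⟧
  x²-commutes 0F = assoc x x x
  x²-commutes 1F = consequence sat (X · X · Y ≐ Y · (X · X)) ((0 , 3 , 0 , false) ∷ [])
  x²-commutes 2F = consequence sat (X · X · Z ≐ Z · (X · X)) ((0 , 4 , 0 , false) ∷ [])

  y²-commutes : Commutes ⟦ Y · Y ⟧
  y²-commutes 0F = consequence sat (Y · Y · X ≐ X · (Y · Y)) ((0 , 5 , 0 , false) ∷ [])
  y²-commutes 1F = assoc y y y
  y²-commutes 2F = consequence sat (Y · Y · Z ≐ Z · (Y · Y)) ((0 , 6 , 0 , false) ∷ [])

  z²-commutes : Commutes ⟦ Z · Z ⟧
  z²-commutes 0F = consequence sat (Z · Z · X ≐ X · (Z · Z)) ((0 , 7 , 0 , false) ∷ [])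
  z²-commutes 1F = consequence sat (Z · Z · Y ≐ Y · (Z · Z)) ((0 , 8 , 0 , false) ∷ [])
  z²-commutes 2F = assoc z z z

  central-commutes : ∀ n → Commutes ⟦ central n ⟧
  central-commutes (a ∷ b ∷ c ∷ []) = Commutes-∙ (Commutes-∙ (Commutes-bit (X · X) a x²-commutes)
    (Commutes-bit (Y · Y) b y²-commutes)) (Commutes-bit (Z · Z) c z²-commutes)

  bit-xor : ∀ u → ⟦ u · u ⟧ ≡ ε → ∀ a a′ → ⟦ bit u (a xor a′) ⟧ ≡ ⟦ bit u a ⟧ ∙ ⟦ bit u a′ ⟧
  bit-xor u p true  true  = sym p
  bit-xor u p true  false = sym (identityʳ _)
  bit-xor u p false a′    = sym (identityˡ _)

  central-commute : ∀ n u → ⟦ central n ⟧ ∙ ⟦ u ⟧ ≡ ⟦ u ⟧ ∙ ⟦ central n ⟧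
  central-commute n = commutes-eval (central-commutes n)

  central-⊞ : ∀ n m → ⟦ central (n ⊞ m) ⟧ ≡ ⟦ central n ⟧ ∙ ⟦ central m ⟧
  central-⊞ (a ∷ d ∷ c ∷ []) (a′ ∷ d′ ∷ c′ ∷ []) =
    trans (cong₂ _∙_ (cong₂ _∙_ (bit-xor (X · X) x⁴ a a′) (bit-xor (Y · Y) y⁴ d d′)) (bit-xor (Z · Z) z⁴ c c′))
      (elements-consequence {R = Y · Z ≐ Z · Y ∷ Y · D ≐ D · Y ∷ W · D ≐ D · W ∷ []} (commutes-eval (Commutes-bit (X · X) a′ x²-commutes) (bit (Y · Y) d) ∷ commutes-eval (Commutes-bit (X · X) a′ x²-commutes) (bit (Z · Z) c) ∷ commutes-eval (Commutes-bit (Y · Y) d′ y²-commutes) (bit (Z · Z) c) ∷ []) ((X · Y) · (Z · W) · (D · F) ≐ (X · Z · D) · (Y · W · F)) ((3 , 2 , 0 , false) ∷ (3 , 1 , 1 , false) ∷ (1 , 0 , 0 , false) ∷ []))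
    where
    open Elements (⟦ bit (X · X) a ⟧ ∷ ⟦ bit (X · X) a′ ⟧ ∷ ⟦ bit (Y · Y) d ⟧ ∷ ⟦ bit (Y · Y) d′ ⟧ ∷ ⟦ bit (Z · Z) c ⟧ ∷ ⟦ bit (Z · Z) c′ ⟧ ∷ [])
    x⁴ : ⟦ X · X · (X · X) ⟧ ≡ ε
    x⁴ = Eval.consequence H b sat (X · X · (X · X) ≐ e) ((0 , 0 , 0 , false) ∷ [])
    y⁴ : ⟦ Y · Y · (Y · Y) ⟧ ≡ ε
    y⁴ = Eval.consequence H b sat (Y · Y · (Y · Y) ≐ e) ((0 , 1 , 0 , false) ∷ [])
    z⁴ : ⟦ Z · Z · (Z · Z) ⟧ ≡ ε
    z⁴ = Eval.consequence H b sat (Z · Z · (Z · Z) ≐ e) ((0 , 2 , 0 , false) ∷ [])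

  central-zero : ⟦ central (replicate 3 false) ⟧ ≡ ε
  central-zero = free-identity (e · e · e ≐ e)

  y-x : ⟦ Y ⟧ ∙ ⟦ X ⟧ ≡ ⟦ X ⟧ ∙ ⟦ Y ⟧ ∙ ⟦ central yx ⟧
  y-x = All.lookup sat (there (there (there (there (there (there (there (there (there (here refl))))))))))

  z-x : ⟦ Z ⟧ ∙ ⟦ X ⟧ ≡ ⟦ X ⟧ ∙ ⟦ Z ⟧ ∙ ⟦ central zx ⟧
  z-x = All.lookup sat (there (there (there (there (there (there (there (there (there (there (here refl)))))))))))

  z-y : ⟦ Z ⟧ ∙ ⟦ Y ⟧ ≡ ⟦ Y ⟧ ∙ ⟦ Z ⟧ ∙ ⟦ central zy ⟧
  z-y = All.lookup sat (there (there (there (there (there (there (there (there (there (there (there (here refl))))))))))))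

  power-power : ∀ u i i′ → ⟦ bit u i ⟧ ∙ ⟦ bit u i′ ⟧ ≡ ⟦ bit u (i xor i′) ⟧ ∙ ⟦ bit (u · u) (i ∧ i′) ⟧
  power-power u true  true  = sym (identityˡ _)
  power-power u true  false = refl
  power-power u false i′    = trans (identityˡ _) (sym (identityʳ _))

  power-swap : ∀ u v c → ⟦ u ⟧ ∙ ⟦ v ⟧ ≡ ⟦ v ⟧ ∙ ⟦ u ⟧ ∙ ⟦ central c ⟧ →
               ∀ k i → ⟦ bit u k ⟧ ∙ ⟦ bit v i ⟧ ≡ ⟦ bit v i ⟧ ∙ ⟦ bit u k ⟧ ∙ ⟦ central ((k ∧ i) ⊡ c) ⟧
  power-swap u v c p true  true  = p
  power-swap u v c p true  false = begin
    ⟦ u ⟧ ∙ ε                 ≡⟨ trans (identityʳ _) (sym (identityˡ _)) ⟩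
    ε ∙ ⟦ u ⟧                 ≡⟨ sym (identityʳ _) ⟩
    ε ∙ ⟦ u ⟧ ∙ ε             ≡⟨ cong (ε ∙ ⟦ u ⟧ ∙_) (sym central-zero) ⟩
    ε ∙ ⟦ u ⟧ ∙ ⟦ central (replicate 3 false) ⟧ ∎
  power-swap u v c p false i = begin
    ε ∙ ⟦ bit v i ⟧           ≡⟨ trans (identityˡ _) (sym (identityʳ _)) ⟩
    ⟦ bit v i ⟧ ∙ ε           ≡⟨ sym (identityʳ _) ⟩
    ⟦ bit v i ⟧ ∙ ε ∙ ε       ≡⟨ cong (⟦ bit v i ⟧ ∙ ε ∙_) (sym central-zero) ⟩
    ⟦ bit v i ⟧ ∙ ε ∙ ⟦ central (replicate 3 false) ⟧ ∎

  value : Normal → C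
  value n = ⟦ normalWord n ⟧

  -- A collection process: `x₂` is moved left past `z₁` and `y₁`, then `y₂` past `z₁`. Each passage
  -- leaves a commutator, each meeting of equal letters a square, and these central factors are
  -- gathered at the right end.
  value-⊕ : ∀ n m → value (n ⊕ m) ≡ value n ∙ value m
  value-⊕ (i ∷ j ∷ k ∷ [] , n) (i′ ∷ j′ ∷ k′ ∷ [] , n′) = sym (begin
    x₁ ∙ y₁ ∙ z₁ ∙ cn ∙ (x₂ ∙ y₂ ∙ z₂ ∙ cn′)         ≡⟨ step₁ ⟩
    x₁ ∙ y₁ ∙ z₁ ∙ x₂ ∙ y₂ ∙ z₂ ∙ (cn ∙ cn′)         ≡⟨ cong (λ t → t ∙ y₂ ∙ z₂ ∙ (cn ∙ cn′)) step₂ ⟩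
    x₃ ∙ y₁ ∙ z₁ ∙ w₁ ∙ y₂ ∙ z₂ ∙ (cn ∙ cn′)         ≡⟨ step₃ ⟩
    x₃ ∙ y₁ ∙ z₁ ∙ y₂ ∙ z₂ ∙ (w₁ ∙ (cn ∙ cn′))       ≡⟨ cong (λ t → t ∙ z₂ ∙ (w₁ ∙ (cn ∙ cn′))) step₄ ⟩
    x₃ ∙ y₃ ∙ z₁ ∙ w₂ ∙ z₂ ∙ (w₁ ∙ (cn ∙ cn′))       ≡⟨ step₅ ⟩
    x₃ ∙ y₃ ∙ (z₁ ∙ z₂) ∙ (w₂ ∙ w₁ ∙ (cn ∙ cn′))     ≡⟨ cong (λ t → x₃ ∙ y₃ ∙ t ∙ (w₂ ∙ w₁ ∙ (cn ∙ cn′))) (power-power Z k k′) ⟩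
    x₃ ∙ y₃ ∙ (z₃ ∙ q₃) ∙ (w₂ ∙ w₁ ∙ (cn ∙ cn′))     ≡⟨ step₆ ⟩
    x₃ ∙ y₃ ∙ z₃ ∙ (q₁ ∙ q₂ ∙ q₃ ∙ (r₁ ∙ r₂) ∙ r₃ ∙ (cn ∙ cn′)) ≡⟨ cong (x₃ ∙ y₃ ∙ z₃ ∙_) (sym step₇) ⟩
    x₃ ∙ y₃ ∙ z₃ ∙ ⟦ central (cocycle (i ∷ j ∷ k ∷ []) (i′ ∷ j′ ∷ k′ ∷ []) ⊞ (n ⊞ n′)) ⟧ ∎)
    where
    p₁ = (j ∧ i′) ⊡ yx
    p₂ = (k ∧ i′) ⊡ zx
    p₃ = (k ∧ j′) ⊡ zy
    x₁ = ⟦ bit X i ⟧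
    x₂ = ⟦ bit X i′ ⟧
    x₃ = ⟦ bit X (i xor i′) ⟧
    y₁ = ⟦ bit Y j ⟧
    y₂ = ⟦ bit Y j′ ⟧
    y₃ = ⟦ bit Y (j xor j′) ⟧
    z₁ = ⟦ bit Z k ⟧
    z₂ = ⟦ bit Z k′ ⟧
    z₃ = ⟦ bit Z (k xor k′) ⟧
    q₁ = ⟦ bit (X · X) (i ∧ i′) ⟧
    q₂ = ⟦ bit (Y · Y) (j ∧ j′) ⟧
    q₃ = ⟦ bit (Z · Z) (k ∧ k′) ⟧
    r₁ = ⟦ central p₁ ⟧
    r₂ = ⟦ central p₂ ⟧
    r₃ = ⟦ central p₃ ⟧
    cn = ⟦ central n ⟧
    cn′ = ⟦ central n′ ⟧
    w₁ = q₁ ∙ r₁ ∙ r₂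
    w₂ = q₂ ∙ r₃

    q₁-commutes : Commutes q₁
    q₁-commutes = Commutes-bit (X · X) (i ∧ i′) x²-commutes
    q₂-commutes : Commutes q₂
    q₂-commutes = Commutes-bit (Y · Y) (j ∧ j′) y²-commutes
    q₃-commutes : Commutes q₃
    q₃-commutes = Commutes-bit (Z · Z) (k ∧ k′) z²-commutes
    w₁-commutes : Commutes w₁
    w₁-commutes = Commutes-∙ (Commutes-∙ q₁-commutes (central-commutes p₁)) (central-commutes p₂)
    w₂-commutes : Commutes w₂
    w₂-commutes = Commutes-∙ q₂-commutes (central-commutes p₃)

    step₁ : x₁ ∙ y₁ ∙ z₁ ∙ cn ∙ (x₂ ∙ y₂ ∙ z₂ ∙ cn′) ≡ x₁ ∙ y₁ ∙ z₁ ∙ x₂ ∙ y₂ ∙ z₂ ∙ (cn ∙ cn′)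
    step₁ = (elements-consequence {R = Y · Z ≐ Z · Y ∷ Y · W ≐ W · Y ∷ Y · D ≐ D · Y ∷ []} (central-commute n (bit X i′) ∷ central-commute n (bit Y j′) ∷ central-commute n (bit Z k′) ∷ []) (X · Y · (Z · W · D · F) ≐ X · Z · W · D · (Y · F)) ((4 , 2 , 1 , false) ∷ (3 , 1 , 1 , false) ∷ (1 , 0 , 0 , false) ∷ []))
      where open Elements (x₁ ∙ y₁ ∙ z₁ ∷ cn ∷ x₂ ∷ y₂ ∷ z₂ ∷ cn′ ∷ [])

    step₂ : x₁ ∙ y₁ ∙ z₁ ∙ x₂ ≡ x₃ ∙ y₁ ∙ z₁ ∙ w₁
    step₂ = (elements-consequence {R = Z · W ≐ W · Z · F ∷ Y · W ≐ W · Y · D ∷ X · W ≐ L · J ∷ D · Z ≐ Z · D ∷ J · Y ≐ Y · J ∷ J · Z ≐ Z · J ∷ []} (power-swap Z X zx z-x k i′ ∷ power-swap Y X yx y-x j i′ ∷ power-power X i i′ ∷ central-commute p₁ (bit Z k) ∷ commutes-eval q₁-commutes (bit Y j) ∷ commutes-eval q₁-commutes (bit Z k) ∷ []) (X · Y · Z · W ≐ L · Y · Z · (J · D · F)) ((2 , 0 , 0 , false) ∷ (5 , 5 , 2 , false) ∷ (3 , 3 , 1 , false) ∷ (1 , 1 , 0 , false) ∷ (2 , 4 , 1 , false) ∷ (0 , 2 , 0 , false) ∷ []))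
      where open Elements (x₁ ∷ y₁ ∷ z₁ ∷ x₂ ∷ r₁ ∷ r₂ ∷ q₁ ∷ x₃ ∷ [])

    step₃ : x₃ ∙ y₁ ∙ z₁ ∙ w₁ ∙ y₂ ∙ z₂ ∙ (cn ∙ cn′) ≡ x₃ ∙ y₁ ∙ z₁ ∙ y₂ ∙ z₂ ∙ (w₁ ∙ (cn ∙ cn′))
    step₃ = (elements-consequence {R = Y · Z ≐ Z · Y ∷ Y · W ≐ W · Y ∷ []} (commutes-eval w₁-commutes (bit Y j′) ∷ commutes-eval w₁-commutes (bit Z k′) ∷ []) (X · Y · Z · W · D ≐ X · Z · W · (Y · D)) ((3 , 1 , 1 , false) ∷ (1 , 0 , 0 , false) ∷ []))
      where open Elements (x₃ ∙ y₁ ∙ z₁ ∷ w₁ ∷ y₂ ∷ z₂ ∷ cn ∙ cn′ ∷ [])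

    step₄ : x₃ ∙ y₁ ∙ z₁ ∙ y₂ ≡ x₃ ∙ y₃ ∙ z₁ ∙ w₂
    step₄ = (elements-consequence {R = Z · W ≐ W · Z · D ∷ Y · W ≐ L · J ∷ J · Z ≐ Z · J ∷ []} (power-swap Z Y zy z-y k j′ ∷ power-power Y j j′ ∷ commutes-eval q₂-commutes (bit Z k) ∷ []) (X · Y · Z · W ≐ X · L · Z · (J · D)) ((2 , 0 , 0 , false) ∷ (3 , 2 , 1 , false) ∷ (1 , 1 , 0 , false) ∷ []))
      where open Elements (x₃ ∷ y₁ ∷ z₁ ∷ y₂ ∷ r₃ ∷ ε ∷ q₂ ∷ y₃ ∷ [])

    step₅ : x₃ ∙ y₃ ∙ z₁ ∙ w₂ ∙ z₂ ∙ (w₁ ∙ (cn ∙ cn′)) ≡ x₃ ∙ y₃ ∙ (z₁ ∙ z₂) ∙ (w₂ ∙ w₁ ∙ (cn ∙ cn′))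
    step₅ = (elements-consequence {R = Z · W ≐ W · Z ∷ []} (commutes-eval w₂-commutes (bit Z k′) ∷ []) (X · Y · Z · W · (D · F) ≐ X · (Y · W) · (Z · D · F)) ((2 , 0 , 0 , false) ∷ []))
      where open Elements (x₃ ∙ y₃ ∷ z₁ ∷ w₂ ∷ z₂ ∷ w₁ ∷ cn ∙ cn′ ∷ [])

    step₆ : x₃ ∙ y₃ ∙ (z₃ ∙ q₃) ∙ (w₂ ∙ w₁ ∙ (cn ∙ cn′)) ≡ x₃ ∙ y₃ ∙ z₃ ∙ (q₁ ∙ q₂ ∙ q₃ ∙ (r₁ ∙ r₂) ∙ r₃ ∙ (cn ∙ cn′))
    step₆ = (elements-consequence {R = W · Z ≐ Z · W ∷ W · D ≐ D · W ∷ W · F ≐ F · W ∷ J · Y ≐ Y · J ∷ J · Z ≐ Z · J ∷ J · D ≐ D · J ∷ J · F ≐ F · J ∷ J · W ≐ W · J ∷ Y · Z ≐ Z · Y ∷ []} (central-commute p₃ (bit (X · X) (i ∧ i′)) ∷ central-commute p₃ (central p₁) ∷ central-commute p₃ (central p₂)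
        ∷ commutes-eval q₃-commutes (bit (Y · Y) (j ∧ j′)) ∷ commutes-eval q₃-commutes (bit (X · X) (i ∧ i′))
        ∷ commutes-eval q₃-commutes (central p₁) ∷ commutes-eval q₃-commutes (central p₂)
        ∷ commutes-eval q₃-commutes (central p₃) ∷ commutes-eval q₂-commutes (bit (X · X) (i ∧ i′)) ∷ []) (X · (M · J) · ((Y · W) · (Z · D · F) · L) ≐ X · M · (Z · Y · J · (D · F) · W · L)) ((7 , 2 , 1 , false) ∷ (6 , 1 , 1 , false) ∷ (4 , 0 , 0 , false) ∷ (6 , 8 , 2 , false) ∷ (4 , 4 , 1 , false) ∷ (2 , 3 , 0 , false) ∷ []))
      where open Elements (x₃ ∙ y₃ ∷ q₂ ∷ q₁ ∷ r₃ ∷ r₁ ∷ r₂ ∷ q₃ ∷ cn ∙ cn′ ∷ z₃ ∷ [])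

    step₇ : ⟦ central (cocycle (i ∷ j ∷ k ∷ []) (i′ ∷ j′ ∷ k′ ∷ []) ⊞ (n ⊞ n′)) ⟧ ≡ q₁ ∙ q₂ ∙ q₃ ∙ (r₁ ∙ r₂) ∙ r₃ ∙ (cn ∙ cn′)
    step₇ = trans (central-⊞ (q ⊞ (p₁ ⊞ p₂) ⊞ p₃) (n ⊞ n′)) (cong₂ _∙_
      (trans (central-⊞ (q ⊞ (p₁ ⊞ p₂)) p₃) (cong (_∙ r₃) (trans (central-⊞ q (p₁ ⊞ p₂)) (cong (q₁ ∙ q₂ ∙ q₃ ∙_) (central-⊞ p₁ p₂)))))
      (central-⊞ n n′))
      where
      q : Bits
      q = i ∧ i′ ∷ j ∧ j′ ∷ k ∧ k′ ∷ []

  value-inverse-generator : ∀ (u : Word 3) → ⟦ u · u · (u · u) ⟧ ≡ ε → ⟦ u ⟧ ∙ ⟦ u · u ⟧ ≡ ⟦ u ⟧ ⁻¹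
  value-inverse-generator u p = (elements-consequence {R = X · X · (X · X) ≐ e ∷ []} (p ∷ []) (X · (X · X) ≐ X ⁻) ((0 , 0 , 0 , false) ∷ []))
    where open Elements (⟦ u ⟧ ∷ [])

  value-letter : ∀ l → value (letterNormal l) ≡ letter l
  value-letter (0F , true)  = free-identity (normalWord (letterNormal (0F , true)) ≐ X)
  value-letter (1F , true)  = free-identity (normalWord (letterNormal (1F , true)) ≐ Y)
  value-letter (2F , true)  = free-identity (normalWord (letterNormal (2F , true)) ≐ Z)
  value-letter (0F , false) = consequence sat (normalWord (letterNormal (0F , false)) ≐ X ⁻) ((0 , 0 , 0 , false) ∷ [])
  value-letter (1F , false) = consequence sat (normalWord (letterNormal (1F , false)) ≐ Y ⁻) ((0 , 1 , 0 , false) ∷ [])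
  value-letter (2F , false) = consequence sat (normalWord (letterNormal (2F , false)) ≐ Z ⁻) ((0 , 2 , 0 , false) ∷ [])

  value-fromString : ∀ w → value (fromString w) ≡ ⟪ w ⟫
  value-fromString []      = free-identity (normalWord (replicate 3 false , replicate 3 false) ≐ e)
  value-fromString (l ∷ w) = trans (value-⊕ (letterNormal l) (fromString w)) (cong₂ _∙_ (value-letter l) (value-fromString w))

  value-normal : ∀ u → value (normal u) ≡ ⟦ u ⟧
  value-normal u = trans (value-fromString (flatten u)) (⟪⟫-flatten u)

  value-⟨⟩ : ∀ {g} → ⟨_⟩ H b g → ∃ λ n → value n ≡ g
  value-⟨⟩ (gen i) = normal (var i) , value-normal (var i)
  value-⟨⟩ one     = normal e , value-normal e
  value-⟨⟩ (mul p q) with value-⟨⟩ p | value-⟨⟩ q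
  ... | n , refl | m , refl = n ⊕ m , value-⊕ n m
  value-⟨⟩ (inv p) with value-⟨⟩ p
  ... | n , refl = normal (normalWord n ⁻) , value-normal (normalWord n ⁻)

  difference : Normal → Normal → Normal
  difference n m = normal (normalWord n · normalWord m ⁻)

  value-difference : ∀ n m → value (difference n m) ≡ value n ∙ value m ⁻¹
  value-difference n m = value-normal (normalWord n · normalWord m ⁻)

  -- Merging `x` and `x²` into `x⁻¹` leaves a generator of odd exponent with exactly one occurrence,
  -- the form in which independence applies to it.
  signed : Word 3 → Bool → Bool → Word 3
  signed u true  true  = u ⁻
  signed u true  false = u
  signed u false true  = u · u
  signed u false false = e

  signedWord : Normal → Word 3
  signedWord (i ∷ j ∷ k ∷ [] , a ∷ c ∷ d ∷ []) = signed X i a · signed Y j c · signed Z k d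

  power-signed : ∀ u → ⟦ u · u · (u · u) ⟧ ≡ ε → ∀ i a → ⟦ bit u i ⟧ ∙ ⟦ bit (u · u) a ⟧ ≡ ⟦ signed u i a ⟧
  power-signed u p true  true  = value-inverse-generator u p
  power-signed u p true  false = identityʳ _
  power-signed u p false true  = identityˡ _
  power-signed u p false false = identityˡ _

  value-signed : ∀ n → value n ≡ ⟦ signedWord n ⟧
  value-signed (i ∷ j ∷ k ∷ [] , a ∷ c ∷ d ∷ []) = trans
    (elements-consequence {R = W · Y ≐ Y · W ∷ W · Z ≐ Z · W ∷ D · Z ≐ Z · D ∷ []} (commutes-eval (Commutes-bit (X · X) a x²-commutes) (bit Y j) ∷ commutes-eval (Commutes-bit (X · X) a x²-commutes) (bit Z k) ∷ commutes-eval (Commutes-bit (Y · Y) c y²-commutes) (bit Z k) ∷ []) (X · Y · Z · (W · D · F) ≐ X · W · (Y · D) · (Z · F)) ((4 , 2 , 3 , true) ∷ (2 , 1 , 0 , true) ∷ (1 , 0 , 0 , true) ∷ []))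
    (cong₂ _∙_ (cong₂ _∙_ (power-signed X (consequence sat (X · X · (X · X) ≐ e) ((0 , 0 , 0 , false) ∷ [])) i a)
                          (power-signed Y (consequence sat (Y · Y · (Y · Y) ≐ e) ((0 , 1 , 0 , false) ∷ [])) j c))
               (power-signed Z (consequence sat (Z · Z · (Z · Z) ≐ e) ((0 , 2 , 0 , false) ∷ [])) k d))
    where open Elements (⟦ bit X i ⟧ ∷ ⟦ bit Y j ⟧ ∷ ⟦ bit Z k ⟧ ∷ ⟦ bit (X · X) a ⟧ ∷ ⟦ bit (Y · Y) c ⟧ ∷ ⟦ bit (Z · Z) d ⟧ ∷ [])

  value-central : ∀ n → ⟦ central n ⟧ ≡ value (o ∷ o ∷ o ∷ [] , n)
  value-central n = sym (trans (cong (_∙ ⟦ central n ⟧) (trans (cong (_∙ ε) (identityˡ ε)) (identityˡ ε))) (identityˡ _))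

isZero : Bits → Bool
isZero (a ∷ b ∷ c ∷ []) = not a ∧ not b ∧ not c

inKernel : (Bits → Bool) → Normal → Bool
inKernel ker (v , n) = isZero v ∧ ker n

-- Rank three separates the identity from every normal form with an odd exponent. Equality therefore
-- becomes decidable as soon as `ker` lists precisely the trivial products of squares.
module Kernel (G : FinGroup) (rank : NotGeneratedByTwo G) (a : Fin 3 → Carrier G) (gn : Generates G a)
  (κ : Commutators) (sat : Satisfies G a (quadratic κ)) (ker : Bits → Bool)
  (ker-sound : ∀ n → T (ker n) → eval G a (central n) ≡ FinGroup.ε G)
  (ker-complete : ∀ n → eval G a (central n) ≡ FinGroup.ε G → T (ker n)) where
  open GroupOf G
  open Eval G a
  open Independence G rank a gn
  open Multiplication κ public
  open QuadraticGroup G κ a sat public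

  independent : Vec Bool 6 → Bool
  independent (i ∷ j ∷ k ∷ n) = isZero (i ∷ j ∷ k ∷ []) ∨ once (reduce (relator (signedWord (i ∷ j ∷ k ∷ [] , n) ≐ e)))

  kernel-complete : ∀ n → value n ≡ ε → T (inKernel ker n)
  -- Evaluation runs through all 64 normal forms here: either all exponents are even or some
  -- generator occurs once.
  kernel-complete v@(i ∷ j ∷ k ∷ [] , n) eq with Equivalence.to (T-∨ {isZero (i ∷ j ∷ k ∷ [])}) (every-sound 6 independent tt (i ∷ j ∷ k ∷ n))
  kernel-complete (o ∷ o ∷ o ∷ [] , n) eq | inj₁ t = ker-complete n (trans (value-central n) eq)
  kernel-complete v eq | inj₂ t = ⊥-elim (primitive-≢ (signedWord v ≐ e) {t} (trans (sym (value-signed v)) eq))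

  kernel-sound : ∀ n → T (inKernel ker n) → value n ≡ ε
  kernel-sound (o ∷ o ∷ o ∷ [] , n) t = trans (sym (value-central n)) (ker-sound n t)

  equal? : Normal → Normal → Bool
  equal? n m = inKernel ker (difference n m)

  equal-sound : ∀ {n m} → T (equal? n m) → value n ≡ value m
  equal-sound {n} {m} t = quotient-trivial (trans (sym (value-difference n m)) (kernel-sound (difference n m) t))

  equal-complete : ∀ {n m} → value n ≡ value m → T (equal? n m)
  equal-complete {n} {m} eq = kernel-complete (difference n m) (trans (value-difference n m) (trivial-quotient eq))

  value-surjective : ∀ g → ∃ λ n → value n ≡ g
  value-surjective g = value-⟨⟩ (gn g)

  -- An element goes to the value in `H` of a normal form of it. The choice is immaterial: two
  -- normal forms of one element differ by a member of `ker`, which is complete for `G`, and the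
  -- relations make every member of `ker` trivial in `H`.
  presentation : ∀ {R} → Satisfies G a R →
    (∀ H b → Satisfies H b R → Satisfies H b (quadratic κ) × (∀ n → T (ker n) → eval H b (central n) ≡ FinGroup.ε H)) →
    IsPresentedBy G 3 R
  presentation {R} satR universal = a , gn , satR , λ H b satH → let satQ , kerH = universal H b satH in
    Universal.hom H b satQ kerH , Universal.isHom H b satQ kerH , Universal.hom-generator H b satQ kerH
    where
    module Universal (H : FinGroup) (b : Fin 3 → Carrier H) (satQ : Satisfies H b (quadratic κ))
                     (kerH : ∀ n → T (ker n) → eval H b (central n) ≡ FinGroup.ε H) where
      module E = Eval H b
      module Q = QuadraticGroup H κ b satQ
      open ≡-Reasoning

      hom : Carrier G → Carrier H
      hom g = Q.value (proj₁ (value-surjective g))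

      kernelH : ∀ n → T (inKernel ker n) → Q.value n ≡ FinGroup.ε H
      kernelH (o ∷ o ∷ o ∷ [] , n) t = trans (sym (Q.value-central n)) (kerH n t)

      same-value : ∀ {n m} → value n ≡ value m → Q.value n ≡ Q.value m
      same-value {n} {m} eq = E.quotient-trivial (trans (sym (Q.value-difference n m)) (kernelH (difference n m) (equal-complete {n} {m} eq)))

      hom-value : ∀ n → hom (value n) ≡ Q.value n
      hom-value n = same-value {proj₁ (value-surjective (value n))} {n} (proj₂ (value-surjective (value n)))

      isHom : IsHom G H hom
      isHom g h = begin
        hom (g ∙ h)                    ≡⟨ cong hom (sym (trans (value-⊕ n m) (cong₂ _∙_ (proj₂ (value-surjective g)) (proj₂ (value-surjective h))))) ⟩
        hom (value (n ⊕ m))            ≡⟨ hom-value (n ⊕ m) ⟩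
        Q.value (n ⊕ m)                ≡⟨ Q.value-⊕ n m ⟩
        FinGroup._∙_ H (hom g) (hom h) ∎
        where
        n = proj₁ (value-surjective g)
        m = proj₁ (value-surjective h)

      hom-generator : ∀ i → hom (a i) ≡ b i
      hom-generator i = begin
        hom (a i)                      ≡⟨ cong hom (sym (value-normal (var i))) ⟩
        hom (value (normal (var i)))   ≡⟨ hom-value (normal (var i)) ⟩
        Q.value (normal (var i))       ≡⟨ Q.value-normal (var i) ⟩
        b i                            ∎

  module Connection {m : ℕ} (S : Vec (Word 3) m) where
    s : Fin m → C
    s i = ⟦ Vec.lookup S i ⟧

    after before : Fin m → Normal → Normal
    after  i v = normal (Vec.lookup S i) ⊕ v
    before i v = normal (Vec.lookup S i ⁻) ⊕ v

    separated : Bool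
    separated = all (λ i → all (λ j → not (inKernel ker (normal (Vec.lookup S i · Vec.lookup S j)))) (allFin m)) (allFin m)

    module Separated (sep : T separated) where
      open Rigidity G s public using (Oriented; Fixed; Fixed-∙; Fixed-⁻¹; Fixed-⟨⟩; fixed-last; orr)

      not-T : ∀ b → T (not b) → ¬ T b
      not-T false _ ()

      oriented : Oriented
      oriented i j eq = not-T _ (all-∈ _ (all-∈ _ sep (∈-allFin i)) (∈-allFin j))
        (kernel-complete (normal (Vec.lookup S i · Vec.lookup S j)) (trans (value-normal (Vec.lookup S i · Vec.lookup S j)) eq))

      open Rigidity.Global G s value value-surjective after before
        (λ i v → trans (value-⊕ (normal (Vec.lookup S i)) v) (cong (_∙ value v) (value-normal (Vec.lookup S i))))
        (λ i v → trans (value-⊕ (normal (Vec.lookup S i ⁻)) v) (cong (_∙ value v) (value-normal (Vec.lookup S i ⁻)))) public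

      at : (u : Word 3) → Fixed ⟦ u ⟧ → Invariant
      at u p = constant (normal u) (subst Fixed (sym (value-normal u)) p) equal?
        (λ {n} {m} → equal-sound {n} {m}) (λ {n} {m} → equal-complete {n} {m})

      root : Invariant
      -- The identity is generated by the empty family, hence fixed before anything else is known.
      root = at e (Rigidity.Fixed-⟨⟩ G s {k = 0} {b = λ ()} (λ ()) one)

      fixed : (P : Invariant) → ∀ i →
        {_ : T (all (λ j → ⌊ j ≟F i ⌋ ∨ not (holds P (normal (Vec.lookup S j)))) (allFin m))} →
        {_ : T (holds P (normal (Vec.lookup S i)))} → Fixed (s i)
      fixed P i {u} {t} = fixed-by P (λ j → normal (Vec.lookup S j)) (λ j → value-normal (Vec.lookup S j)) i u t

      Fixed-word : ∀ u v → {_ : T (equal? (normal u) (normal v))} → Fixed ⟦ u ⟧ → Fixed ⟦ v ⟧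
      Fixed-word u v {t} = subst Fixed (trans (sym (value-normal u)) (trans (equal-sound {normal u} {normal v} t) (value-normal v)))

-- Families of order at most 64

0ᵇ x²ᵇ x²y²ᵇ x²z²ᵇ y²z²ᵇ : Bits
0ᵇ   = o ∷ o ∷ o ∷ []
x²ᵇ   = ı ∷ o ∷ o ∷ []
x²y²ᵇ = ı ∷ ı ∷ o ∷ []
x²z²ᵇ = ı ∷ o ∷ ı ∷ []
y²z²ᵇ = o ∷ ı ∷ ı ∷ []

-- In the first two `z` is a central involution; `H` is the group of order 16 generated by a paired
-- `x`, `y` with trivial fourth powers. The third is `relG1` without `x²y²z² = 1`.
relQ₈×C₂ relH×C₂ relOrder64 : List (Relation 3)
relQ₈×C₂ = Y ⁻ · X · Y · X ≐ e ∷ X ⁻ · Y · X · Y ≐ e ∷ X · Z ≐ Z · X ∷ Y · Z ≐ Z · Y ∷ Z · Z ≐ e ∷ []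
relH×C₂ = X · Y · (X · Y) ≐ e ∷ X · Y ⁻ · (X · Y ⁻) ≐ e ∷ X · X · (X · X) ≐ e ∷ Y · Y · (Y · Y) ≐ e
        ∷ X · Z ≐ Z · X ∷ Y · Z ≐ Z · Y ∷ Z · Z ≐ e ∷ []
relOrder64 = X ^ 4 ≐ e ∷ Y ^ 4 ≐ e ∷ Z ^ 4 ≐ e
        ∷ (X · Y) ^ 2 ≐ e ∷ (X · Y ⁻) ^ 2 ≐ e ∷ (X · Z) ^ 2 ≐ e ∷ (X · Z ⁻) ^ 2 ≐ e
        ∷ (Y · Z) ^ 2 ≐ e ∷ (Y · Z ⁻) ^ 2 ≐ e ∷ []

-- When fourth powers vanish, `(xy)² = (xy⁻¹)² = 1` gives `yx = xy x²y²`, the source of `κH×C₂` and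
-- `κOrder64`. Mutual inversion gives `yx = xy x²`.
κQ₈×C₂ κH×C₂ κOrder64 κ₀ κG2 : Commutators
κQ₈×C₂  = commutators x²ᵇ 0ᵇ 0ᵇ
κH×C₂   = commutators x²y²ᵇ 0ᵇ 0ᵇ
κOrder64 = commutators x²y²ᵇ x²z²ᵇ y²z²ᵇ
κ₀      = commutators 0ᵇ 0ᵇ 0ᵇ
κG2     = commutators 0ᵇ x²ᵇ 0ᵇ

module _ {H : FinGroup} {b : Fin 3 → Carrier H} where
  open Eval H b using (consequences)

  quadraticQ₈×C₂ : Satisfies H b relQ₈×C₂ → Satisfies H b (quadratic κQ₈×C₂)
  quadraticQ₈×C₂ sat = consequences sat (quadratic κQ₈×C₂) (((3 , 1 , 1 , true) ∷ (2 , 0 , 1 , false) ∷ (1 , 0 , 1 , false) ∷ (0 , 1 , 2 , false) ∷ []) ∷ ((0 , 0 , 1 , true) ∷ (1 , 1 , 1 , false) ∷ (1 , 0 , 1 , false) ∷ (0 , 1 , 2 , false) ∷ []) ∷ ((0 , 4 , 0 , false) ∷ (0 , 4 , 0 , false) ∷ []) ∷ ((1 , 1 , 2 , false) ∷ (0 , 1 , 1 , true) ∷ []) ∷ ((1 , 2 , 0 , false) ∷ (0 , 2 , 0 , false) ∷ []) ∷ ((1 , 0 , 2 , false) ∷ (0 , 0 , 1 , true) ∷ []) ∷ ((1 , 3 , 0 , false) ∷ (0 , 3 , 0 , false) ∷ []) ∷ ((3 , 4 , 0 , true) ∷ (0 , 4 , 0 , false) ∷ []) ∷ ((3 , 4 ,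 0 , true) ∷ (0 , 4 , 0 , false) ∷ []) ∷ ((0 , 0 , 1 , true) ∷ []) ∷ ((0 , 2 , 0 , true) ∷ []) ∷ ((0 , 3 , 0 , true) ∷ []) ∷ [])

  quadraticH×C₂ : Satisfies H b relH×C₂ → Satisfies H b (quadratic κH×C₂)
  quadraticH×C₂ sat = consequences sat (quadratic κH×C₂) (((0 , 2 , 0 , false) ∷ []) ∷ ((0 , 3 , 0 , false) ∷ []) ∷ ((0 , 6 , 0 , false) ∷ (0 , 6 , 0 , false) ∷ []) ∷ ((2 , 1 , 0 , true) ∷ (3 , 0 , 0 , true) ∷ (0 , 2 , 0 , false) ∷ []) ∷ ((1 , 4 , 0 , false) ∷ (0 , 4 , 0 , false) ∷ []) ∷ ((3 , 3 , 0 , true) ∷ (1 , 0 , 1 , false) ∷ (0 , 1 , 0 , true) ∷ []) ∷ ((1 , 5 , 0 , false) ∷ (0 , 5 , 0 , false) ∷ []) ∷ ((3 , 6 , 0 , true) ∷ (0 , 6 , 0 , false) ∷ []) ∷ ((3 , 6 , 0 , true) ∷ (0 , 6 , 0 , false) ∷ []) ∷ ((5 , 0 , 1 , true) ∷ (2 , 3 , 0 , true) ∷ (3 , 1 , 0 , true) ∷ (0 , 0 , 1 , false) ∷ []) ∷ ((0 , 4 , 0 , true) ∷ []) ∷ ((0 , 5 , 0 , true) ∷ []) ∷ [])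

  quadraticOrder64 : Satisfies H b relOrder64 → Satisfies H b (quadratic κOrder64)
  quadraticOrder64 sat = consequences sat (quadratic κOrder64) (((0 , 0 , 0 , false) ∷ []) ∷ ((0 , 1 , 0 , false) ∷ []) ∷ ((0 , 2 , 0 , false) ∷ []) ∷ ((2 , 4 , 0 , true) ∷ (3 , 3 , 0 , true) ∷ (0 , 0 , 0 , false) ∷ []) ∷ ((2 , 6 , 0 , true) ∷ (3 , 5 , 0 , true) ∷ (0 , 0 , 0 , false) ∷ []) ∷ ((3 , 1 , 0 , true) ∷ (1 , 3 , 1 , false) ∷ (0 , 4 , 0 , true) ∷ []) ∷ ((2 , 8 , 0 , true) ∷ (3 , 7 , 0 , true) ∷ (0 , 1 , 0 , false) ∷ []) ∷ ((3 , 2 , 0 , true) ∷ (1 , 5 , 1 , false) ∷ (0 , 6 , 0 , true) ∷ []) ∷ ((3 , 2 , 0 , true) ∷ (1 , 7 , 1 , false) ∷ (0 , 8 , 0 , true) ∷ []) ∷ ((5 , 3 , 1 , true) ∷ (2 , 1 , 0 , true) ∷ (3 , 4 , 0 , true) ∷ (0 , 3 , 1 , false) ∷ []) ∷ ((5 , 5 , 1 , true) ∷ (2 , 2 , 0 , true) ∷ (3 , 6 , 0 , true) ∷ (0 , 5 , 1 , false) ∷ []) ∷ ((5 , 7 , 1 , true) ∷ (2 , 2 , 0 , true) ∷ (3 , 8 , 0 , true) ∷ (0 , 7 , 1 , false) ∷ []) ∷ [])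

  quadraticG1 : Satisfies H b relG1 → Satisfies H b (quadratic κOrder64)
  quadraticG1 sat = consequences sat (quadratic κOrder64) (((0 , 0 , 0 , false) ∷ []) ∷ ((0 , 1 , 0 , false) ∷ []) ∷ ((0 , 2 , 0 , false) ∷ []) ∷ ((2 , 4 , 0 , true) ∷ (3 , 3 , 0 , true) ∷ (0 , 0 , 0 , false) ∷ []) ∷ ((2 , 6 , 0 , true) ∷ (3 , 5 , 0 , true) ∷ (0 , 0 , 0 , false) ∷ []) ∷ ((3 , 1 , 0 , true) ∷ (1 , 3 , 1 , false) ∷ (0 , 4 , 0 , true) ∷ []) ∷ ((2 , 8 , 0 , true) ∷ (3 , 7 , 0 , true) ∷ (0 , 1 , 0 , false) ∷ []) ∷ ((3 , 2 , 0 , true) ∷ (1 , 5 , 1 , false) ∷ (0 , 6 , 0 , true) ∷ []) ∷ ((3 , 2 , 0 , true) ∷ (1 , 7 , 1 , false) ∷ (0 , 8 , 0 , true) ∷ []) ∷ ((5 , 3 , 1 , true) ∷ (2 , 1 , 0 , true) ∷ (3 , 4 , 0 , true) ∷ (0 , 3 , 1 , false) ∷ []) ∷ ((5 , 5 , 1 , true) ∷ (2 , 2 , 0 , true) ∷ (3 , 6 , 0 , true) ∷ (0 , 5 , 1 , false) ∷ []) ∷ ((5 , 7 , 1 , true) ∷ (2 , 2 , 0 , true) ∷ (3 , 8 , 0 , true) ∷ (0 , 7 , 1 , false) ∷ []) ∷ [])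

  quadraticG2 : Satisfies H b relG2 → Satisfies H b (quadratic κG2)
  quadraticG2 sat = consequences sat (quadratic κG2) (((0 , 0 , 0 , false) ∷ []) ∷ ((0 , 1 , 0 , false) ∷ []) ∷ ((0 , 2 , 0 , false) ∷ []) ∷ ((2 , 9 , 3 , true) ∷ (0 , 9 , 0 , false) ∷ []) ∷ ((2 , 7 , 3 , true) ∷ (0 , 7 , 0 , false) ∷ []) ∷ ((2 , 9 , 1 , false) ∷ (0 , 9 , 0 , true) ∷ []) ∷ ((2 , 6 , 0 , true) ∷ (3 , 5 , 0 , true) ∷ (0 , 1 , 0 , false) ∷ []) ∷ ((2 , 7 , 1 , false) ∷ (0 , 7 , 0 , true) ∷ []) ∷ ((3 , 2 , 0 , true) ∷ (1 , 5 , 1 , false) ∷ (0 , 6 , 0 , true) ∷ []) ∷ ((1 , 4 , 0 , true) ∷ (0 , 9 , 0 , true) ∷ []) ∷ ((0 , 8 , 1 , true) ∷ []) ∷ ((1 , 6 , 0 , false) ∷ (0 , 7 , 0 , true) ∷ (0 , 9 , 0 , false) ∷ []) ∷ [])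

  quadraticC₄C₂C₂ : Satisfies H b relC4C2C2 → Satisfies H b (quadratic κ₀)
  quadraticC₄C₂C₂ sat = consequences sat (quadratic κ₀) (((0 , 0 , 0 , false) ∷ []) ∷ ((0 , 1 , 0 , false) ∷ (0 , 1 , 0 , false) ∷ []) ∷ ((0 , 2 , 0 , false) ∷ (0 , 2 , 0 , false) ∷ []) ∷ ((1 , 3 , 0 , false) ∷ (0 , 3 , 0 , false) ∷ []) ∷ ((1 , 4 , 0 , false) ∷ (0 , 4 , 0 , false) ∷ []) ∷ ((3 , 1 , 0 , true) ∷ (0 , 1 , 0 , false) ∷ []) ∷ ((3 , 1 , 0 , true) ∷ (0 , 1 , 0 , false) ∷ []) ∷ ((3 , 2 , 0 , true) ∷ (0 , 2 , 0 , false) ∷ []) ∷ ((3 , 2 , 0 , true) ∷ (0 , 2 , 0 , false) ∷ []) ∷ ((0 , 3 , 0 , true) ∷ []) ∷ ((0 , 4 , 0 , true) ∷ []) ∷ ((0 , 5 , 0 , true) ∷ []) ∷ [])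

module _ (G : FinGroup) (rank : NotGeneratedByTwo G) (a : Fin 3 → Carrier G) (gn : Generates G a) where
  open GroupOf G
  open Eval G a

  -- Of the connection set, `xz` alone lies on no directed triangle through the identity. Once fixed
  -- it is named in the formula for `x`, and `x⁻¹` in turn in the one for `y`.
  Q₈×C₂-hasORR : Satisfies G a relQ₈×C₂ → ⟦ X · X ⟧ ≢ ε → HasORR G
  Q₈×C₂-hasORR sat x²≢ε = orr oriented gn λ { 0F → fx ; 1F → fy ; 2F → fz }
    where
    ker : Bits → Bool
    -- Here `x² = y²` has order two and `z² = 1`, so only the parity of `i + j` matters.
    ker (i ∷ j ∷ k ∷ []) = not (i xor j)

    ker-sound : ∀ n → T (ker n) → ⟦ central n ⟧ ≡ ε
    ker-sound (ı ∷ ı ∷ ı ∷ []) _ = consequence sat (central (ı ∷ ı ∷ ı ∷ []) ≐ e) ((4 , 4 , 0 , false) ∷ (1 , 0 , 1 , false) ∷ (0 , 1 , 2 , false) ∷ [])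
    ker-sound (ı ∷ ı ∷ o ∷ []) _ = consequence sat (central (ı ∷ ı ∷ o ∷ []) ≐ e) ((1 , 0 , 1 , false) ∷ (0 , 1 , 2 , false) ∷ [])
    ker-sound (o ∷ o ∷ ı ∷ []) _ = consequence sat (central (o ∷ o ∷ ı ∷ []) ≐ e) ((0 , 4 , 0 , false) ∷ [])
    ker-sound (o ∷ o ∷ o ∷ []) _ = free-identity (central (o ∷ o ∷ o ∷ []) ≐ e)

    ker-complete : ∀ n → ⟦ central n ⟧ ≡ ε → T (ker n)
    ker-complete (ı ∷ ı ∷ _ ∷ []) _ = tt
    ker-complete (o ∷ o ∷ _ ∷ []) _ = tt
    ker-complete (ı ∷ o ∷ ı ∷ []) p = contradiction (trans (consequence sat (X · X ≐ central (ı ∷ o ∷ ı ∷ [])) ((2 , 4 , 0 , true) ∷ [])) p) x²≢ε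
    ker-complete (ı ∷ o ∷ o ∷ []) p = contradiction (trans (free-identity (X · X ≐ central (ı ∷ o ∷ o ∷ []))) p) x²≢ε
    ker-complete (o ∷ ı ∷ ı ∷ []) p = contradiction (trans (consequence sat (X · X ≐ central (o ∷ ı ∷ ı ∷ [])) ((2 , 4 , 0 , true) ∷ (1 , 1 , 1 , true) ∷ (0 , 0 , 1 , false) ∷ [])) p) x²≢ε
    ker-complete (o ∷ ı ∷ o ∷ []) p = contradiction (trans (consequence sat (X · X ≐ central (o ∷ ı ∷ o ∷ [])) ((1 , 1 , 1 , true) ∷ (0 , 0 , 1 , false) ∷ [])) p) x²≢ε

    open Kernel G rank a gn κQ₈×C₂ (quadraticQ₈×C₂ sat) ker ker-sound ker-complete
    open Connection (X ∷ Y ∷ (X · Y) ∷ (X · Z) ∷ [])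
    open Separated tt

    fxz : Fixed ⟦ X · Z ⟧
    fxz = fixed (~ ◇[ out ] ◇[ out ] root) 3F
    fx : Fixed ⟦ X ⟧
    fx = fixed (~ ◇[ out ] ◇[ out ] at (X · Z) fxz & ~ at (X · Z) fxz) 0F
    fy : Fixed ⟦ Y ⟧
    fy = fixed (◇[ out ] at (X ⁻) (Fixed-⁻¹ fx)) 1F
    fz : Fixed ⟦ Z ⟧
    fz = subst Fixed (free-identity (X ⁻ · (X · Z) ≐ Z)) (Fixed-∙ (Fixed-⁻¹ fx) fxz)

  H×C₂-hasORR : Satisfies G a relH×C₂ → ⟦ X · X ⟧ ≢ ε → ⟦ Y · Y ⟧ ≢ ε → ⟦ X · X · (Y · Y) ⟧ ≢ ε → HasORR G
  H×C₂-hasORR sat x²≢ε y²≢ε x²y²≢ε = orr oriented gn λ { 0F → fx ; 1F → fy ; 2F → fz }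
    where
    ker : Bits → Bool
    ker (i ∷ j ∷ k ∷ []) = not i ∧ not j

    ker-sound : ∀ n → T (ker n) → ⟦ central n ⟧ ≡ ε
    ker-sound (o ∷ o ∷ ı ∷ []) _ = consequence sat (central (o ∷ o ∷ ı ∷ []) ≐ e) ((0 , 6 , 0 , false) ∷ [])
    ker-sound (o ∷ o ∷ o ∷ []) _ = free-identity (central (o ∷ o ∷ o ∷ []) ≐ e)

    ker-complete : ∀ n → ⟦ central n ⟧ ≡ ε → T (ker n)
    ker-complete (o ∷ o ∷ _ ∷ []) _ = tt
    ker-complete (ı ∷ ı ∷ ı ∷ []) p = contradiction (trans (consequence sat (X · X · (Y · Y) ≐ central (ı ∷ ı ∷ ı ∷ [])) ((4 , 6 , 0 , true) ∷ [])) p) x²y²≢ε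
    ker-complete (ı ∷ ı ∷ o ∷ []) p = contradiction (trans (free-identity (X · X · (Y · Y) ≐ central (ı ∷ ı ∷ o ∷ []))) p) x²y²≢ε
    ker-complete (ı ∷ o ∷ ı ∷ []) p = contradiction (trans (consequence sat (X · X ≐ central (ı ∷ o ∷ ı ∷ [])) ((2 , 6 , 0 , true) ∷ [])) p) x²≢ε
    ker-complete (ı ∷ o ∷ o ∷ []) p = contradiction (trans (free-identity (X · X ≐ central (ı ∷ o ∷ o ∷ []))) p) x²≢ε
    ker-complete (o ∷ ı ∷ ı ∷ []) p = contradiction (trans (consequence sat (Y · Y ≐ central (o ∷ ı ∷ ı ∷ [])) ((2 , 6 , 0 , true) ∷ [])) p) y²≢ε
    ker-complete (o ∷ ı ∷ o ∷ []) p = contradiction (trans (free-identity (Y · Y ≐ central (o ∷ ı ∷ o ∷ []))) p) y²≢ε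

    open Kernel G rank a gn κH×C₂ (quadraticH×C₂ sat) ker ker-sound ker-complete
    open Connection (Y ∷ X ∷ (X · Z · (X · X · (Y · Y))) ∷ (X ⁻ · Z) ∷ (Y · Z · (X · X)) ∷ (Y ⁻ · (X · X)) ∷ [])
    open Separated tt

    f₄ : Fixed ⟦ Y · Z · (X · X) ⟧
    f₄ = fixed (◇[ out ] ~ ◇[ into ] ~ ◇[ into ] ~ ◇[ into ] ◇[ out ] root) 4F
    fy : Fixed ⟦ Y ⟧
    fy = fixed (~ ◇[ out ] ◇[ out ] at (Y · Z · (X · X)) f₄ & ~ at (Y · Z · (X · X)) f₄) 0F
    f₅ : Fixed ⟦ Y ⁻ · (X · X) ⟧
    f₅ = fixed (◇[ out ] at (Y · Y) (Fixed-∙ fy fy) & ~ at Y fy & ~ at (Y · Z · (X · X)) f₄) 5F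
    fz : Fixed ⟦ Z ⟧
    -- The central factor `x²` enters twice, from `f₄` and from `y (y⁻¹ x²)`, and cancels.
    fz = Fixed-word (Y ⁻ · (Y · Z · (X · X)) · (Y · (Y ⁻ · (X · X)))) Z
           (Fixed-∙ (Fixed-∙ (Fixed-⁻¹ fy) f₄) (Fixed-∙ fy f₅))
    f₂ : Fixed ⟦ X · Z · (X · X · (Y · Y)) ⟧
    f₂ = fixed (~ ◇[ out ] at Z fz & ~ at Y fy & ~ at (Y · Z · (X · X)) f₄ & ~ at (Y ⁻ · (X · X)) f₅) 2F
    fx : Fixed ⟦ X ⟧
    fx = Fixed-word (X · Z · (X · X · (Y · Y)) · Z · (Y · Y) · (Y · (Y ⁻ · (X · X)))) X
           (Fixed-∙ (Fixed-∙ (Fixed-∙ f₂ fz) (Fixed-∙ fy fy)) (Fixed-∙ fy f₅))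

  -- No nonempty product of squares vanishes, so normal forms are unique and the order is exactly
  -- 64.
  order64-hasORR : Satisfies G a relOrder64 → (∀ n → ⟦ central n ⟧ ≡ ε → T (isZero n)) → HasORR G
  order64-hasORR sat ker-complete = orr oriented gn λ { 0F → fx ; 1F → fy ; 2F → fz }
    where
    ker-sound : ∀ n → T (isZero n) → ⟦ central n ⟧ ≡ ε
    ker-sound (o ∷ o ∷ o ∷ []) _ = free-identity (central (o ∷ o ∷ o ∷ []) ≐ e)

    open Kernel G rank a gn κOrder64 (quadraticOrder64 sat) isZero ker-sound ker-complete
    open Connection ((X ⁻ · (Y · Y)) ∷ (Y ⁻ · (X · X)) ∷ Z ∷ (X · Y · Z ⁻) ∷ (X · Y · Z) ∷ [])
    open Separated tt

    f₁ : Fixed ⟦ Y ⁻ · (X · X) ⟧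
    f₁ = fixed (~ ◇[ into ] ◇[ out ] ◇[ out ] root) 1F
    fz : Fixed ⟦ Z ⟧
    fz = fixed (◇[ out ] ◇[ into ] at (Y ⁻ · (X · X)) f₁ & ~ at (Y ⁻ · (X · X)) f₁) 2F
    f₀ : Fixed ⟦ X ⁻ · (Y · Y) ⟧
    f₀ = fixed (~ ◇[ into ] at (Z · Z) (Fixed-∙ fz fz) & ~ at (Y ⁻ · (X · X)) f₁ & ~ at Z fz) 0F
    fx : Fixed ⟦ X ⟧
    -- The squares of `x⁻¹y²` and `y⁻¹x²` are `x²` and `y²`; multiplying by both turns `x⁻¹y²` back
    -- into `x`.
    fx = Fixed-word ((X ⁻ · (Y · Y)) · (X ⁻ · (Y · Y)) · (Y ⁻ · (X · X) · (Y ⁻ · (X · X))) · (X ⁻ · (Y · Y))) X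
           (Fixed-∙ (Fixed-∙ (Fixed-∙ f₀ f₀) (Fixed-∙ f₁ f₁)) f₀)
    fy : Fixed ⟦ Y ⟧
    fy = Fixed-word ((X ⁻ · (Y · Y)) · (X ⁻ · (Y · Y)) · (Y ⁻ · (X · X) · (Y ⁻ · (X · X))) · (Y ⁻ · (X · X))) Y
           (Fixed-∙ (Fixed-∙ (Fixed-∙ f₀ f₀) (Fixed-∙ f₁ f₁)) f₁)

  -- The relation `x²y²z² = 1` leaves the products of squares `1`, `x²`, `y²` and `x²y²`. The three
  -- inequalities make them distinct, which is what completeness of the kernel amounts to.
  exceptionalG1 : Satisfies G a relG1 → ⟦ X · X ⟧ ≢ ε → ⟦ Y · Y ⟧ ≢ ε → ⟦ X · X · (Y · Y) ⟧ ≢ ε → Exceptional G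
  exceptionalG1 sat x²≢ε y²≢ε x²y²≢ε = inj₂ (inj₂ (inj₁ (Kernel.presentation G rank a gn κOrder64 (quadraticG1 sat) ker ker-sound ker-complete sat
    (λ H b satH → quadraticG1 satH , sound H b satH))))
    where
    ker : Bits → Bool
    ker (i ∷ j ∷ k ∷ []) = not (i xor j) ∧ not (j xor k)

    sound : ∀ H b → Satisfies H b relG1 → ∀ n → T (ker n) → eval H b (central n) ≡ FinGroup.ε H
    sound H b satH (ı ∷ ı ∷ ı ∷ []) _ = Eval.consequence H b satH (central (ı ∷ ı ∷ ı ∷ []) ≐ e) ((0 , 9 , 0 , false) ∷ [])
    sound H b satH (o ∷ o ∷ o ∷ []) _ = Eval.consequence H b satH (central (o ∷ o ∷ o ∷ []) ≐ e) []

    ker-sound = sound G a sat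

    ker-complete : ∀ n → ⟦ central n ⟧ ≡ ε → T (ker n)
    ker-complete (ı ∷ ı ∷ ı ∷ []) _ = tt
    ker-complete (ı ∷ ı ∷ o ∷ []) p = contradiction (trans (consequence sat (X · X · (Y · Y) ≐ central (ı ∷ ı ∷ o ∷ [])) []) p) x²y²≢ε
    ker-complete (ı ∷ o ∷ ı ∷ []) p = contradiction (trans (consequence sat (Y · Y ≐ central (ı ∷ o ∷ ı ∷ [])) ((2 , 2 , 0 , true) ∷ (0 , 9 , 2 , false) ∷ (0 , 0 , 0 , true) ∷ [])) p) y²≢ε
    ker-complete (ı ∷ o ∷ o ∷ []) p = contradiction (trans (consequence sat (X · X ≐ central (ı ∷ o ∷ o ∷ [])) []) p) x²≢ε
    ker-complete (o ∷ ı ∷ ı ∷ []) p = contradiction (trans (consequence sat (X · X ≐ central (o ∷ ı ∷ ı ∷ [])) ((2 , 9 , 0 , true) ∷ (0 , 0 , 0 , false) ∷ [])) p) x²≢ε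
    ker-complete (o ∷ ı ∷ o ∷ []) p = contradiction (trans (consequence sat (Y · Y ≐ central (o ∷ ı ∷ o ∷ [])) []) p) y²≢ε
    ker-complete (o ∷ o ∷ ı ∷ []) p = contradiction (trans (consequence sat (X · X · (Y · Y) ≐ central (o ∷ o ∷ ı ∷ [])) ((0 , 9 , 0 , false) ∷ (0 , 2 , 0 , true) ∷ [])) p) x²y²≢ε
    ker-complete (o ∷ o ∷ o ∷ []) _ = tt

  -- All squares coincide, so a product of squares depends only on the parity of the number of
  -- factors. The group is the central product of `Q₈ = ⟨x, z⟩` with the cyclic group of order 4
  -- generated by `y`.
  exceptionalG2 : Satisfies G a relG2 → ⟦ X · X ⟧ ≢ ε → Exceptional G
  exceptionalG2 sat x²≢ε = inj₂ (inj₂ (inj₂ (Kernel.presentation G rank a gn κG2 (quadraticG2 sat) ker ker-sound ker-complete sat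
    (λ H b satH → quadraticG2 satH , sound H b satH))))
    where
    ker : Bits → Bool
    ker (i ∷ j ∷ k ∷ []) = not (i xor (j xor k))

    sound : ∀ H b → Satisfies H b relG2 → ∀ n → T (ker n) → eval H b (central n) ≡ FinGroup.ε H
    sound H b satH (ı ∷ ı ∷ o ∷ []) _ = Eval.consequence H b satH (central (ı ∷ ı ∷ o ∷ []) ≐ e) ((2 , 9 , 0 , true) ∷ (0 , 0 , 0 , false) ∷ [])
    sound H b satH (ı ∷ o ∷ ı ∷ []) _ = Eval.consequence H b satH (central (ı ∷ o ∷ ı ∷ []) ≐ e) ((2 , 7 , 0 , true) ∷ (0 , 0 , 0 , false) ∷ [])
    sound H b satH (o ∷ ı ∷ ı ∷ []) _ = Eval.consequence H b satH (central (o ∷ ı ∷ ı ∷ []) ≐ e) ((0 , 9 , 0 , true) ∷ (2 , 7 , 0 , true) ∷ (0 , 0 , 0 , false) ∷ [])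
    sound H b satH (o ∷ o ∷ o ∷ []) _ = Eval.consequence H b satH (central (o ∷ o ∷ o ∷ []) ≐ e) []

    ker-sound = sound G a sat

    ker-complete : ∀ n → ⟦ central n ⟧ ≡ ε → T (ker n)
    ker-complete (ı ∷ ı ∷ ı ∷ []) p = contradiction (trans (consequence sat (X · X ≐ central (ı ∷ ı ∷ ı ∷ [])) ((0 , 7 , 0 , false) ∷ (0 , 1 , 0 , true) ∷ (0 , 9 , 0 , true) ∷ [])) p) x²≢ε
    ker-complete (ı ∷ ı ∷ o ∷ []) _ = tt
    ker-complete (ı ∷ o ∷ ı ∷ []) _ = tt
    ker-complete (ı ∷ o ∷ o ∷ []) p = contradiction (trans (consequence sat (X · X ≐ central (ı ∷ o ∷ o ∷ [])) []) p) x²≢ε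
    ker-complete (o ∷ ı ∷ ı ∷ []) _ = tt
    ker-complete (o ∷ ı ∷ o ∷ []) p = contradiction (trans (consequence sat (X · X ≐ central (o ∷ ı ∷ o ∷ [])) ((0 , 9 , 0 , false) ∷ [])) p) x²≢ε
    ker-complete (o ∷ o ∷ ı ∷ []) p = contradiction (trans (consequence sat (X · X ≐ central (o ∷ o ∷ ı ∷ [])) ((0 , 7 , 0 , false) ∷ [])) p) x²≢ε
    ker-complete (o ∷ o ∷ o ∷ []) _ = tt

  exceptionalC₄C₂C₂ : Satisfies G a relC4C2C2 → ⟦ X · X ⟧ ≢ ε → Exceptional G
  exceptionalC₄C₂C₂ sat x²≢ε = inj₁ (Kernel.presentation G rank a gn κ₀ (quadraticC₄C₂C₂ sat) ker ker-sound ker-complete sat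
    (λ H b satH → quadraticC₄C₂C₂ satH , sound H b satH))
    where
    ker : Bits → Bool
    ker (i ∷ j ∷ k ∷ []) = not i

    sound : ∀ H b → Satisfies H b relC4C2C2 → ∀ n → T (ker n) → eval H b (central n) ≡ FinGroup.ε H
    sound H b satH (o ∷ ı ∷ ı ∷ []) _ = Eval.consequence H b satH (central (o ∷ ı ∷ ı ∷ []) ≐ e) ((2 , 2 , 0 , false) ∷ (0 , 1 , 0 , false) ∷ [])
    sound H b satH (o ∷ ı ∷ o ∷ []) _ = Eval.consequence H b satH (central (o ∷ ı ∷ o ∷ []) ≐ e) ((0 , 1 , 0 , false) ∷ [])
    sound H b satH (o ∷ o ∷ ı ∷ []) _ = Eval.consequence H b satH (central (o ∷ o ∷ ı ∷ []) ≐ e) ((0 , 2 , 0 , false) ∷ [])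
    sound H b satH (o ∷ o ∷ o ∷ []) _ = Eval.consequence H b satH (central (o ∷ o ∷ o ∷ []) ≐ e) []

    ker-sound = sound G a sat

    ker-complete : ∀ n → ⟦ central n ⟧ ≡ ε → T (ker n)
    ker-complete (ı ∷ ı ∷ ı ∷ []) p = contradiction (trans (consequence sat (X · X ≐ central (ı ∷ ı ∷ ı ∷ [])) ((2 , 2 , 0 , true) ∷ (2 , 1 , 0 , true) ∷ [])) p) x²≢ε
    ker-complete (ı ∷ ı ∷ o ∷ []) p = contradiction (trans (consequence sat (X · X ≐ central (ı ∷ ı ∷ o ∷ [])) ((2 , 1 , 0 , true) ∷ [])) p) x²≢ε
    ker-complete (ı ∷ o ∷ ı ∷ []) p = contradiction (trans (consequence sat (X · X ≐ central (ı ∷ o ∷ ı ∷ [])) ((2 , 2 , 0 , true) ∷ [])) p) x²≢ε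
    ker-complete (ı ∷ o ∷ o ∷ []) p = contradiction (trans (consequence sat (X · X ≐ central (ı ∷ o ∷ o ∷ [])) []) p) x²≢ε
    ker-complete (o ∷ ı ∷ ı ∷ []) _ = tt
    ker-complete (o ∷ ı ∷ o ∷ []) _ = tt
    ker-complete (o ∷ o ∷ ı ∷ []) _ = tt
    ker-complete (o ∷ o ∷ o ∷ []) _ = tt

-- A paired couple with a central involution, of unbounded order

relPaired×C₂ : List (Relation 3)
relPaired×C₂ = X · Y · (X · Y) ≐ e ∷ X · Y ⁻ · (X · Y ⁻) ≐ e ∷ X · X · (X · X) ≐ e ∷ X · Z ≐ Z · X ∷ Y · Z ≐ Z · Y ∷ Z · Z ≐ e ∷ []

-- Nothing bounds the order of `y`, so no normal form is at hand; every coincidence in `S` has to be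
-- excluded by a separate word.
module PairedTimesC₂ (G : FinGroup) (rank : NotGeneratedByTwo G) (a : Fin 3 → Carrier G) (gn : Generates G a)
  (sat : Satisfies G a relPaired×C₂)
  (x²≢ε : eval G a (X · X) ≢ FinGroup.ε G) (y²≢ε : eval G a (Y · Y) ≢ FinGroup.ε G)
  (y⁴≢ε : eval G a (Y · Y · (Y · Y)) ≢ FinGroup.ε G) (x²y²≢ε : eval G a (X · X · (Y · Y)) ≢ FinGroup.ε G) where
  open GroupOf G
  open Eval G a
  open Independence G rank a gn
  open Generation G

  -- If y³ is a power of x², then y² has order 3 and z order 2, so y²z generates both.
  cubes : ⟦ Y ⟧ ≡ ⟦ (Y · Y · Z) ⁻ · (Y · Y · Z) ⁻ · (Y · Y · Z) ⁻ · (Y · Y · Z) ⁻ ⟧ ⊎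
          ⟦ Y ⟧ ≡ ⟦ X · X · ((Y · Y · Z) ⁻ · (Y · Y · Z) ⁻ · (Y · Y · Z) ⁻ · (Y · Y · Z) ⁻) ⟧ →
          ⟦ Z ⟧ ≡ ⟦ Y · Y · Z · (Y · Y · Z) · (Y · Y · Z) ⟧ → ⊥
  cubes y z = rank (b , λ g → ⟨⟩-map (λ { 0F → gen 0F ; 1F → y∈ y ; 2F → subst (⟨_⟩ G b) (sym z) (⟨⟩-eval b (Y · Y · Y)) }) (gn g))
    where
    b : Fin 2 → C
    b = lookup (⟦ X ⟧ ∷ ⟦ Y · Y · Z ⟧ ∷ [])
    y∈ : _ → ⟨_⟩ G b ⟦ Y ⟧
    y∈ (inj₁ p) = subst (⟨_⟩ G b) (sym p) (⟨⟩-eval b (Y ⁻ · Y ⁻ · Y ⁻ · Y ⁻))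
    y∈ (inj₂ p) = subst (⟨_⟩ G b) (sym p) (⟨⟩-eval b (X · X · (Y ⁻ · Y ⁻ · Y ⁻ · Y ⁻)))

  y³≢ε : ⟦ Y · Y · Y ⟧ ≢ ε
  -- For `w = y²z` one has `w³ = z` and `w⁻⁴ = y⁻⁸ = y`.
  y³≢ε p = cubes (inj₁ (consequence {R = Y · Y · Y ≐ e ∷ relPaired×C₂} (p ∷ sat) (Y ≐ (Y · Y · Z) ⁻ · (Y · Y · Z) ⁻ · (Y · Y · Z) ⁻ · (Y · Y · Z) ⁻)
                   ((0 , 0 , 0 , false) ∷ (7 , 0 , 0 , false) ∷ (5 , 5 , 0 , false) ∷ (5 , 6 , 0 , false) ∷ (1 , 0 , 0 , false) ∷ (1 , 5 , 1 , true) ∷ (0 , 6 , 0 , false) ∷ [])))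
                 (consequence {R = Y · Y · Y ≐ e ∷ relPaired×C₂} (p ∷ sat) (Z ≐ Y · Y · Z · (Y · Y · Z) · (Y · Y · Z)) ((0 , 0 , 0 , true) ∷ (0 , 5 , 3 , true) ∷ (3 , 0 , 0 , true) ∷ (1 , 5 , 2 , false) ∷ (0 , 6 , 0 , true) ∷ []))

  x²y³≢ε : ⟦ X · X · (Y · Y · Y) ⟧ ≢ ε
  -- Now `y³ = x²`, so `w = y²z` satisfies `w⁻⁴ = y⁻⁸ = x²y`, and still `w³ = z`.
  x²y³≢ε p = cubes (inj₂ (consequence {R = X · X · (Y · Y · Y) ≐ e ∷ relPaired×C₂} (p ∷ sat) (Y ≐ X · X · ((Y · Y · Z) ⁻ · (Y · Y · Z) ⁻ · (Y · Y · Z) ⁻ · (Y · Y · Z) ⁻))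
                   ((0 , 0 , 2 , false) ∷ (5 , 5 , 0 , true) ∷ (3 , 0 , 2 , false) ∷ (0 , 3 , 0 , true) ∷ (1 , 4 , 0 , false) ∷ (0 , 4 , 0 , false) ∷ (0 , 6 , 0 , false) ∷ (0 , 5 , 0 , false) ∷ (1 , 0 , 2 , false) ∷ (1 , 3 , 0 , true) ∷ (2 , 4 , 0 , false) ∷ (1 , 4 , 0 , false) ∷ (0 , 6 , 0 , false) ∷ [])))
                 (consequence {R = X · X · (Y · Y · Y) ≐ e ∷ relPaired×C₂} (p ∷ sat) (Z ≐ Y · Y · Z · (Y · Y · Z) · (Y · Y · Z)) ((2 , 5 , 2 , true) ∷ (0 , 0 , 0 , true) ∷ (2 , 6 , 0 , true) ∷ (2 , 5 , 1 , false) ∷ (2 , 0 , 0 , true) ∷ (0 , 3 , 0 , false) ∷ []))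

  -- Contraposition along a derivation: with `u = ε` as an extra relation, `v`, which is known to be
  -- nontrivial, would vanish.
  reject : ∀ u v ss → {_ : T (derives (relPaired×C₂ ++ u ≐ e ∷ []) (v ≐ e) ss)} → ⟦ v ⟧ ≢ ε → ⟦ u ⟧ ≢ ε
  reject u v ss {t} n p = n (consequence {R = relPaired×C₂ ++ u ≐ e ∷ []} (satisfies-++ {a = a} sat (p ∷ [])) (v ≐ e) ss {t})

  trivials : List (Word 3)
  trivials = X · X · Y · X · X · Y ⁻ ∷ Y · Z · Y ⁻ · Z ∷ Y · Z · Y ⁻ · Z ⁻ ∷ []

  trivial : All (λ u → ⟦ u ⟧ ≡ ε) trivials
  trivial = consequence sat (X · X · Y · X · X · Y ⁻ ≐ e) ((1 , 0 , 0 , false) ∷ (0 , 1 , 0 , false) ∷ []) ∷ consequence sat (Y · Z · Y ⁻ · Z ≐ e) ((0 , 4 , 0 , false) ∷ (0 , 5 , 0 , false) ∷ []) ∷ consequence sat (Y · Z · Y ⁻ · Z ⁻ ≐ e) ((0 , 4 , 0 , false) ∷ []) ∷ []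

  nontrivials : List (Word 3)
  nontrivials = X · X ∷ Y · Y ∷ X · X · (Y · Y) ∷ Y · Y · Y ∷ X · X · (Y · Y · Y) ∷ Y · Y · (Y · Y) ∷ X · X · Y ⁻ · Y ⁻ ∷ X · X · Z ⁻ · Y ⁻ · Z · Y ∷ Y · Y · Z ⁻ · Y ⁻ · Z ∷ Y · Y · Z · Z ∷ X · X · Z ⁻ · Y ⁻ · Y ⁻ · Z ⁻ ∷ Y · Y · Z · Y ⁻ · Z ∷ X · X · Y · X ⁻ · Y ∷ X · X · Y · X · Y ∷ X · X · Y · Y · X ⁻ · Y ∷ X · X · X ∷ X · X · Y ⁻ · Y ⁻ · Y ⁻ ∷ Y · Z · Y · Z ⁻ ∷ Y · Z · Y · Z ∷ X · X · Z ⁻ · Y ⁻ · Z ⁻ · Y ⁻ ∷ X · X · Z ⁻ · Y · Z · Y ∷ Y · Y · Z ⁻ · Y · Z ∷ Y · Y · Z · Y · Z ∷ X · X · Z ⁻ · Y ⁻ · Y ⁻ · Z ⁻ · Y ⁻ ∷ X · X · Y ⁻ · X ⁻ · Y ∷ X · X · Y ⁻ · X · Y ∷ X · X · Y ⁻ · Y ⁻ · X · Y ∷ X · X · Y ⁻ · Y ⁻ · X ⁻ · Y ∷ X · X · Y · X · X · Y ∷ Y · Y · Z · Y · Y · Z ∷ []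

  nontrivial : All (λ u → ⟦ u ⟧ ≢ ε) nontrivials
  nontrivial = x²≢ε ∷ y²≢ε ∷ x²y²≢ε ∷ y³≢ε ∷ x²y³≢ε ∷ y⁴≢ε
      ∷ reject (X · X · Y ⁻ · Y ⁻) (X · X · (Y · Y)) ((2 , 6 , 0 , true) ∷ (0 , 2 , 0 , false) ∷ []) x²y²≢ε
      ∷ reject (X · X · Z ⁻ · Y ⁻ · Z · Y) (X · X) ((0 , 6 , 0 , false) ∷ (0 , 4 , 2 , false) ∷ []) x²≢ε
      ∷ reject (Y · Y · Z ⁻ · Y ⁻ · Z) (Y) ((0 , 6 , 1 , false) ∷ (0 , 4 , 2 , false) ∷ []) (primitive-≢ (Y ≐ e))
      ∷ reject (Y · Y · Z · Z) (Y · Y) ((0 , 6 , 0 , false) ∷ (0 , 5 , 0 , true) ∷ []) y²≢ε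
      ∷ reject (X · X · Z ⁻ · Y ⁻ · Y ⁻ · Z ⁻) (X · X · (Y · Y)) ((2 , 6 , 5 , true) ∷ (2 , 3 , 3 , false) ∷ (0 , 2 , 0 , false) ∷ (0 , 3 , 2 , false) ∷ (0 , 5 , 0 , true) ∷ []) x²y²≢ε
      ∷ reject (Y · Y · Z · Y ⁻ · Z) (Y) ((0 , 6 , 1 , false) ∷ (0 , 4 , 2 , false) ∷ (0 , 5 , 0 , true) ∷ []) (primitive-≢ (Y ≐ e))
      ∷ reject (X · X · Y · X ⁻ · Y) (X ⁻) ((0 , 2 , 0 , true) ∷ (1 , 6 , 0 , false) ∷ (0 , 1 , 0 , false) ∷ []) (primitive-≢ (X ⁻ ≐ e))
      ∷ reject (X · X · Y · X · Y) (X) ((0 , 6 , 1 , false) ∷ (0 , 0 , 1 , true) ∷ []) (primitive-≢ (X ≐ e))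
      ∷ reject (X · X · Y · Y · X ⁻ · Y) (Y · X ⁻) ((0 , 0 , 1 , false) ∷ (1 , 6 , 3 , true) ∷ (0 , 1 , 1 , true) ∷ []) (primitive-≢ (Y · X ⁻ ≐ e))
      ∷ reject (X · X · X) (X ⁻) ((0 , 2 , 0 , true) ∷ (0 , 6 , 0 , false) ∷ []) (primitive-≢ (X ⁻ ≐ e))
      ∷ reject (X · X · Y ⁻ · Y ⁻ · Y ⁻) (X · X · (Y · Y · Y)) ((2 , 6 , 0 , true) ∷ (0 , 2 , 0 , false) ∷ []) x²y³≢ε
      ∷ reject (Y · Z · Y · Z ⁻) (Y · Y) ((1 , 4 , 0 , false) ∷ (0 , 6 , 0 , false) ∷ []) y²≢ε
      ∷ reject (Y · Z · Y · Z) (Y · Y) ((1 , 4 , 0 , false) ∷ (0 , 6 , 0 , false) ∷ (0 , 5 , 0 , true) ∷ []) y²≢ε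
      ∷ reject (X · X · Z ⁻ · Y ⁻ · Z ⁻ · Y ⁻) (X · X · (Y · Y)) ((0 , 2 , 0 , false) ∷ (0 , 6 , 2 , true) ∷ (1 , 4 , 2 , false) ∷ (0 , 5 , 0 , true) ∷ []) x²y²≢ε
      ∷ reject (X · X · Z ⁻ · Y · Z · Y) (X · X · (Y · Y)) ((1 , 0 , 0 , false) ∷ (0 , 1 , 0 , false) ∷ (1 , 2 , 0 , true) ∷ (0 , 6 , 5 , false) ∷ (0 , 4 , 2 , true) ∷ []) x²y²≢ε
      ∷ reject (Y · Y · Z ⁻ · Y · Z) (Y · Y · Y) ((1 , 6 , 0 , false) ∷ (0 , 4 , 3 , true) ∷ []) y³≢ε
      ∷ reject (Y · Y · Z · Y · Z) (Y · Y · Y) ((1 , 6 , 0 , false) ∷ (0 , 4 , 3 , true) ∷ (0 , 5 , 0 , true) ∷ []) y³≢ε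
      ∷ reject (X · X · Z ⁻ · Y ⁻ · Y ⁻ · Z ⁻ · Y ⁻) (X · X · (Y · Y · Y)) ((0 , 2 , 0 , false) ∷ (0 , 6 , 2 , true) ∷ (2 , 4 , 2 , false) ∷ (1 , 4 , 2 , false) ∷ (0 , 5 , 0 , true) ∷ []) x²y³≢ε
      ∷ reject (X · X · Y ⁻ · X ⁻ · Y) (Y ⁻ · Y ⁻ · X ⁻) ((1 , 1 , 1 , false) ∷ (0 , 6 , 2 , false) ∷ (0 , 2 , 0 , true) ∷ []) (primitive-≢ (Y ⁻ · Y ⁻ · X ⁻ ≐ e))
      ∷ reject (X · X · Y ⁻ · X · Y) (Y ⁻ · Y ⁻ · X) ((1 , 0 , 0 , true) ∷ (0 , 6 , 2 , false) ∷ []) (primitive-≢ (Y ⁻ · Y ⁻ · X ≐ e))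
      ∷ reject (X · X · Y ⁻ · Y ⁻ · X · Y) (Y ⁻ · Y ⁻ · Y ⁻ · X) ((0 , 6 , 2 , false) ∷ (1 , 0 , 1 , true) ∷ []) (primitive-≢ (Y ⁻ · Y ⁻ · Y ⁻ · X ≐ e))
      ∷ reject (X · X · Y ⁻ · Y ⁻ · X ⁻ · Y) (Y ⁻ · Y ⁻ · Y ⁻ · X ⁻) ((0 , 6 , 2 , false) ∷ (2 , 1 , 1 , false) ∷ (0 , 2 , 0 , true) ∷ []) (primitive-≢ (Y ⁻ · Y ⁻ · Y ⁻ · X ⁻ ≐ e))
      ∷ reject (X · X · Y · X · X · Y) (Y · Y) ((0 , 0 , 1 , false) ∷ (0 , 6 , 1 , true) ∷ (0 , 0 , 0 , false) ∷ []) y²≢ε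
      ∷ reject (Y · Y · Z · Y · Y · Z) (Y · Y · (Y · Y)) ((3 , 4 , 0 , false) ∷ (1 , 6 , 0 , false) ∷ (0 , 4 , 3 , true) ∷ (0 , 5 , 0 , true) ∷ []) y⁴≢ε ∷ []

  S : Vec (Word 3) 6
  S = Y ∷ (Y · Z) ∷ (Y · (X · X)) ∷ (Y · Y) ∷ (Y · Y · Z) ∷ X ∷ []

  open Symbolic G rank a gn trivials trivial nontrivials nontrivial S using (s-injective; module Decided)
  open Decided tt tt

  -- y and yz each point to y² and y²z, but yx² points to y² only.
  hasORR : HasORR G
  hasORR = orr oriented gn λ { 0F → fx ; 1F → fy ; 2F → fz }
    where
    single : Invariant
    single = ◇[ out ] everything & ~ branching (s-injective tt) out
    fx : Fixed ⟦ X ⟧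
    fx = fixed-by-local (~ ◇[ out ] everything & ~ ◇[ into ] everything) 5F
    f₂ : Fixed ⟦ Y · (X · X) ⟧
    f₂ = fixed-by-local single 2F
    f₃ : Fixed ⟦ Y · Y ⟧
    f₃ = fixed-by-local (◇[ into ] single) 3F
    f₄ : Fixed ⟦ Y · Y · Z ⟧
    f₄ = fixed-by-local (◇[ into ] everything & ~ ◇[ into ] single) 4F
    fy : Fixed ⟦ Y ⟧
    fy = Fixed-by (Y · (X · X) · (X · X) ⁻) (Fixed-∙ f₂ (Fixed-⁻¹ (Fixed-∙ fx fx))) (free-identity (Y · (X · X) · (X · X) ⁻ ≐ Y))
    fz : Fixed ⟦ Z ⟧
    fz = Fixed-by ((Y · Y) ⁻ · (Y · Y · Z)) (Fixed-∙ (Fixed-⁻¹ f₃) f₄) (free-identity ((Y · Y) ⁻ · (Y · Y · Z) ≐ Z))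

-- Types of pairs of non-involutions

Outcome : FinGroup → Set
Outcome G = GeneralizedDihedral G ⊎ HasORR G ⊎ Exceptional G

module Pairs (G : FinGroup) where
  open GroupOf G

  Commuting Quaternionic Paired : C → C → Set
  Commuting g h = g ∙ h ≡ h ∙ g
  Quaternionic g h = g ∙ h ≢ h ∙ g × h ⁻¹ ∙ g ∙ h ∙ g ≡ ε × g ⁻¹ ∙ h ∙ g ∙ h ≡ ε
  Paired g h = g ∙ h ≢ h ∙ g × g ∙ h ∙ (g ∙ h) ≡ ε × g ∙ h ⁻¹ ∙ (g ∙ h ⁻¹) ≡ ε

  data Edge (g h : C) : Set where
    commuting    : Commuting g h → Edge g h
    quaternionic : Quaternionic g h → Edge g h
    paired       : Paired g h → Edge g h

  swapC : ∀ {g h} → Commuting g h → Commuting h g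
  swapC = sym

  swapQ : ∀ {g h} → Quaternionic g h → Quaternionic h g
  swapQ (n , p , q) = (λ eq → n (sym eq)) , q , p

  swapP : ∀ {g h} → Paired g h → Paired h g
  swapP {g} {h} (n , p , q) = (λ eq → n (sym eq)) , (consequence {R = X · Y · (X · Y) ≐ e ∷ X · Y ⁻ · (X · Y ⁻) ≐ e ∷ []} (p ∷ q ∷ []) (Y · X · (Y · X) ≐ e) ((0 , 0 , 1 , false) ∷ [])) , (consequence {R = X · Y · (X · Y) ≐ e ∷ X · Y ⁻ · (X · Y ⁻) ≐ e ∷ []} (p ∷ q ∷ []) (Y · X ⁻ · (Y · X ⁻) ≐ e) ((0 , 1 , 0 , true) ∷ []))
    where open Eval G (lookup (g ∷ h ∷ [])) using (consequence)

-- Configurations of three pairs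

module Cases (G : FinGroup) (rank : NotGeneratedByTwo G) where
  open GroupOf G
  open Generation G
  open Pairs G

  relC relQ relP : Word 3 → Word 3 → List (Relation 3)
  relC u v = u · v ≐ v · u ∷ []
  relQ u v = v ⁻ · u · v · u ≐ e ∷ u ⁻ · v · u · v ≐ e ∷ []
  relP u v = u · v · (u · v) ≐ e ∷ u · v ⁻ · (u · v ⁻) ≐ e ∷ []

  NonInvolutions : (Fin 3 → C) → Set
  NonInvolutions a = ∀ i → a i ∙ a i ≢ ε

  triple : (Fin 3 → C) → Word 3 → Word 3 → Word 3 → Fin 3 → C
  triple a u v w i = eval G a (lookup (u ∷ v ∷ w ∷ []) i)

  noninvolutions : ∀ {a : Fin 3 → C} → a 0F ∙ a 0F ≢ ε → a 1F ∙ a 1F ≢ ε → a 2F ∙ a 2F ≢ ε → NonInvolutions a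
  noninvolutions p q r 0F = p
  noninvolutions p q r 1F = q
  noninvolutions p q r 2F = r

  -- The connection set for a non-commuting pair is tried with `x, y` and with `x, y⁻¹`. Both fail
  -- only if the pair is quaternionic, a condition that survives inverting `y`, or if `(yx)²` and
  -- `(y⁻¹x)²` both vanish, which is pairedness.
  edge : ∀ a → Generates G a → NonInvolutions a → HasORR G ⊎ Edge (a 0F) (a 1F)
  edge a gn ni = go (⟦ X · Y ⟧ ≟ ⟦ Y · X ⟧)
    where
    open Eval G a
    module _ (n : ⟦ X · Y ⟧ ≢ ⟦ Y · X ⟧) where
      noncommuting : ⟦ X · Y · X ⁻ · Y ⁻ ⟧ ≢ ε
      noncommuting p = n (consequence {R = X · Y · X ⁻ · Y ⁻ ≐ e ∷ []} (p ∷ []) (X · Y ≐ Y · X) ((0 , 0 , 0 , false) ∷ []))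

      noncommuting′ : ⟦ X · Y ⁻ · X ⁻ · (Y ⁻) ⁻ ⟧ ≢ ε
      noncommuting′ p = n (consequence {R = X · Y ⁻ · X ⁻ · (Y ⁻) ⁻ ≐ e ∷ []} (p ∷ []) (X · Y ≐ Y · X) ((0 , 0 , 3 , true) ∷ []))

      y⁻²≢ε : ⟦ Y ⁻ · Y ⁻ ⟧ ≢ ε
      y⁻²≢ε p = ni 1F (consequence {R = Y ⁻ · Y ⁻ ≐ e ∷ []} (p ∷ []) (Y · Y ≐ e) ((0 , 0 , 0 , true) ∷ []))

      squares : Dec (⟦ Y · X · (Y · X) ⟧ ≡ ε) → Dec (⟦ Y ⁻ · X · (Y ⁻ · X) ⟧ ≡ ε) →
                ¬ (⟦ Y ⁻ · X · Y · X ⟧ ≡ ε × ⟦ X ⁻ · Y · X · Y ⟧ ≡ ε) → HasORR G ⊎ Edge (a 0F) (a 1F)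
      squares (no yx²) _ notQ = inj₁ (NonCommutingPair.hasORR G rank a gn (ni 0F) (ni 1F) (ni 2F) yx² noncommuting notQ)
      squares (yes p) (no y⁻x²) notQ = inj₁ (NonCommutingPair.hasORR G rank (triple a X (Y ⁻) Z)
        (change-generators gn (lookup (X ∷ Y ⁻ ∷ Z ∷ [])) (lookup (X ∷ Y ⁻ ∷ Z ∷ [])))
        (ni 0F) y⁻²≢ε (ni 2F) y⁻x² noncommuting′
        λ (p , q) → notQ ((consequence {R = (Y ⁻) ⁻ · X · Y ⁻ · X ≐ e ∷ X ⁻ · Y ⁻ · X · Y ⁻ ≐ e ∷ []} (p ∷ q ∷ []) (Y ⁻ · X · Y · X ≐ e) ((0 , 0 , 2 , false) ∷ [])) , (consequence {R = (Y ⁻) ⁻ · X · Y ⁻ · X ≐ e ∷ X ⁻ · Y ⁻ · X · Y ⁻ ≐ e ∷ []} (p ∷ q ∷ []) (X ⁻ · Y · X · Y ≐ e) ((0 , 1 , 3 , true) ∷ []))))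
      squares (yes p) (yes q) notQ = inj₂ (paired (n , (consequence {R = Y · X · (Y · X) ≐ e ∷ Y ⁻ · X · (Y ⁻ · X) ≐ e ∷ []} (p ∷ q ∷ []) (X · Y · (X · Y) ≐ e) ((0 , 0 , 1 , false) ∷ [])) , (consequence {R = Y · X · (Y · X) ≐ e ∷ Y ⁻ · X · (Y ⁻ · X) ≐ e ∷ []} (p ∷ q ∷ []) (X · Y ⁻ · (X · Y ⁻) ≐ e) ((0 , 1 , 1 , false) ∷ []))))

      noncommutingEdge : Dec (⟦ Y ⁻ · X · Y · X ⟧ ≡ ε) → Dec (⟦ X ⁻ · Y · X · Y ⟧ ≡ ε) → HasORR G ⊎ Edge (a 0F) (a 1F)
      noncommutingEdge (yes p) (yes q) = inj₂ (quaternionic (n , p , q))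
      noncommutingEdge (no p)  _       = squares (_ ≟ _) (_ ≟ _) λ (q , _) → p q
      noncommutingEdge (yes _) (no q)  = squares (_ ≟ _) (_ ≟ _) λ (_ , p) → q p

    go : Dec (⟦ X · Y ⟧ ≡ ⟦ Y · X ⟧) → HasORR G ⊎ Edge (a 0F) (a 1F)
    go (yes p) = inj₂ (commuting p)
    go (no n)  = noncommutingEdge n (_ ≟ _) (_ ≟ _)

  module Triple (a : Fin 3 → C) (gn : Generates G a) (ni : NonInvolutions a) where
    open Eval G a

    -- If `(zx)² = ε`, all three squares agree and `z` is the central generator of order 4 in the
    -- second exceptional presentation. Otherwise the pair `zx, y` is examined: commuting would make
    -- `x` and `y` commute, quaternionic would give `z² = ε`, and paired would give `(zx)² = ε`.
    caseQCC : Quaternionic ⟦ X ⟧ ⟦ Y ⟧ → Commuting ⟦ X ⟧ ⟦ Z ⟧ → Commuting ⟦ Y ⟧ ⟦ Z ⟧ → HasORR G ⊎ Exceptional G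
    caseQCC (n , q₁ , q₂) xz yz with ⟦ Z · X · (Z · X) ⟧ ≟ ε
    ... | yes p = inj₂ (exceptionalG2 G rank (triple a X Z Y) (change-generators gn (lookup (X ∷ Z ∷ Y ∷ [])) (lookup (X ∷ Z ∷ Y ∷ [])))
        (Eval.consequences G (triple a X Z Y) {R = Z ⁻ · X · Z · X ≐ e ∷ X ⁻ · Z · X · Z ≐ e ∷ X · Y ≐ Y · X ∷ Z · Y ≐ Y · Z ∷ Y · X · (Y · X) ≐ e ∷ []}
          (q₁ ∷ q₂ ∷ xz ∷ yz ∷ p ∷ []) relG2 (((3 , 1 , 1 , true) ∷ (2 , 0 , 1 , false) ∷ (1 , 0 , 1 , false) ∷ (0 , 1 , 2 , false) ∷ []) ∷ ((1 , 2 , 0 , true) ∷ (0 , 4 , 0 , false) ∷ (0 , 0 , 2 , true) ∷ (1 , 1 , 1 , true) ∷ (0 , 0 , 1 , true) ∷ (1 , 1 , 1 , false) ∷ (1 , 2 , 0 , false) ∷ (0 , 4 , 1 , false) ∷ []) ∷ ((0 , 0 , 1 , true) ∷ (1 , 1 , 1 , false) ∷ (1 , 0 , 1 , false) ∷ (0 , 1 , 2 , false) ∷ []) ∷ ((0 , 4 , 0 , false) ∷ []) ∷ ((1 , 0 , 2 , true) ∷ (3 , 3 , 1 , true) ∷ (4 , 0 , 3 , true) ∷ (2 , 4 , 1 , false) ∷ (0 , 3 , 0 , true) ∷ []) ∷ ((1 , 0 , 1 , true) ∷ (2 , 1 , 1 , false) ∷ (3 , 3 , 1 , true) ∷ (0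 , 2 , 0 , true) ∷ (0 , 4 , 1 , false) ∷ []) ∷ ((1 , 1 , 2 , true) ∷ (2 , 0 , 1 , true) ∷ (3 , 3 , 0 , false) ∷ (0 , 2 , 0 , true) ∷ (0 , 4 , 1 , false) ∷ []) ∷ ((1 , 1 , 1 , true) ∷ (0 , 0 , 1 , false) ∷ []) ∷ ((0 , 0 , 0 , false) ∷ []) ∷ ((2 , 4 , 1 , true) ∷ (3 , 2 , 0 , true) ∷ (3 , 1 , 1 , true) ∷ (2 , 0 , 1 , false) ∷ (1 , 0 , 1 , false) ∷ (0 , 1 , 2 , false) ∷ []) ∷ [])) (ni 0F))
    ... | no n² with edge (triple a (Z · X) Y Z) (change-generators gn (lookup (Z · X ∷ Y ∷ Z ∷ [])) (lookup (Z ⁻ · X ∷ Y ∷ Z ∷ []))) (noninvolutions n² (ni 1F) (ni 2F))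
    ...   | inj₁ orr = inj₁ orr
    ...   | inj₂ (commuting p) = contradiction (consequence {R = relC X Z ++ relC Y Z ++ relC (Z · X) Y} (xz ∷ yz ∷ p ∷ []) (X · Y ≐ Y · X) ((0 , 2 , 1 , false) ∷ (0 , 1 , 3 , false) ∷ [])) n
    ...   | inj₂ (quaternionic (_ , p , q)) = contradiction (consequence {R = relQ X Y ++ relC X Z ++ relC Y Z ++ relQ (Z · X) Y} (q₁ ∷ q₂ ∷ xz ∷ yz ∷ p ∷ q ∷ []) (Z · Z ≐ e) ((0 , 4 , 1 , false) ∷ (0 , 0 , 1 , true) ∷ (1 , 3 , 3 , true) ∷ (0 , 2 , 3 , true) ∷ [])) (ni 2F)
    ...   | inj₂ (paired (_ , p , q)) = contradiction (consequence {R = relQ X Y ++ relC X Z ++ relC Y Z ++ relP (Z · X) Y} (q₁ ∷ q₂ ∷ xz ∷ yz ∷ p ∷ q ∷ []) (Z · X · (Z · X) ≐ e) ((0 , 5 , 0 , false) ∷ (2 , 3 , 3 , false) ∷ (0 , 1 , 3 , false) ∷ [])) n²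

    -- Mutual inversion gives `x² = z² = y²`, so the commuting product `xy` is an involution. It is
    -- central because `z` inverts both factors, while `x` and `z` remain quaternionic.
    caseQQC : Quaternionic ⟦ X ⟧ ⟦ Z ⟧ → Quaternionic ⟦ Y ⟧ ⟦ Z ⟧ → Commuting ⟦ X ⟧ ⟦ Y ⟧ → HasORR G
    caseQQC (_ , p₁ , p₂) (_ , q₁ , q₂) xy = Q₈×C₂-hasORR G rank (triple a X Z (X · Y)) (change-generators gn (lookup (X ∷ Z ∷ X · Y ∷ [])) (lookup (X ∷ X ⁻ · Z ∷ Y ∷ [])))
      (p₁ ∷ p₂ ∷ (consequence {R = relQ X Z ++ relQ Y Z ++ relC X Y} (p₁ ∷ p₂ ∷ q₁ ∷ q₂ ∷ xy ∷ []) (X · (X · Y) ≐ (X · Y) · X) ((1 , 4 , 0 , false) ∷ []))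
               ∷ (consequence {R = relQ X Z ++ relQ Y Z ++ relC X Y} (p₁ ∷ p₂ ∷ q₁ ∷ q₂ ∷ xy ∷ []) (Z · (X · Y) ≐ (X · Y) · Z) ((2 , 3 , 1 , true) ∷ (0 , 1 , 1 , false) ∷ []))
               ∷ (consequence {R = relQ X Z ++ relQ Y Z ++ relC X Y} (p₁ ∷ p₂ ∷ q₁ ∷ q₂ ∷ xy ∷ []) ((X · Y) · (X · Y) ≐ e) ((1 , 4 , 0 , true) ∷ (3 , 3 , 1 , true) ∷ (2 , 2 , 1 , false) ∷ (1 , 0 , 1 , false) ∷ (0 , 1 , 2 , false) ∷ [])) ∷ []) (ni 0F)

    -- Conjugation by `x` or by `y` inverts two of the three factors of `xyz`. The squares are equal
    -- and central with trivial fourth powers, so the product is unchanged: `xyz` is a central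
    -- involution.
    caseQQQ : Quaternionic ⟦ X ⟧ ⟦ Y ⟧ → Quaternionic ⟦ Y ⟧ ⟦ Z ⟧ → Quaternionic ⟦ X ⟧ ⟦ Z ⟧ → HasORR G
    caseQQQ (_ , p₁ , p₂) (_ , q₁ , q₂) (_ , r₁ , r₂) = Q₈×C₂-hasORR G rank (triple a X Y (X · Y · Z)) (change-generators gn (lookup (X ∷ Y ∷ X · Y · Z ∷ [])) (lookup (X ∷ Y ∷ Y ⁻ · X ⁻ · Z ∷ [])))
      (p₁ ∷ p₂ ∷ (consequence {R = relQ X Y ++ relQ Y Z ++ relQ X Z} (p₁ ∷ p₂ ∷ q₁ ∷ q₂ ∷ r₁ ∷ r₂ ∷ []) (X · (X · Y · Z) ≐ (X · Y · Z) · X) ((3 , 4 , 1 , true) ∷ (1 , 0 , 1 , false) ∷ []))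
               ∷ (consequence {R = relQ X Y ++ relQ Y Z ++ relQ X Z} (p₁ ∷ p₂ ∷ q₁ ∷ q₂ ∷ r₁ ∷ r₂ ∷ []) (Y · (X · Y · Z) ≐ (X · Y · Z) · Y) ((3 , 2 , 1 , true) ∷ (0 , 1 , 1 , false) ∷ []))
               ∷ (consequence {R = relQ X Y ++ relQ Y Z ++ relQ X Z} (p₁ ∷ p₂ ∷ q₁ ∷ q₂ ∷ r₁ ∷ r₂ ∷ []) ((X · Y · Z) · (X · Y · Z) ≐ e) ((2 , 5 , 1 , false) ∷ (3 , 2 , 0 , false) ∷ (0 , 0 , 1 , false) ∷ [])) ∷ []) (ni 0F)

    -- Another use of the pair `zx, y`: a quaternionic edge would force `x² = ε`, a paired one
    -- `z² = ε`.
    product-involution : Paired ⟦ X ⟧ ⟦ Y ⟧ → Commuting ⟦ X ⟧ ⟦ Z ⟧ → Commuting ⟦ Y ⟧ ⟦ Z ⟧ → HasORR G ⊎ ⟦ Z · X · (Z · X) ⟧ ≡ ε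
    product-involution (n , p₁ , p₂) xz yz with ⟦ Z · X · (Z · X) ⟧ ≟ ε
    ... | yes p = inj₂ p
    ... | no n² with edge (triple a (Z · X) Y Z) (change-generators gn (lookup (Z · X ∷ Y ∷ Z ∷ [])) (lookup (Z ⁻ · X ∷ Y ∷ Z ∷ []))) (noninvolutions n² (ni 1F) (ni 2F))
    ...   | inj₁ orr = inj₁ orr
    ...   | inj₂ (commuting p) = contradiction (consequence {R = relC X Z ++ relC Y Z ++ relC (Z · X) Y} (xz ∷ yz ∷ p ∷ []) (X · Y ≐ Y · X) ((0 , 2 , 1 , false) ∷ (0 , 1 , 3 , false) ∷ [])) n
    ...   | inj₂ (quaternionic (_ , p , q)) = contradiction (consequence {R = relP X Y ++ relC X Z ++ relC Y Z ++ relQ (Z · X) Y} (p₁ ∷ p₂ ∷ xz ∷ yz ∷ p ∷ q ∷ []) (X · X ≐ e) ((1 , 0 , 0 , false) ∷ (0 , 5 , 1 , true) ∷ (0 , 3 , 3 , false) ∷ [])) (ni 0F)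
    ...   | inj₂ (paired (_ , p , q)) = contradiction (consequence {R = relP X Y ++ relC X Z ++ relC Y Z ++ relP (Z · X) Y} (p₁ ∷ p₂ ∷ xz ∷ yz ∷ p ∷ q ∷ []) (Z · Z ≐ e) ((0 , 4 , 0 , false) ∷ (0 , 0 , 0 , true) ∷ (1 , 3 , 3 , true) ∷ (0 , 2 , 3 , true) ∷ [])) (ni 2F)

    -- In S, z lies on the directed triangle z → yz → y → z, and x points only to xz.
    casePCQ : Paired ⟦ X ⟧ ⟦ Y ⟧ → Commuting ⟦ X ⟧ ⟦ Z ⟧ → Quaternionic ⟦ Y ⟧ ⟦ Z ⟧ → HasORR G
    casePCQ (n , p₁ , p₂) xz (_ , q₁ , q₂) = orr oriented gn λ { 0F → fx ; 1F → fy ; 2F → fz }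
      where
      from : ∀ u v ss → {_ : T (derives (X · Y · (X · Y) ≐ e ∷ X · Y ⁻ · (X · Y ⁻) ≐ e ∷ X · Z ≐ Z · X ∷ Z ⁻ · Y · Z · Y ≐ e ∷ Y ⁻ · Z · Y · Z ≐ e ∷ u ≐ e ∷ []) v ss)} →
             ⟦ u ⟧ ≡ ε → ⟦ proj₁ v ⟧ ≡ ⟦ proj₂ v ⟧
      from u v ss {t} p = consequence (p₁ ∷ p₂ ∷ xz ∷ q₁ ∷ q₂ ∷ p ∷ []) v ss {t}
      trivials nontrivials : List (Word 3)
      trivials = Y · Z · Y · Z ⁻ ∷ X · Z · X ⁻ · Z ⁻ ∷ Y · Z · Y ⁻ · Z ∷ []
      nontrivials = X · X ∷ Y · Y ∷ Z · Z ∷ X · Z · X ⁻ · Z ∷ Y · Z · Y ⁻ · Z ⁻ ∷ X · Z · X · Z ⁻ ∷ X · Z · X · Z ∷ Y · Z · Y · Z ∷ []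
      trivial : All (λ u → ⟦ u ⟧ ≡ ε) trivials
      trivial = (consequence {R = relP X Y ++ relC X Z ++ relQ Y Z} (p₁ ∷ p₂ ∷ xz ∷ q₁ ∷ q₂ ∷ []) (Y · Z · Y · Z ⁻ ≐ e) ((0 , 3 , 1 , false) ∷ []))
          ∷ (consequence {R = relP X Y ++ relC X Z ++ relQ Y Z} (p₁ ∷ p₂ ∷ xz ∷ q₁ ∷ q₂ ∷ []) (X · Z · X ⁻ · Z ⁻ ≐ e) ((0 , 2 , 0 , false) ∷ []))
          ∷ (consequence {R = relP X Y ++ relC X Z ++ relQ Y Z} (p₁ ∷ p₂ ∷ xz ∷ q₁ ∷ q₂ ∷ []) (Y · Z · Y ⁻ · Z ≐ e) ((0 , 4 , 2 , false) ∷ [])) ∷ []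
      nontrivial : All (λ u → ⟦ u ⟧ ≢ ε) nontrivials
      nontrivial = ni 0F ∷ ni 1F ∷ ni 2F
          ∷ (λ p → ni 2F (from (X · Z · X ⁻ · Z) (Z · Z ≐ e) ((0 , 2 , 0 , true) ∷ (0 , 5 , 0 , false) ∷ []) p))
          ∷ (λ p → ni 2F (from (Y · Z · Y ⁻ · Z ⁻) (Z · Z ≐ e) ((0 , 5 , 0 , true) ∷ (0 , 4 , 2 , false) ∷ []) p))
          ∷ (λ p → ni 0F (from (X · Z · X · Z ⁻) (X · X ≐ e) ((1 , 2 , 0 , false) ∷ (0 , 5 , 0 , false) ∷ []) p))
          ∷ (λ p → n (from (X · Z · X · Z) (X · Y ≐ Y · X) ((1 , 1 , 0 , true) ∷ (2 , 3 , 2 , true) ∷ (3 , 4 , 1 , true) ∷ (1 , 2 , 0 , false) ∷ (0 , 5 , 0 , false) ∷ []) p))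
          ∷ (λ p → ni 2F (from (Y · Z · Y · Z) (Z · Z ≐ e) ((0 , 3 , 1 , true) ∷ (0 , 5 , 0 , false) ∷ []) p))
          ∷ []
      S : Vec (Word 3) 5
      S = X ∷ Z ∷ (X · Z) ∷ Y ∷ (Y · Z) ∷ []
      open Symbolic G rank a gn trivials trivial nontrivials nontrivial S using (module Decided)
      open Decided tt tt
      sink : Invariant
      sink = ◇[ into ] everything & ~ ◇[ out ] everything
      fx : Fixed ⟦ X ⟧
      fx = fixed-by-local (~ ◇[ into ] everything) 0F
      fz : Fixed ⟦ Z ⟧
      fz = fixed-by-local (◇[ into ] everything & ◇[ out ] sink) 1F
      fy : Fixed ⟦ Y ⟧
      fy = fixed-by-local (◇[ out ] (◇[ into ] everything & ◇[ out ] sink)) 3F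

    -- The quaternionic edges give `x² = z² = y²`, and a paired couple with equal squares commutes:
    -- `xy = (xy⁻¹) y² = (yx⁻¹) x² = yx`.
    casePQQ : Paired ⟦ X ⟧ ⟦ Y ⟧ → Quaternionic ⟦ X ⟧ ⟦ Z ⟧ → Quaternionic ⟦ Y ⟧ ⟦ Z ⟧ → ⊥
    casePQQ (n , p₁ , p₂) (_ , q₁ , q₂) (_ , r₁ , r₂) =
      n (consequence {R = relP X Y ++ relQ X Z ++ relQ Y Z} (p₁ ∷ p₂ ∷ q₁ ∷ q₂ ∷ r₁ ∷ r₂ ∷ []) (X · Y ≐ Y · X) ((1 , 1 , 0 , true) ∷ (2 , 4 , 2 , true) ∷ (3 , 5 , 1 , true) ∷ (1 , 2 , 1 , false) ∷ (0 , 3 , 2 , false) ∷ []))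

    -- The product `xyz` is compared with `z`. If it is an involution, or forms a quaternionic or
    -- paired edge with `z`, then `z⁴ = ε`; if it commutes with `z`, then `x` and `y` commute.
    fourth-power : Paired ⟦ X ⟧ ⟦ Y ⟧ → Paired ⟦ Y ⟧ ⟦ Z ⟧ → Paired ⟦ X ⟧ ⟦ Z ⟧ → HasORR G ⊎ ⟦ Z · (Z · (Z · (Z · e))) ⟧ ≡ ε
    fourth-power (n , p₁ , p₂) (_ , q₁ , q₂) (_ , r₁ , r₂) with ⟦ X · Y · Z · (X · Y · Z) ⟧ ≟ ε
    ... | yes p = inj₂ (consequence {R = relP X Y ++ relP Y Z ++ relP X Z ++ (X · Y · Z · (X · Y · Z) ≐ e ∷ [])} (p₁ ∷ p₂ ∷ q₁ ∷ q₂ ∷ r₁ ∷ r₂ ∷ p ∷ []) (Z · (Z · (Z · (Z · (e)))) ≐ e) ((2 , 5 , 0 , true) ∷ (3 , 2 , 0 , true) ∷ (1 , 6 , 2 , false) ∷ (1 , 0 , 0 , true) ∷ (0 , 6 , 2 , false) ∷ (0 , 0 , 0 , true) ∷ (1 , 3 , 0 , false) ∷ (0 , 4 , 0 , false) ∷ []))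
    ... | no n² with edge (triple a Z (X · Y · Z) X) (change-generators gn (lookup (Z ∷ X · Y · Z ∷ X ∷ [])) (lookup (Z ∷ Z ⁻ · Y · X ⁻ ∷ X ∷ []))) (noninvolutions (ni 2F) n² (ni 0F))
    ...   | inj₁ orr = inj₁ orr
    ...   | inj₂ (commuting p) = contradiction (consequence {R = relP X Y ++ relP Y Z ++ relP X Z ++ relC Z (X · Y · Z)} (p₁ ∷ p₂ ∷ q₁ ∷ q₂ ∷ r₁ ∷ r₂ ∷ p ∷ []) (X · Y ≐ Y · X) ((2 , 4 , 1 , true) ∷ (4 , 3 , 0 , true) ∷ (2 , 6 , 0 , false) ∷ (0 , 0 , 0 , false) ∷ [])) n
    ...   | inj₂ (quaternionic (_ , p , q)) = inj₂ (consequence {R = relP X Y ++ relP Y Z ++ relP X Z ++ relQ Z (X · Y · Z)} (p₁ ∷ p₂ ∷ q₁ ∷ q₂ ∷ r₁ ∷ r₂ ∷ p ∷ q ∷ []) (Z · (Z · (Z · (Z · (e)))) ≐ e) ((2 , 7 , 3 , false) ∷ (2 , 0 , 0 , true) ∷ (0 , 7 , 3 , false) ∷ (0 , 0 , 0 , true) ∷ []))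
    ...   | inj₂ (paired (_ , p , q)) = inj₂ (consequence {R = relP X Y ++ relP Y Z ++ relP X Z ++ relP Z (X · Y · Z)} (p₁ ∷ p₂ ∷ q₁ ∷ q₂ ∷ r₁ ∷ r₂ ∷ p ∷ q ∷ []) (Z · (Z · (Z · (Z · (e)))) ≐ e) ((0 , 3 , 0 , true) ∷ (1 , 4 , 0 , true) ∷ (2 , 6 , 0 , false) ∷ (2 , 2 , 0 , true) ∷ (3 , 5 , 0 , true) ∷ (0 , 0 , 1 , false) ∷ []))

  open Triple using (caseQCC; caseQQC; caseQQQ; casePCQ; casePQQ; product-involution; fourth-power)

  module Paired₁ (a : Fin 3 → C) (gn : Generates G a) (ni : NonInvolutions a) where
    open Eval G a

    -- Failing an ORR, both `(zx)²` and `(zy)²` vanish by symmetry. Then `x² = z⁻² = y²`, and a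
    -- paired couple with equal squares commutes.
    casePCC : Paired ⟦ X ⟧ ⟦ Y ⟧ → Commuting ⟦ X ⟧ ⟦ Z ⟧ → Commuting ⟦ Y ⟧ ⟦ Z ⟧ → HasORR G
    casePCC xy@(n , p₁ , p₂) xz yz with product-involution a gn ni xy xz yz
    ... | inj₁ orr = orr
    ... | inj₂ p with product-involution (triple a Y X Z) (change-generators gn (lookup (Y ∷ X ∷ Z ∷ [])) (lookup (Y ∷ X ∷ Z ∷ []))) (noninvolutions (ni 1F) (ni 0F) (ni 2F)) (swapP xy) yz xz
    ...   | inj₁ orr = orr
    ...   | inj₂ q = contradiction (consequence {R = relP X Y ++ relC X Z ++ relC Y Z ++ (Z · X · (Z · X) ≐ e ∷ Z · Y · (Z · Y) ≐ e ∷ [])} (p₁ ∷ p₂ ∷ xz ∷ yz ∷ p ∷ q ∷ []) (X · Y ≐ Y · X) ((1 , 1 , 0 , true) ∷ (2 , 5 , 0 , true) ∷ (3 , 3 , 0 , false) ∷ (1 , 2 , 0 , false) ∷ (0 , 4 , 1 , false) ∷ [])) n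

    -- The element `xz` is again quaternionic with `x`. If it commutes with `y`, the configuration
    -- is that of `casePCQ`; any other edge with `y` makes `x` and `y` commute.
    casePPQ : Paired ⟦ X ⟧ ⟦ Y ⟧ → Paired ⟦ Y ⟧ ⟦ Z ⟧ → Quaternionic ⟦ X ⟧ ⟦ Z ⟧ → HasORR G
    casePPQ xy@(n , p₁ , p₂) (_ , q₁ , q₂) (m , r₁ , r₂) with edge (triple a (X · Z) Y X) (change-generators gn (lookup (X · Z ∷ Y ∷ X ∷ [])) (lookup (Z ∷ Y ∷ Z ⁻ · X ∷ []))) (noninvolutions xz² (ni 1F) (ni 0F))
      where
      xz² : ⟦ X · Z · (X · Z) ⟧ ≢ ε
      xz² p = ni 0F (consequence {R = relQ X Z ++ (X · Z · (X · Z) ≐ e ∷ [])} (r₁ ∷ r₂ ∷ p ∷ []) (X · X ≐ e) ((1 , 1 , 1 , true) ∷ (0 , 2 , 0 , false) ∷ []))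
    ... | inj₁ orr = orr
    ... | inj₂ (commuting p) = casePCQ (triple a Y X (X · Z)) (change-generators gn (lookup (Y ∷ X ∷ X · Z ∷ [])) (lookup (Y ∷ X ∷ Y ⁻ · Z ∷ []))) (noninvolutions (ni 1F) (ni 0F) xz²) (swapP xy) (sym p)
        (nonc , (consequence {R = relQ X Z} (r₁ ∷ r₂ ∷ []) ((X · Z) ⁻ · X · (X · Z) · X ≐ e) ((0 , 0 , 0 , false) ∷ [])) , (consequence {R = relQ X Z} (r₁ ∷ r₂ ∷ []) (X ⁻ · (X · Z) · X · (X · Z) ≐ e) ((0 , 1 , 1 , false) ∷ (0 , 0 , 3 , false) ∷ [])))
      where
      xz² : ⟦ X · Z · (X · Z) ⟧ ≢ ε
      xz² p = ni 0F (consequence {R = relQ X Z ++ (X · Z · (X · Z) ≐ e ∷ [])} (r₁ ∷ r₂ ∷ p ∷ []) (X · X ≐ e) ((1 , 1 , 1 , true) ∷ (0 , 2 , 0 , false) ∷ []))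
      nonc : ⟦ X · (X · Z) ⟧ ≢ ⟦ X · Z · X ⟧
      nonc p = m (consequence {R = X · (X · Z) ≐ X · Z · X ∷ []} (p ∷ []) (X · Z ≐ Z · X) ((0 , 0 , 1 , false) ∷ []))
    ... | inj₂ (quaternionic (_ , p , q)) = contradiction (consequence {R = relP X Y ++ relP Y Z ++ relQ X Z ++ relQ (X · Z) Y} (p₁ ∷ p₂ ∷ q₁ ∷ q₂ ∷ r₁ ∷ r₂ ∷ p ∷ q ∷ []) (X · Y ≐ Y · X) ((2 , 5 , 0 , false) ∷ (1 , 6 , 1 , true) ∷ (1 , 7 , 3 , false) ∷ (0 , 1 , 0 , false) ∷ [])) n
    ... | inj₂ (paired (_ , p , q)) = contradiction (consequence {R = relP X Y ++ relP Y Z ++ relQ X Z ++ relP (X · Z) Y} (p₁ ∷ p₂ ∷ q₁ ∷ q₂ ∷ r₁ ∷ r₂ ∷ p ∷ q ∷ []) (X · Y ≐ Y · X) ((2 , 6 , 1 , true) ∷ (1 , 2 , 0 , false) ∷ (0 , 4 , 3 , false) ∷ [])) n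

    -- With all fourth powers trivial, `G` is a quotient of the group of order 64. A product of two
    -- squares cannot vanish, as the corresponding pair would commute; so all depends on whether
    -- `x²y²z²` does.
    casePPP : Paired ⟦ X ⟧ ⟦ Y ⟧ → Paired ⟦ Y ⟧ ⟦ Z ⟧ → Paired ⟦ X ⟧ ⟦ Z ⟧ → HasORR G ⊎ Exceptional G
    casePPP xy yz xz with fourth-power (triple a Y Z X) (change-generators gn (lookup (Y ∷ Z ∷ X ∷ [])) (lookup (Z ∷ X ∷ Y ∷ []))) (noninvolutions (ni 1F) (ni 2F) (ni 0F)) yz (swapP xz) (swapP xy)
                        | fourth-power (triple a Z X Y) (change-generators gn (lookup (Z ∷ X ∷ Y ∷ [])) (lookup (Y ∷ Z ∷ X ∷ []))) (noninvolutions (ni 2F) (ni 0F) (ni 1F)) (swapP xz) xy (swapP yz)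
                        | fourth-power a gn ni xy yz xz
    ... | inj₁ orr | _ | _ = inj₁ orr
    ... | inj₂ _ | inj₁ orr | _ = inj₁ orr
    ... | inj₂ _ | inj₂ _ | inj₁ orr = inj₁ orr
    ... | inj₂ x⁴ | inj₂ y⁴ | inj₂ z⁴ with ⟦ X · X · (Y · Y) · (Z · Z) ⟧ ≟ ε | xy | yz | xz
    ...   | d | n , p₁ , p₂ | m , q₁ , q₂ | l , r₁ , r₂ = go d
      where
      64sat : Satisfies G a relOrder64
      64sat = consequences {R = X ^ 4 ≐ e ∷ Y ^ 4 ≐ e ∷ Z ^ 4 ≐ e ∷ X · Y · (X · Y) ≐ e ∷ X · Y ⁻ · (X · Y ⁻) ≐ e ∷ X · Z · (X · Z) ≐ e ∷ X · Z ⁻ · (X · Z ⁻) ≐ e ∷ Y · Z · (Y · Z) ≐ e ∷ Y · Z ⁻ · (Y · Z ⁻) ≐ e ∷ []}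
        (x⁴ ∷ y⁴ ∷ z⁴ ∷ p₁ ∷ p₂ ∷ r₁ ∷ r₂ ∷ q₁ ∷ q₂ ∷ []) relOrder64
        (((0 , 0 , 0 , false) ∷ []) ∷ ((0 , 1 , 0 , false) ∷ []) ∷ ((0 , 2 , 0 , false) ∷ []) ∷ ((0 , 3 , 0 , false) ∷ []) ∷ ((0 , 4 , 0 , false) ∷ []) ∷ ((0 , 5 , 0 , false) ∷ []) ∷ ((0 , 6 , 0 , false) ∷ []) ∷ ((0 , 7 , 0 , false) ∷ []) ∷ ((0 , 8 , 0 , false) ∷ []) ∷ [])
      x²y²≢ε : ⟦ X · X · (Y · Y) ⟧ ≢ ε
      x²y²≢ε p = n (consequence {R = relP X Y ++ (X · X · (Y · Y) ≐ e ∷ [])} (p₁ ∷ p₂ ∷ p ∷ []) (X · Y ≐ Y · X) ((2 , 2 , 1 , true) ∷ (0 , 0 , 0 , false) ∷ []))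
      x²z²≢ε : ⟦ X · X · (Z · Z) ⟧ ≢ ε
      x²z²≢ε p = l (consequence {R = relP X Z ++ (X · X · (Z · Z) ≐ e ∷ [])} (r₁ ∷ r₂ ∷ p ∷ []) (X · Z ≐ Z · X) ((2 , 2 , 1 , true) ∷ (0 , 0 , 0 , false) ∷ []))
      y²z²≢ε : ⟦ Y · Y · (Z · Z) ⟧ ≢ ε
      y²z²≢ε p = m (consequence {R = relP Y Z ++ (Y · Y · (Z · Z) ≐ e ∷ [])} (q₁ ∷ q₂ ∷ p ∷ []) (Y · Z ≐ Z · Y) ((2 , 2 , 1 , true) ∷ (0 , 0 , 0 , false) ∷ []))
      go : Dec (⟦ X · X · (Y · Y) · (Z · Z) ⟧ ≡ ε) → HasORR G ⊎ Exceptional G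
      go (yes p) = inj₂ (exceptionalG1 G rank a gn (consequences {R = X · X · (Y · Y) · (Z · Z) ≐ e ∷ relOrder64} (p ∷ 64sat) relG1
        (((0 , 1 , 0 , false) ∷ []) ∷ ((0 , 2 , 0 , false) ∷ []) ∷ ((0 , 3 , 0 , false) ∷ []) ∷ ((0 , 4 , 0 , false) ∷ []) ∷ ((0 , 5 , 0 , false) ∷ []) ∷ ((0 , 6 , 0 , false) ∷ []) ∷ ((0 , 7 , 0 , false) ∷ []) ∷ ((0 , 8 , 0 , false) ∷ []) ∷ ((0 , 9 , 0 , false) ∷ []) ∷ ((0 , 0 , 0 , false) ∷ []) ∷ [])) (ni 0F) (ni 1F) x²y²≢ε)
      go (no n³) = inj₁ (order64-hasORR G rank a gn 64sat complete)
        where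
        complete : ∀ n → ⟦ central n ⟧ ≡ ε → T (isZero n)
        complete (o ∷ o ∷ o ∷ []) _ = tt
        complete (ı ∷ ı ∷ ı ∷ []) p = contradiction p n³
        complete (ı ∷ o ∷ o ∷ []) p = contradiction (trans (free-identity (X · X ≐ central (ı ∷ o ∷ o ∷ []))) p) (ni 0F)
        complete (o ∷ ı ∷ o ∷ []) p = contradiction (trans (free-identity (Y · Y ≐ central (o ∷ ı ∷ o ∷ []))) p) (ni 1F)
        complete (o ∷ o ∷ ı ∷ []) p = contradiction (trans (free-identity (Z · Z ≐ central (o ∷ o ∷ ı ∷ []))) p) (ni 2F)
        complete (ı ∷ ı ∷ o ∷ []) p = contradiction (trans (free-identity (X · X · (Y · Y) ≐ central (ı ∷ ı ∷ o ∷ []))) p) x²y²≢ε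
        complete (ı ∷ o ∷ ı ∷ []) p = contradiction (trans (free-identity (X · X · (Z · Z) ≐ central (ı ∷ o ∷ ı ∷ []))) p) x²z²≢ε
        complete (o ∷ ı ∷ ı ∷ []) p = contradiction (trans (free-identity (Y · Y · (Z · Z) ≐ central (o ∷ ı ∷ ı ∷ []))) p) y²z²≢ε

  open Paired₁ using (casePCC; casePPQ; casePPP)

  module Paired₂ (a : Fin 3 → C) (gn : Generates G a) (ni : NonInvolutions a) where
    open Eval G a

    -- If `xz` is not an involution, it can replace `z`. A commuting or quaternionic edge between
    -- `xz` and `y` gives a configuration already settled, and a paired one gives `y² = ε`.
    outer-product : Paired ⟦ X ⟧ ⟦ Y ⟧ → Paired ⟦ Y ⟧ ⟦ Z ⟧ → Commuting ⟦ X ⟧ ⟦ Z ⟧ → HasORR G ⊎ ⟦ X · Z · (X · Z) ⟧ ≡ ε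
    outer-product xy@(n , p₁ , p₂) (_ , q₁ , q₂) xz with ⟦ X · Z · (X · Z) ⟧ ≟ ε
    ... | yes p = inj₂ p
    ... | no n² with edge (triple a (X · Z) Y X) (change-generators gn (lookup (X · Z ∷ Y ∷ X ∷ [])) (lookup (Z ∷ Y ∷ Z ⁻ · X ∷ []))) (noninvolutions n² (ni 1F) (ni 0F))
    ...   | inj₁ orr = inj₁ orr
    ...   | inj₂ (commuting p) = inj₁ (casePCC (triple a X Y (X · Z)) (change-generators gn (lookup (X ∷ Y ∷ X · Z ∷ [])) (lookup (X ∷ Y ∷ X ⁻ · Z ∷ []))) (noninvolutions (ni 0F) (ni 1F) n²) xy
              (consequence {R = X · Z ≐ Z · X ∷ []} (xz ∷ []) (X · (X · Z) ≐ (X · Z) · X) ((1 , 0 , 0 , false) ∷ [])) (sym p))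
    ...   | inj₂ (quaternionic q) = inj₁ (casePCQ (triple a X Y (X · Z)) (change-generators gn (lookup (X ∷ Y ∷ X · Z ∷ [])) (lookup (X ∷ Y ∷ X ⁻ · Z ∷ []))) (noninvolutions (ni 0F) (ni 1F) n²) xy
              (consequence {R = X · Z ≐ Z · X ∷ []} (xz ∷ []) (X · (X · Z) ≐ (X · Z) · X) ((1 , 0 , 0 , false) ∷ [])) (swapQ q))
    ...   | inj₂ (paired (_ , p , q)) = contradiction (consequence {R = relP X Y ++ relP Y Z ++ relC X Z ++ relP (X · Z) Y} (p₁ ∷ p₂ ∷ q₁ ∷ q₂ ∷ xz ∷ p ∷ q ∷ []) (Y · Y ≐ e) ((0 , 6 , 0 , true) ∷ (1 , 3 , 0 , true) ∷ (2 , 4 , 3 , false) ∷ (0 , 0 , 0 , false) ∷ [])) (ni 1F)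

  open Paired₂ using (outer-product)

  module Paired₃ (a : Fin 3 → C) (gn : Generates G a) (ni : NonInvolutions a) where
    open Eval G a

    -- Used with `z` and with `z⁻¹`, `outer-product` gives `(xz)² = (xz⁻¹)² = ε`. Hence `x⁴ = ε`,
    -- and `xz` is a central involution; whether `y⁴` vanishes separates the group of bounded order
    -- from the open family.
    casePPC : Paired ⟦ X ⟧ ⟦ Y ⟧ → Paired ⟦ Y ⟧ ⟦ Z ⟧ → Commuting ⟦ X ⟧ ⟦ Z ⟧ → HasORR G
    casePPC xy yz xz with outer-product a gn ni xy yz xz
    ... | inj₁ orr = orr
    ... | inj₂ w₁ with outer-product (triple a X Y (Z ⁻)) (change-generators gn (lookup (X ∷ Y ∷ Z ⁻ ∷ [])) (lookup (X ∷ Y ∷ Z ⁻ ∷ []))) (noninvolutions (ni 0F) (ni 1F) (λ p → ni 2F (consequence {R = Z ⁻ · Z ⁻ ≐ e ∷ []} (p ∷ []) (Z · Z ≐ e) ((0 , 0 , 0 , true) ∷ [])))) xy (inverseP yz) (consequence {R = X · Z ≐ Z · X ∷ []} (xz ∷ []) (X · Z ⁻ ≐ Z ⁻ · X) ((0 , 0 , 3 , true) ∷ []))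
      where
      inverseP : Paired ⟦ Y ⟧ ⟦ Z ⟧ → Paired ⟦ Y ⟧ ⟦ Z ⁻ ⟧
      inverseP (n , q₁ , q₂) = (λ p → n (consequence {R = Y · Z ⁻ ≐ Z ⁻ · Y ∷ []} (p ∷ []) (Y · Z ≐ Z · Y) ((0 , 0 , 3 , true) ∷ []))) , q₂ , (consequence {R = Y · Z · (Y · Z) ≐ e ∷ []} (q₁ ∷ []) (Y · (Z ⁻) ⁻ · (Y · (Z ⁻) ⁻) ≐ e) ((0 , 0 , 0 , false) ∷ []))
    ...   | inj₁ orr = orr
    ...   | inj₂ w₂ with ⟦ Y · Y · (Y · Y) ⟧ ≟ ε | xy | yz
    ...     | d | n , p₁ , p₂ | _ , q₁ , q₂ = finish d
      where
      x²y²≢ε : ⟦ X · X · (Y · Y) ⟧ ≢ ε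
      x²y²≢ε p = n (consequence {R = relP X Y ++ (X · X · (Y · Y) ≐ e ∷ [])} (p₁ ∷ p₂ ∷ p ∷ []) (X · Y ≐ Y · X) ((2 , 2 , 1 , true) ∷ (0 , 0 , 0 , false) ∷ []))
      x⁴ : ⟦ X · X · (X · X) ⟧ ≡ ε
      x⁴ = (consequence {R = relP X Y ++ relP Y Z ++ relC X Z ++ (X · Z · (X · Z) ≐ e ∷ X · Z ⁻ · (X · Z ⁻) ≐ e ∷ [])} (p₁ ∷ p₂ ∷ q₁ ∷ q₂ ∷ xz ∷ w₁ ∷ w₂ ∷ []) (X · X · (X · X) ≐ e) ((3 , 4 , 0 , false) ∷ (2 , 5 , 0 , false) ∷ (1 , 6 , 0 , false) ∷ (0 , 4 , 0 , false) ∷ []))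
      wx : ⟦ X · (X · Z) ⟧ ≡ ⟦ X · Z · X ⟧
      wx = (consequence {R = X · Z ≐ Z · X ∷ []} (xz ∷ []) (X · (X · Z) ≐ (X · Z) · X) ((1 , 0 , 0 , false) ∷ []))
      wy : ⟦ Y · (X · Z) ⟧ ≡ ⟦ X · Z · Y ⟧
      wy = (consequence {R = relP X Y ++ relP Y Z ++ relC X Z ++ (X · Z · (X · Z) ≐ e ∷ X · Z ⁻ · (X · Z ⁻) ≐ e ∷ [])} (p₁ ∷ p₂ ∷ q₁ ∷ q₂ ∷ xz ∷ w₁ ∷ w₂ ∷ []) (Y · (X · Z) ≐ (X · Z) · Y) ((2 , 3 , 0 , true) ∷ (0 , 0 , 1 , false) ∷ (0 , 5 , 1 , true) ∷ (0 , 4 , 0 , true) ∷ []))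
      finish : Dec (⟦ Y · Y · (Y · Y) ⟧ ≡ ε) → HasORR G
      finish (yes y⁴) = H×C₂-hasORR G rank (triple a X Y (X · Z)) (change-generators gn (lookup (X ∷ Y ∷ X · Z ∷ [])) (lookup (X ∷ Y ∷ X ⁻ · Z ∷ [])))
        (p₁ ∷ p₂ ∷ x⁴ ∷ y⁴ ∷ wx ∷ wy ∷ w₁ ∷ []) (ni 0F) (ni 1F) x²y²≢ε
      finish (no y⁴) = PairedTimesC₂.hasORR G rank (triple a X Y (X · Z)) (change-generators gn (lookup (X ∷ Y ∷ X · Z ∷ [])) (lookup (X ∷ Y ∷ X ⁻ · Z ∷ [])))
        (p₁ ∷ p₂ ∷ x⁴ ∷ wx ∷ wy ∷ w₁ ∷ []) (ni 0F) (ni 1F) y⁴ x²y²≢ε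

  open Paired₃ using (casePPC)

  module Dispatch
    (caseCCC : ∀ a → Generates G a → NonInvolutions a → Commuting (a 0F) (a 1F) → Commuting (a 1F) (a 2F) → Commuting (a 0F) (a 2F) → HasORR G ⊎ Exceptional G)
    (a : Fin 3 → C) (gn : Generates G a) (ni : NonInvolutions a) where
    open Eval G a

    -- Up to permutation of the generators the 27 configurations are ten, the multisets of three
    -- types. Each clause reorders the triple so that its configuration takes the shape treated
    -- above.
    dispatch : Edge ⟦ X ⟧ ⟦ Y ⟧ → Edge ⟦ Y ⟧ ⟦ Z ⟧ → Edge ⟦ X ⟧ ⟦ Z ⟧ → HasORR G ⊎ Exceptional G
    dispatch (commuting p) (commuting q) (commuting r) = caseCCC a gn ni p q r
    dispatch (commuting p) (commuting q) (quaternionic r) = caseQCC (triple a X Z Y) (change-generators gn (lookup (X ∷ Z ∷ Y ∷ [])) (lookup (X ∷ Z ∷ Y ∷ []))) (noninvolutions (ni 0F) (ni 2F) (ni 1F)) r p (swapC q)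
    dispatch (commuting p) (commuting q) (paired r) = inj₁ (casePCC (triple a X Z Y) (change-generators gn (lookup (X ∷ Z ∷ Y ∷ [])) (lookup (X ∷ Z ∷ Y ∷ []))) (noninvolutions (ni 0F) (ni 2F) (ni 1F)) r p (swapC q))
    dispatch (commuting p) (quaternionic q) (commuting r) = caseQCC (triple a Y Z X) (change-generators gn (lookup (Y ∷ Z ∷ X ∷ [])) (lookup (Z ∷ X ∷ Y ∷ []))) (noninvolutions (ni 1F) (ni 2F) (ni 0F)) q (swapC p) (swapC r)
    dispatch (commuting p) (quaternionic q) (quaternionic r) = inj₁ (caseQQC a gn ni r q p)
    dispatch (commuting p) (quaternionic q) (paired r) = inj₁ (casePCQ (triple a X Z Y) (change-generators gn (lookup (X ∷ Z ∷ Y ∷ [])) (lookup (X ∷ Z ∷ Y ∷ []))) (noninvolutions (ni 0F) (ni 2F) (ni 1F)) r p (swapQ q))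
    dispatch (commuting p) (paired q) (commuting r) = inj₁ (casePCC (triple a Y Z X) (change-generators gn (lookup (Y ∷ Z ∷ X ∷ [])) (lookup (Z ∷ X ∷ Y ∷ []))) (noninvolutions (ni 1F) (ni 2F) (ni 0F)) q (swapC p) (swapC r))
    dispatch (commuting p) (paired q) (quaternionic r) = inj₁ (casePCQ (triple a Y Z X) (change-generators gn (lookup (Y ∷ Z ∷ X ∷ [])) (lookup (Z ∷ X ∷ Y ∷ []))) (noninvolutions (ni 1F) (ni 2F) (ni 0F)) q (swapC p) (swapQ r))
    dispatch (commuting p) (paired q) (paired r) = inj₁ (casePPC (triple a X Z Y) (change-generators gn (lookup (X ∷ Z ∷ Y ∷ [])) (lookup (X ∷ Z ∷ Y ∷ []))) (noninvolutions (ni 0F) (ni 2F) (ni 1F)) r (swapP q) p)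
    dispatch (quaternionic p) (commuting q) (commuting r) = caseQCC a gn ni p r q
    dispatch (quaternionic p) (commuting q) (quaternionic r) = inj₁ (caseQQC (triple a Y Z X) (change-generators gn (lookup (Y ∷ Z ∷ X ∷ [])) (lookup (Z ∷ X ∷ Y ∷ []))) (noninvolutions (ni 1F) (ni 2F) (ni 0F)) (swapQ p) (swapQ r) q)
    dispatch (quaternionic p) (commuting q) (paired r) = inj₁ (casePCQ (triple a Z X Y) (change-generators gn (lookup (Z ∷ X ∷ Y ∷ [])) (lookup (Y ∷ Z ∷ X ∷ []))) (noninvolutions (ni 2F) (ni 0F) (ni 1F)) (swapP r) (swapC q) p)
    dispatch (quaternionic p) (quaternionic q) (commuting r) = inj₁ (caseQQC (triple a X Z Y) (change-generators gn (lookup (X ∷ Z ∷ Y ∷ [])) (lookup (X ∷ Z ∷ Y ∷ []))) (noninvolutions (ni 0F) (ni 2F) (ni 1F)) p (swapQ q) r)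
    dispatch (quaternionic p) (quaternionic q) (quaternionic r) = inj₁ (caseQQQ a gn ni p q r)
    dispatch (quaternionic p) (quaternionic q) (paired r) = ⊥-elim (casePQQ (triple a X Z Y) (change-generators gn (lookup (X ∷ Z ∷ Y ∷ [])) (lookup (X ∷ Z ∷ Y ∷ []))) (noninvolutions (ni 0F) (ni 2F) (ni 1F)) r p (swapQ q))
    dispatch (quaternionic p) (paired q) (commuting r) = inj₁ (casePCQ (triple a Z Y X) (change-generators gn (lookup (Z ∷ Y ∷ X ∷ [])) (lookup (Z ∷ Y ∷ X ∷ []))) (noninvolutions (ni 2F) (ni 1F) (ni 0F)) (swapP q) (swapC r) (swapQ p))
    dispatch (quaternionic p) (paired q) (quaternionic r) = ⊥-elim (casePQQ (triple a Y Z X) (change-generators gn (lookup (Y ∷ Z ∷ X ∷ [])) (lookup (Z ∷ X ∷ Y ∷ []))) (noninvolutions (ni 1F) (ni 2F) (ni 0F)) q (swapQ p) (swapQ r))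
    dispatch (quaternionic p) (paired q) (paired r) = inj₁ (casePPQ (triple a X Z Y) (change-generators gn (lookup (X ∷ Z ∷ Y ∷ [])) (lookup (X ∷ Z ∷ Y ∷ []))) (noninvolutions (ni 0F) (ni 2F) (ni 1F)) r (swapP q) p)
    dispatch (paired p) (commuting q) (commuting r) = inj₁ (casePCC a gn ni p r q)
    dispatch (paired p) (commuting q) (quaternionic r) = inj₁ (casePCQ (triple a Y X Z) (change-generators gn (lookup (Y ∷ X ∷ Z ∷ [])) (lookup (Y ∷ X ∷ Z ∷ []))) (noninvolutions (ni 1F) (ni 0F) (ni 2F)) (swapP p) q r)
    dispatch (paired p) (commuting q) (paired r) = inj₁ (casePPC (triple a Y X Z) (change-generators gn (lookup (Y ∷ X ∷ Z ∷ [])) (lookup (Y ∷ X ∷ Z ∷ []))) (noninvolutions (ni 1F) (ni 0F) (ni 2F)) (swapP p) r q)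
    dispatch (paired p) (quaternionic q) (commuting r) = inj₁ (casePCQ a gn ni p r q)
    dispatch (paired p) (quaternionic q) (quaternionic r) = ⊥-elim (casePQQ a gn ni p r q)
    dispatch (paired p) (quaternionic q) (paired r) = inj₁ (casePPQ (triple a Y X Z) (change-generators gn (lookup (Y ∷ X ∷ Z ∷ [])) (lookup (Y ∷ X ∷ Z ∷ []))) (noninvolutions (ni 1F) (ni 0F) (ni 2F)) (swapP p) r q)
    dispatch (paired p) (paired q) (commuting r) = inj₁ (casePPC a gn ni p q r)
    dispatch (paired p) (paired q) (quaternionic r) = inj₁ (casePPQ a gn ni p q r)
    dispatch (paired p) (paired q) (paired r) = casePPP a gn ni p q r

    orr-or-exceptional : HasORR G ⊎ Exceptional G
    orr-or-exceptional with edge a gn ni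
      | edge (triple a Y Z X) (change-generators gn (lookup (Y ∷ Z ∷ X ∷ [])) (lookup (Z ∷ X ∷ Y ∷ []))) (noninvolutions (ni 1F) (ni 2F) (ni 0F))
      | edge (triple a X Z Y) (change-generators gn (lookup (X ∷ Z ∷ Y ∷ [])) (lookup (X ∷ Z ∷ Y ∷ []))) (noninvolutions (ni 0F) (ni 2F) (ni 1F))
    ... | inj₁ orr | _ | _ = inj₁ orr
    ... | inj₂ _ | inj₁ orr | _ = inj₁ orr
    ... | inj₂ _ | inj₂ _ | inj₁ orr = inj₁ orr
    ... | inj₂ p | inj₂ q | inj₂ r = dispatch p q r

-- Connection sets for abelian groups

-- The elements `y, xy, x²y` form a progression with difference `x`. The inequalities for `x²`,
-- `y²`, `x²y²`, `x⁴y²` and `z²` keep involutions out of `S`; `x³ = ε` would close the progression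
-- to a cycle.
module Arithmetic (G : FinGroup) (rank : NotGeneratedByTwo G) (a : Fin 3 → Carrier G) (gn : Generates G a)
  (xy : eval G a (X · Y) ≡ eval G a (Y · X))
  (x²≢ε : eval G a (X · X) ≢ FinGroup.ε G) (x³≢ε : eval G a (X · X · X) ≢ FinGroup.ε G)
  (y²≢ε : eval G a (Y · Y) ≢ FinGroup.ε G) (x²y²≢ε : eval G a (X · X · Y · Y) ≢ FinGroup.ε G)
  (x⁴y²≢ε : eval G a (X · X · X · X · Y · Y) ≢ FinGroup.ε G) (z²≢ε : eval G a (Z · Z) ≢ FinGroup.ε G) where
  open GroupOf G
  open Eval G a
  open Independence G rank a gn
  open Generation G

  relations : List (Relation 3)
  relations = X · Y ≐ Y · X ∷ []

  sat : Satisfies G a relations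
  sat = xy ∷ []

  reject : ∀ u v ss → {_ : T (derives (relations ++ u ≐ e ∷ []) (v ≐ e) ss)} → ⟦ v ⟧ ≢ ε → ⟦ u ⟧ ≢ ε
  reject u v ss {t} n p = n (consequence {R = relations ++ u ≐ e ∷ []} (satisfies-++ {a = a} sat (p ∷ [])) (v ≐ e) ss {t})

  -- In terms of the generators `x, xy, z` the word is `(xy)² x`, where `x` occurs once.
  x³y²≢ε : ⟦ X · X · X · Y · Y ⟧ ≢ ε
  x³y²≢ε p = Independence.primitive-≢ G rank (λ i → ⟦ lookup (X ∷ X · Y ∷ Z ∷ []) i ⟧)
    (change-generators gn (lookup (X ∷ X · Y ∷ Z ∷ [])) (lookup (X ∷ X ⁻ · Y ∷ Z ∷ []))) (Y · Y · X ≐ e)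
    (consequence {R = X · X · X · Y · Y ≐ e ∷ relations} (p ∷ sat) (X · Y · (X · Y) · X ≐ e) ((1 , 1 , 0 , true) ∷ (0 , 0 , 1 , false) ∷ []))

  trivials nontrivials : List (Word 3)
  trivials = X · Y · X ⁻ · Y ⁻ ∷ []
  nontrivials = X · X ∷ X · X · X ∷ Y · Y ∷ X · X · Y · Y ∷ Z · Z ∷ X · X · Y · X ⁻ · Y ⁻ ∷ X · Y · X ⁻ · Y ∷ X · X · Y · X ⁻ · Y ∷ X · Y · X · Y ⁻ ∷ X · X · Y · X · Y ⁻ ∷ X · Y · X · Y ∷ X · X · Y · X · Y ∷ X · X · Y · X · X · Y ∷ []

  trivial : All (λ u → ⟦ u ⟧ ≡ ε) trivials
  trivial = consequence sat (X · Y · X ⁻ · Y ⁻ ≐ e) ((0 , 0 , 0 , false) ∷ []) ∷ []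

  nontrivial : All (λ u → ⟦ u ⟧ ≢ ε) nontrivials
  nontrivial = x²≢ε ∷ x³≢ε ∷ y²≢ε ∷ x²y²≢ε ∷ z²≢ε ∷
    reject (X · X · Y · X ⁻ · Y ⁻) (X) ((0 , 1 , 0 , false) ∷ (0 , 0 , 0 , true) ∷ []) (primitive-≢ (X ≐ e)) ∷
    reject (X · Y · X ⁻ · Y) (Y · Y) ((0 , 0 , 0 , true) ∷ (0 , 1 , 0 , false) ∷ []) y²≢ε ∷
    reject (X · X · Y · X ⁻ · Y) (X · Y · Y) ((0 , 1 , 1 , false) ∷ (0 , 0 , 2 , false) ∷ []) (primitive-≢ (X · Y · Y ≐ e)) ∷
    reject (X · Y · X · Y ⁻) (X · X) ((1 , 0 , 0 , false) ∷ (0 , 1 , 0 , false) ∷ []) x²≢ε ∷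
    reject (X · X · Y · X · Y ⁻) (X · X · X) ((1 , 1 , 0 , false) ∷ (0 , 0 , 0 , false) ∷ []) x³≢ε ∷
    reject (X · Y · X · Y) (X · X · Y · Y) ((1 , 0 , 0 , false) ∷ (0 , 1 , 0 , false) ∷ []) x²y²≢ε ∷
    reject (X · X · Y · X · Y) (X · X · X · Y · Y) ((1 , 1 , 0 , false) ∷ (0 , 0 , 3 , true) ∷ []) x³y²≢ε ∷
    reject (X · X · Y · X · X · Y) (X · X · X · X · Y · Y) ((3 , 0 , 0 , false) ∷ (1 , 1 , 0 , false) ∷ (0 , 0 , 3 , true) ∷ []) x⁴y²≢ε ∷ []

  S : Vec (Word 3) 5
  S = X ∷ Y ∷ (X · Y) ∷ (X · X · Y) ∷ Z ∷ []

  open Symbolic G rank a gn trivials trivial nontrivials nontrivial S using (module Decided)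
  open Decided tt tt

  -- The arrows are x → xy → x²y, y → xy and x → x²y.
  hasORR : HasORR G
  hasORR = orr oriented gn λ { 0F → fx ; 1F → fy ; 2F → fixed-last 4F λ { 0F _ → fx ; 1F _ → fy ; 2F _ → fxy ; 3F _ → fx²y ; 4F ≢ → contradiction refl ≢ } }
    where
    fx²y : Fixed ⟦ X · X · Y ⟧
    fx²y = fixed-by-local (◇[ into ] everything & ~ ◇[ out ] everything) 3F
    fxy : Fixed ⟦ X · Y ⟧
    fxy = fixed-by-local (◇[ into ] everything & ◇[ out ] everything) 2F
    fx : Fixed ⟦ X ⟧
    fx = Fixed-by (X · X · Y · (X · Y) ⁻) (Fixed-∙ fx²y (Fixed-⁻¹ fxy)) (free-identity (X · X · Y · (X · Y) ⁻ ≐ X))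
    fy : Fixed ⟦ Y ⟧
    fy = Fixed-by (X ⁻ · (X · Y)) (Fixed-∙ (Fixed-⁻¹ fx) fxy) (free-identity (X ⁻ · (X · Y) ≐ Y))

relC₃³ : List (Relation 3)
relC₃³ = X · X · X ≐ e ∷ Y · Y · Y ≐ e ∷ Z · Z · Z ≐ e ∷ X · Y ≐ Y · X ∷ X · Z ≐ Z · X ∷ Y · Z ≐ Z · Y ∷ []

module ElementaryAbelian27 (G : FinGroup) (rank : NotGeneratedByTwo G) (a : Fin 3 → Carrier G) (gn : Generates G a)
  (sat : Satisfies G a relC₃³) where
  open GroupOf G
  open Eval G a
  open Independence G rank a gn

  reject : ∀ u v ss → {_ : T (derives (relC₃³ ++ u ≐ e ∷ []) (v ≐ e) ss)} → ⟦ v ⟧ ≢ ε → ⟦ u ⟧ ≢ ε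
  reject u v ss {t} n p = n (consequence {R = relC₃³ ++ u ≐ e ∷ []} (satisfies-++ {a = a} sat (p ∷ [])) (v ≐ e) ss {t})

  trivials nontrivials : List (Word 3)
  trivials = Y · Z · Y ⁻ · Z ⁻ ∷ X · Z · X ⁻ · Z ⁻ ∷ Y · Y · Y ∷ Y · Y · Z · Y · Z ⁻ ∷ []
  nontrivials = Y · Z · Y · Z ⁻ ∷ Y · Z · Y ⁻ · Z ∷ Y · Z ⁻ · Y · Z ⁻ ∷ X · Z · X ⁻ · Z ∷ Y · Y ∷ Z · Z ∷ Y · Y · Z ⁻ · Z ⁻ ∷ Y · Y · Z · Y ⁻ · Z ⁻ ∷ Y · Y · Z ⁻ · Y ⁻ · Z ⁻ ∷ Y · Y · Z ⁻ · Y · Z ⁻ ∷ X · X ∷ X · Z · X · Z ⁻ ∷ Y · Z · Y · Z ∷ X · Z · X · Z ∷ []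

  trivial : All (λ u → ⟦ u ⟧ ≡ ε) trivials
  trivial = consequence sat (Y · Z · Y ⁻ · Z ⁻ ≐ e) ((0 , 5 , 0 , false) ∷ []) ∷ consequence sat (X · Z · X ⁻ · Z ⁻ ≐ e) ((0 , 4 , 0 , false) ∷ []) ∷ consequence sat (Y · Y · Y ≐ e) ((0 , 1 , 0 , false) ∷ []) ∷ consequence sat (Y · Y · Z · Y · Z ⁻ ≐ e) ((2 , 5 , 0 , true) ∷ (0 , 1 , 0 , false) ∷ []) ∷ []

  nontrivial : All (λ u → ⟦ u ⟧ ≢ ε) nontrivials
  nontrivial =
    reject (Y · Z · Y · Z ⁻) (Y ⁻) ((0 , 1 , 0 , true) ∷ (1 , 5 , 0 , false) ∷ (0 , 6 , 0 , false) ∷ []) (primitive-≢ (Y ⁻ ≐ e)) ∷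
    reject (Y · Z · Y ⁻ · Z) (Z ⁻) ((0 , 2 , 0 , true) ∷ (0 , 5 , 0 , true) ∷ (0 , 6 , 0 , false) ∷ []) (primitive-≢ (Z ⁻ ≐ e)) ∷
    reject (Y · Z ⁻ · Y · Z ⁻) (Y ⁻ · Z) ((0 , 1 , 0 , true) ∷ (2 , 2 , 0 , false) ∷ (1 , 6 , 0 , false) ∷ (0 , 5 , 0 , false) ∷ []) (primitive-≢ (Y ⁻ · Z ≐ e)) ∷
    reject (X · Z · X ⁻ · Z) (Z ⁻) ((0 , 2 , 0 , true) ∷ (0 , 4 , 0 , true) ∷ (0 , 6 , 0 , false) ∷ []) (primitive-≢ (Z ⁻ ≐ e)) ∷
    reject (Y · Y) (Y ⁻) ((0 , 1 , 0 , true) ∷ (0 , 6 , 0 , false) ∷ []) (primitive-≢ (Y ⁻ ≐ e)) ∷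
    reject (Z · Z) (Z ⁻) ((0 , 2 , 0 , true) ∷ (0 , 6 , 0 , false) ∷ []) (primitive-≢ (Z ⁻ ≐ e)) ∷
    reject (Y · Y · Z ⁻ · Z ⁻) (Y ⁻ · Z) ((0 , 1 , 0 , true) ∷ (0 , 6 , 0 , false) ∷ (0 , 2 , 0 , false) ∷ []) (primitive-≢ (Y ⁻ · Z ≐ e)) ∷
    reject (Y · Y · Z · Y ⁻ · Z ⁻) (Y) ((0 , 6 , 0 , false) ∷ (0 , 5 , 0 , true) ∷ []) (primitive-≢ (Y ≐ e)) ∷
    reject (Y · Y · Z ⁻ · Y ⁻ · Z ⁻) (Y · Z) ((1 , 2 , 0 , false) ∷ (0 , 6 , 1 , false) ∷ (0 , 5 , 1 , true) ∷ []) (primitive-≢ (Y · Z ≐ e)) ∷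
    reject (Y · Y · Z ⁻ · Y · Z ⁻) (Z) ((0 , 2 , 0 , false) ∷ (0 , 5 , 2 , true) ∷ (1 , 6 , 2 , false) ∷ (0 , 1 , 0 , true) ∷ []) (primitive-≢ (Z ≐ e)) ∷
    reject (X · X) (X ⁻) ((0 , 0 , 0 , true) ∷ (0 , 6 , 0 , false) ∷ []) (primitive-≢ (X ⁻ ≐ e)) ∷
    reject (X · Z · X · Z ⁻) (X ⁻) ((0 , 0 , 0 , true) ∷ (1 , 4 , 0 , false) ∷ (0 , 6 , 0 , false) ∷ []) (primitive-≢ (X ⁻ ≐ e)) ∷
    reject (Y · Z · Y · Z) (Y ⁻ · Z ⁻) ((0 , 1 , 0 , true) ∷ (2 , 2 , 0 , true) ∷ (1 , 5 , 0 , false) ∷ (0 , 6 , 0 , false) ∷ []) (primitive-≢ (Y ⁻ · Z ⁻ ≐ e)) ∷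
    reject (X · Z · X · Z) (X ⁻ · Z ⁻) ((0 , 0 , 0 , true) ∷ (2 , 2 , 0 , true) ∷ (1 , 4 , 0 , false) ∷ (0 , 6 , 0 , false) ∷ []) (primitive-≢ (X ⁻ · Z ⁻ ≐ e)) ∷ []

  S : Vec (Word 3) 6
  S = Z ∷ Y ∷ (Y · Z) ∷ (Y ⁻ · Z) ∷ X ∷ (X · Z) ∷ []

  open Symbolic G rank a gn trivials trivial nontrivials nontrivial S using (module Decided)
  open Decided tt tt

  -- The arrows are the directed triangle `z → yz → y⁻¹z → z`, arrows from `y` to its three
  -- vertices, and `x → xz`, `z → xz`. Thus `xz` is the only sink, `x` alone can make exactly one
  -- step, and `y` is the other vertex that nothing enters.
  hasORR : HasORR G
  hasORR = orr oriented gn λ { 0F → fx ; 1F → fy ; 2F → fz }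
    where
    fxz : Fixed ⟦ X · Z ⟧
    fxz = fixed-by-local (~ ◇[ out ] everything) 5F
    fx : Fixed ⟦ X ⟧
    fx = fixed-by-local (◇[ out ] everything & ~ ◇[ out ] ◇[ out ] everything) 4F
    fy : Fixed ⟦ Y ⟧
    fy = fixed-by-local (◇[ out ] ◇[ out ] everything & ~ ◇[ into ] everything) 1F
    fz : Fixed ⟦ Z ⟧
    fz = Fixed-by (X ⁻ · (X · Z)) (Fixed-∙ (Fixed-⁻¹ fx) fxz) (free-identity (X ⁻ · (X · Z) ≐ Z))

-- Normal forms for `C₃ × C₂³`

-- (i , j ∷ k ∷ l ∷ []) stands for x^i y^j z^k w^l.
Normal₂₄ : Set
Normal₂₄ = Fin 3 × Bits

cube : Fin 3 → Word 4
cube 0F = e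
cube 1F = X
cube 2F = X · X

infixl 6 _⊹_ _⊞₃_

_⊹_ : Fin 3 → Fin 3 → Fin 3
0F ⊹ j  = j
1F ⊹ 0F = 1F
1F ⊹ 1F = 2F
1F ⊹ 2F = 0F
2F ⊹ 0F = 2F
2F ⊹ 1F = 0F
2F ⊹ 2F = 1F

negate : Fin 3 → Fin 3
negate 0F = 0F
negate 1F = 2F
negate 2F = 1F

_⊞₃_ : Normal₂₄ → Normal₂₄ → Normal₂₄
(i , v) ⊞₃ (j , w) = i ⊹ j , v ⊞ w

⊟_ : Normal₂₄ → Normal₂₄
⊟ (i , v) = negate i , v

zero₂₄ : Normal₂₄
zero₂₄ = 0F , replicate 3 false

normalWord₂₄ : Normal₂₄ → Word 4
normalWord₂₄ (i , j ∷ k ∷ l ∷ []) = cube i · bit Y j · bit Z k · bit W l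

negate-⊹ : ∀ i → negate i ⊹ i ≡ 0F
negate-⊹ 0F = refl
negate-⊹ 1F = refl
negate-⊹ 2F = refl

⊞-self : ∀ v → v ⊞ v ≡ replicate 3 false
⊞-self (a ∷ b ∷ c ∷ []) = cong₂ _∷_ (xor-self a) (cong₂ _∷_ (xor-self b) (cong (_∷ []) (xor-self c)))
  where
  xor-self : ∀ a → a xor a ≡ false
  xor-self true  = refl
  xor-self false = refl

negate-⊹-zero : ∀ i j → negate i ⊹ j ≡ 0F → i ≡ j
negate-⊹-zero 0F 0F _ = refl
negate-⊹-zero 1F 1F _ = refl
negate-⊹-zero 1F 2F ()
negate-⊹-zero 2F 2F _ = refl

⊞-zero : ∀ v w → v ⊞ w ≡ replicate 3 false → v ≡ w
⊞-zero (a ∷ b ∷ c ∷ []) (a′ ∷ b′ ∷ c′ ∷ []) eq =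
  cong₂ _∷_ (bits a a′ (cong Vec.head eq)) (cong₂ _∷_ (bits b b′ (cong (λ v → Vec.head (Vec.tail v)) eq))
    (cong (_∷ []) (bits c c′ (cong (λ v → Vec.head (Vec.tail (Vec.tail v))) eq))))
  where
  bits : ∀ a b → a xor b ≡ false → a ≡ b
  bits true  true  _ = refl
  bits false false _ = refl

module Group₂₄ (H : FinGroup) (b : Fin 4 → Carrier H) (sat : Satisfies H b relC3C2C2C2) where
  open GroupOf H
  open Eval H b

  value₂₄ : Normal₂₄ → C
  value₂₄ n = ⟦ normalWord₂₄ n ⟧

  module Elements {k : ℕ} (gs : Vec C k) = Eval H (lookup gs) using () renaming (consequence to elements-consequence)

  cube-⊹ : ∀ i j → ⟦ cube i ⟧ ∙ ⟦ cube j ⟧ ≡ ⟦ cube (i ⊹ j) ⟧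
  cube-⊹ 0F j  = identityˡ _
  cube-⊹ 1F 0F = identityʳ _
  cube-⊹ 1F 1F = refl
  cube-⊹ 1F 2F = consequence sat (X · (X · X) ≐ e) ((0 , 0 , 0 , false) ∷ [])
  cube-⊹ 2F 0F = identityʳ _
  cube-⊹ 2F 1F = consequence sat (X · X · X ≐ e) ((0 , 0 , 0 , false) ∷ [])
  cube-⊹ 2F 2F = consequence sat (X · X · (X · X) ≐ X) ((0 , 0 , 0 , false) ∷ [])

  bit-⊞ : ∀ u → ⟦ u · u ⟧ ≡ ε → ∀ a a′ → ⟦ bit u a ⟧ ∙ ⟦ bit u a′ ⟧ ≡ ⟦ bit u (a xor a′) ⟧
  bit-⊞ u p true  true  = p
  bit-⊞ u p true  false = identityʳ _
  bit-⊞ u p false a′    = identityˡ _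

  commute-bit : ∀ {g} u → g ∙ ⟦ u ⟧ ≡ ⟦ u ⟧ ∙ g → ∀ a → g ∙ ⟦ bit u a ⟧ ≡ ⟦ bit u a ⟧ ∙ g
  commute-bit u p true  = p
  commute-bit u p false = trans (identityʳ _) (sym (identityˡ _))

  bit-commute : ∀ u v → ⟦ u ⟧ ∙ ⟦ v ⟧ ≡ ⟦ v ⟧ ∙ ⟦ u ⟧ → ∀ a c → ⟦ bit u a ⟧ ∙ ⟦ bit v c ⟧ ≡ ⟦ bit v c ⟧ ∙ ⟦ bit u a ⟧
  bit-commute u v p a c = sym (commute-bit u (sym (commute-bit v p c)) a)

  cube-commute : ∀ u → ⟦ X · u ⟧ ≡ ⟦ u · X ⟧ → ∀ i a → ⟦ cube i ⟧ ∙ ⟦ bit u a ⟧ ≡ ⟦ bit u a ⟧ ∙ ⟦ cube i ⟧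
  cube-commute u p i a = sym (cubes i)
    where
    one-step : ⟦ bit u a ⟧ ∙ ⟦ X ⟧ ≡ ⟦ X ⟧ ∙ ⟦ bit u a ⟧
    one-step = sym (commute-bit u p a)
    cubes : ∀ i → ⟦ bit u a ⟧ ∙ ⟦ cube i ⟧ ≡ ⟦ cube i ⟧ ∙ ⟦ bit u a ⟧
    cubes 0F = trans (identityʳ _) (sym (identityˡ _))
    cubes 1F = one-step
    cubes 2F = (elements-consequence {R = X · Y ≐ Y · X ∷ []} (one-step ∷ []) (X · (Y · Y) ≐ Y · Y · X) ((2 , 0 , 1 , false) ∷ (0 , 0 , 0 , false) ∷ []))
      where open Elements (⟦ bit u a ⟧ ∷ ⟦ X ⟧ ∷ [])

  value-⊞₃ : ∀ n m → value₂₄ (n ⊞₃ m) ≡ value₂₄ n ∙ value₂₄ m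
  value-⊞₃ (i , j ∷ k ∷ l ∷ []) (i′ , j′ ∷ k′ ∷ l′ ∷ []) = trans
    (cong₂ _∙_ (cong₂ _∙_ (cong₂ _∙_ (sym (cube-⊹ i i′)) (sym (bit-⊞ Y (consequence sat (Y · Y ≐ e) ((0 , 1 , 0 , false) ∷ [])) j j′)))
      (sym (bit-⊞ Z (consequence sat (Z · Z ≐ e) ((0 , 2 , 0 , false) ∷ [])) k k′))) (sym (bit-⊞ W (consequence sat (W · W ≐ e) ((0 , 3 , 0 , false) ∷ [])) l l′)))
    (elements-consequence {R = D · Y ≐ Y · D ∷ D · Z ≐ Z · D ∷ D · W ≐ W · D ∷ F · Z ≐ Z · F ∷ F · W ≐ W · F ∷ J · W ≐ W · J ∷ []} (cube-commute Y xy i′ j ∷ cube-commute Z xz i′ k ∷ cube-commute W xw i′ l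
      ∷ bit-commute Y Z yz j′ k ∷ bit-commute Y W yw j′ l ∷ bit-commute Z W zw k′ l ∷ []) ((X · D) · (Y · F) · (Z · J) · (W · L) ≐ X · Y · Z · W · (D · F · J · L)) ((5 , 5 , 0 , false) ∷ (7 , 2 , 2 , false) ∷ (5 , 4 , 1 , false) ∷ (3 , 3 , 0 , false) ∷ (3 , 1 , 1 , false) ∷ (1 , 0 , 0 , false) ∷ []))
    where
    open Elements (⟦ cube i ⟧ ∷ ⟦ bit Y j ⟧ ∷ ⟦ bit Z k ⟧ ∷ ⟦ bit W l ⟧ ∷ ⟦ cube i′ ⟧ ∷ ⟦ bit Y j′ ⟧ ∷ ⟦ bit Z k′ ⟧ ∷ ⟦ bit W l′ ⟧ ∷ [])
    xy = consequence sat (X · Y ≐ Y · X) ((0 , 4 , 0 , false) ∷ [])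
    xz = consequence sat (X · Z ≐ Z · X) ((0 , 5 , 0 , false) ∷ [])
    xw = consequence sat (X · W ≐ W · X) ((0 , 6 , 0 , false) ∷ [])
    yz = consequence sat (Y · Z ≐ Z · Y) ((0 , 7 , 0 , false) ∷ [])
    yw = consequence sat (Y · W ≐ W · Y) ((0 , 8 , 0 , false) ∷ [])
    zw = consequence sat (Z · W ≐ W · Z) ((0 , 9 , 0 , false) ∷ [])

  value-zero₂₄ : value₂₄ zero₂₄ ≡ ε
  value-zero₂₄ = free-identity (normalWord₂₄ zero₂₄ ≐ e)

  value-⊟ : ∀ n → value₂₄ (⊟ n) ≡ value₂₄ n ⁻¹
  value-⊟ n@(i , v) = inverseˡ-unique _ _ (trans (sym (value-⊞₃ (⊟ n) n))
    (trans (cong value₂₄ (cong₂ _,_ (negate-⊹ i) (⊞-self v))) value-zero₂₄))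

  generator₂₄ : Fin 4 → Normal₂₄
  generator₂₄ 0F = 1F , o ∷ o ∷ o ∷ []
  generator₂₄ 1F = 0F , ı ∷ o ∷ o ∷ []
  generator₂₄ 2F = 0F , o ∷ ı ∷ o ∷ []
  generator₂₄ 3F = 0F , o ∷ o ∷ ı ∷ []

  value-generator₂₄ : ∀ i → value₂₄ (generator₂₄ i) ≡ b i
  value-generator₂₄ 0F = free-identity (normalWord₂₄ (generator₂₄ 0F) ≐ X)
  value-generator₂₄ 1F = free-identity (normalWord₂₄ (generator₂₄ 1F) ≐ Y)
  value-generator₂₄ 2F = free-identity (normalWord₂₄ (generator₂₄ 2F) ≐ Z)
  value-generator₂₄ 3F = free-identity (normalWord₂₄ (generator₂₄ 3F) ≐ W)

  value₂₄-⟨⟩ : ∀ {g} → ⟨_⟩ H b g → ∃ λ n → value₂₄ n ≡ g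
  value₂₄-⟨⟩ (gen i) = generator₂₄ i , value-generator₂₄ i
  value₂₄-⟨⟩ one     = zero₂₄ , value-zero₂₄
  value₂₄-⟨⟩ (mul p q) with value₂₄-⟨⟩ p | value₂₄-⟨⟩ q
  ... | n , refl | m , refl = n ⊞₃ m , value-⊞₃ n m
  value₂₄-⟨⟩ (inv p) with value₂₄-⟨⟩ p
  ... | n , refl = ⊟ n , value-⊟ n

-- Normal forms add componentwise, so the difference of two is again one, and a trivial kernel makes
-- them unique. A homomorphism can then be read off the normal form.
presentation₂₄ : ∀ G (b : Fin 4 → Carrier G) → Generates G b → (sat : Satisfies G b relC3C2C2C2) →
  (∀ n → Group₂₄.value₂₄ G b sat n ≡ FinGroup.ε G → n ≡ zero₂₄) → IsPresentedBy G 4 relC3C2C2C2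
presentation₂₄ G b gn sat kernel = b , gn , sat , λ H c satH → Universal.hom H c satH , Universal.isHom H c satH , Universal.hom-generator H c satH
  where
  module Q = Group₂₄ G b sat
  open GroupOf G
  open ≡-Reasoning

  normal-form : ∀ g → ∃ λ n → Q.value₂₄ n ≡ g
  normal-form g = Q.value₂₄-⟨⟩ (gn g)

  injective : ∀ n m → Q.value₂₄ n ≡ Q.value₂₄ m → n ≡ m
  injective n@(i , v) m@(j , w) eq = cong₂ _,_ (negate-⊹-zero i j (cong proj₁ eq′)) (⊞-zero v w (cong proj₂ eq′))
    where
    eq′ : (⊟ n) ⊞₃ m ≡ zero₂₄
    eq′ = kernel ((⊟ n) ⊞₃ m) (begin
      Q.value₂₄ ((⊟ n) ⊞₃ m)              ≡⟨ Q.value-⊞₃ (⊟ n) m ⟩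
      Q.value₂₄ (⊟ n) ∙ Q.value₂₄ m       ≡⟨ cong₂ _∙_ (Q.value-⊟ n) (sym eq) ⟩
      Q.value₂₄ n ⁻¹ ∙ Q.value₂₄ n        ≡⟨ inverseˡ _ ⟩
      ε                                   ∎)

  module Universal (H : FinGroup) (c : Fin 4 → Carrier H) (satH : Satisfies H c relC3C2C2C2) where
    module R = Group₂₄ H c satH

    hom : Carrier G → Carrier H
    hom g = R.value₂₄ (proj₁ (normal-form g))

    hom-value : ∀ n → hom (Q.value₂₄ n) ≡ R.value₂₄ n
    hom-value n = cong R.value₂₄ {proj₁ (normal-form (Q.value₂₄ n))} {n} (injective _ n (proj₂ (normal-form (Q.value₂₄ n))))

    isHom : IsHom G H hom
    isHom g h = begin
      hom (g ∙ h)                    ≡⟨ cong hom (sym (trans (Q.value-⊞₃ n m) (cong₂ _∙_ (proj₂ (normal-form g)) (proj₂ (normal-form h))))) ⟩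
      hom (Q.value₂₄ (n ⊞₃ m))       ≡⟨ hom-value (n ⊞₃ m) ⟩
      R.value₂₄ (n ⊞₃ m)             ≡⟨ R.value-⊞₃ n m ⟩
      FinGroup._∙_ H (hom g) (hom h) ∎
      where
      n = proj₁ (normal-form g)
      m = proj₁ (normal-form h)

    hom-generator : ∀ i → hom (b i) ≡ c i
    hom-generator i = trans (cong hom (sym (Q.value-generator₂₄ i))) (trans (hom-value (Q.generator₂₄ i)) (R.value-generator₂₄ i))

relC₆C₂C₂ : List (Relation 3)
relC₆C₂C₂ = X · X · X · X · X · X ≐ e ∷ Y · Y ≐ e ∷ Z · Z ≐ e ∷ X · Y ≐ Y · X ∷ X · Z ≐ Z · X ∷ Y · Z ≐ Z · Y ∷ []

-- C₆ = C₃ × C₂ with generators x⁴ and x³.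
exceptionalC₆C₂C₂ : ∀ G → NotGeneratedByTwo G → (a : Fin 3 → Carrier G) → Generates G a → Satisfies G a relC₆C₂C₂ →
  eval G a (X · X) ≢ FinGroup.ε G → eval G a (X · X · X) ≢ FinGroup.ε G → Exceptional G
exceptionalC₆C₂C₂ G rank a gn sat x²≢ε x³≢ε = inj₂ (inj₁ (presentation₂₄ G b gn₄ sat₄ kernel))
  where
  open GroupOf G
  open Eval G a
  open Generation G
  open Independence G rank a gn

  u : Fin 4 → Word 3
  u = lookup (X · X · X · X ∷ X · X · X ∷ Y ∷ Z ∷ [])

  b : Fin 4 → C
  b i = ⟦ u i ⟧

  gn₄ : Generates G b
  gn₄ = change-generators gn u (lookup (X · Y ⁻ ∷ Z ∷ W ∷ []))

  sat₄ : Satisfies G b relC3C2C2C2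
  sat₄ = consequence sat ((X · X · X · X) · ((X · X · X · X) · ((X · X · X · X) · (e))) ≐ e) ((0 , 0 , 0 , false) ∷ (0 , 0 , 0 , false) ∷ [])
    ∷ consequence sat ((X · X · X) · ((X · X · X) · (e)) ≐ e) ((0 , 0 , 0 , false) ∷ [])
    ∷ consequence sat (Y · (Y · (e)) ≐ e) ((0 , 1 , 0 , false) ∷ [])
    ∷ consequence sat (Z · (Z · (e)) ≐ e) ((0 , 2 , 0 , false) ∷ [])
    ∷ consequence sat ((X · X · X · X) · (X · X · X) ≐ (X · X · X) · (X · X · X · X)) []
    ∷ consequence sat ((X · X · X · X) · Y ≐ Y · (X · X · X · X)) ((5 , 0 , 0 , true) ∷ (0 , 0 , 0 , false) ∷ (1 , 3 , 1 , true) ∷ (0 , 3 , 1 , true) ∷ [])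
    ∷ consequence sat ((X · X · X · X) · Z ≐ Z · (X · X · X · X)) ((5 , 0 , 0 , true) ∷ (0 , 0 , 0 , false) ∷ (1 , 4 , 1 , true) ∷ (0 , 4 , 1 , true) ∷ [])
    ∷ consequence sat ((X · X · X) · Y ≐ Y · (X · X · X)) ((2 , 3 , 0 , false) ∷ (1 , 3 , 0 , false) ∷ (0 , 3 , 0 , false) ∷ [])
    ∷ consequence sat ((X · X · X) · Z ≐ Z · (X · X · X)) ((2 , 4 , 0 , false) ∷ (1 , 4 , 0 , false) ∷ (0 , 4 , 0 , false) ∷ [])
    ∷ consequence sat (Y · Z ≐ Z · Y) ((0 , 5 , 0 , false) ∷ []) ∷ []

  -- Modulo `x⁶` a nonzero normal form either contains `y` or `z` exactly once or is a power of `x`;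
  -- the latter are excluded by independence of `x` and by the assumptions on `x²` and `x³`.
  kernel : ∀ n → Group₂₄.value₂₄ G b sat₄ n ≡ ε → n ≡ zero₂₄
  kernel (0F , ı ∷ ı ∷ ı ∷ []) p = contradiction (consequence {R = substitute u (normalWord₂₄ (0F , ı ∷ ı ∷ ı ∷ [])) ≐ e ∷ relC₆C₂C₂} (p ∷ sat) (X · X · X · Y · Z ≐ e) ((0 , 0 , 0 , false) ∷ [])) (primitive-≢ (X · X · X · Y · Z ≐ e))
  kernel (0F , ı ∷ ı ∷ o ∷ []) p = contradiction (consequence {R = substitute u (normalWord₂₄ (0F , ı ∷ ı ∷ o ∷ [])) ≐ e ∷ relC₆C₂C₂} (p ∷ sat) (X · X · X · Y ≐ e) ((0 , 0 , 0 , false) ∷ [])) (primitive-≢ (X · X · X · Y ≐ e))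
  kernel (0F , ı ∷ o ∷ ı ∷ []) p = contradiction (consequence {R = substitute u (normalWord₂₄ (0F , ı ∷ o ∷ ı ∷ [])) ≐ e ∷ relC₆C₂C₂} (p ∷ sat) (X · X · X · Z ≐ e) ((0 , 0 , 0 , false) ∷ [])) (primitive-≢ (X · X · X · Z ≐ e))
  kernel (0F , ı ∷ o ∷ o ∷ []) p = contradiction (consequence {R = substitute u (normalWord₂₄ (0F , ı ∷ o ∷ o ∷ [])) ≐ e ∷ relC₆C₂C₂} (p ∷ sat) (X · X · X ≐ e) ((0 , 0 , 0 , false) ∷ [])) (x³≢ε)
  kernel (0F , o ∷ ı ∷ ı ∷ []) p = contradiction (consequence {R = substitute u (normalWord₂₄ (0F , o ∷ ı ∷ ı ∷ [])) ≐ e ∷ relC₆C₂C₂} (p ∷ sat) (Y · Z ≐ e) ((0 , 0 , 0 , false) ∷ [])) (primitive-≢ (Y · Z ≐ e))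
  kernel (0F , o ∷ ı ∷ o ∷ []) p = contradiction (consequence {R = substitute u (normalWord₂₄ (0F , o ∷ ı ∷ o ∷ [])) ≐ e ∷ relC₆C₂C₂} (p ∷ sat) (Y ≐ e) ((0 , 0 , 0 , false) ∷ [])) (primitive-≢ (Y ≐ e))
  kernel (0F , o ∷ o ∷ ı ∷ []) p = contradiction (consequence {R = substitute u (normalWord₂₄ (0F , o ∷ o ∷ ı ∷ [])) ≐ e ∷ relC₆C₂C₂} (p ∷ sat) (Z ≐ e) ((0 , 0 , 0 , false) ∷ [])) (primitive-≢ (Z ≐ e))
  kernel (0F , o ∷ o ∷ o ∷ []) _ = refl
  kernel (1F , ı ∷ ı ∷ ı ∷ []) p = contradiction (consequence {R = substitute u (normalWord₂₄ (1F , ı ∷ ı ∷ ı ∷ [])) ≐ e ∷ relC₆C₂C₂} (p ∷ sat) (X · Y · Z ≐ e) ((0 , 0 , 6 , false) ∷ (0 , 1 , 0 , true) ∷ [])) (primitive-≢ (X · Y · Z ≐ e))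
  kernel (1F , ı ∷ ı ∷ o ∷ []) p = contradiction (consequence {R = substitute u (normalWord₂₄ (1F , ı ∷ ı ∷ o ∷ [])) ≐ e ∷ relC₆C₂C₂} (p ∷ sat) (X · Y ≐ e) ((0 , 0 , 6 , false) ∷ (0 , 1 , 0 , true) ∷ [])) (primitive-≢ (X · Y ≐ e))
  kernel (1F , ı ∷ o ∷ ı ∷ []) p = contradiction (consequence {R = substitute u (normalWord₂₄ (1F , ı ∷ o ∷ ı ∷ [])) ≐ e ∷ relC₆C₂C₂} (p ∷ sat) (X · Z ≐ e) ((0 , 0 , 6 , false) ∷ (0 , 1 , 0 , true) ∷ [])) (primitive-≢ (X · Z ≐ e))
  kernel (1F , ı ∷ o ∷ o ∷ []) p = contradiction (consequence {R = substitute u (normalWord₂₄ (1F , ı ∷ o ∷ o ∷ [])) ≐ e ∷ relC₆C₂C₂} (p ∷ sat) (X ≐ e) ((0 , 0 , 0 , false) ∷ (0 , 1 , 0 , true) ∷ [])) (primitive-≢ (X ≐ e))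
  kernel (1F , o ∷ ı ∷ ı ∷ []) p = contradiction (consequence {R = substitute u (normalWord₂₄ (1F , o ∷ ı ∷ ı ∷ [])) ≐ e ∷ relC₆C₂C₂} (p ∷ sat) (X ⁻ · X ⁻ · Y · Z ≐ e) ((0 , 1 , 0 , true) ∷ (0 , 0 , 0 , false) ∷ [])) (primitive-≢ (X ⁻ · X ⁻ · Y · Z ≐ e))
  kernel (1F , o ∷ ı ∷ o ∷ []) p = contradiction (consequence {R = substitute u (normalWord₂₄ (1F , o ∷ ı ∷ o ∷ [])) ≐ e ∷ relC₆C₂C₂} (p ∷ sat) (X ⁻ · X ⁻ · Y ≐ e) ((0 , 1 , 0 , true) ∷ (0 , 0 , 0 , false) ∷ [])) (primitive-≢ (X ⁻ · X ⁻ · Y ≐ e))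
  kernel (1F , o ∷ o ∷ ı ∷ []) p = contradiction (consequence {R = substitute u (normalWord₂₄ (1F , o ∷ o ∷ ı ∷ [])) ≐ e ∷ relC₆C₂C₂} (p ∷ sat) (X ⁻ · X ⁻ · Z ≐ e) ((0 , 1 , 0 , true) ∷ (0 , 0 , 0 , false) ∷ [])) (primitive-≢ (X ⁻ · X ⁻ · Z ≐ e))
  kernel (1F , o ∷ o ∷ o ∷ []) p = contradiction (consequence {R = substitute u (normalWord₂₄ (1F , o ∷ o ∷ o ∷ [])) ≐ e ∷ relC₆C₂C₂} (p ∷ sat) (X · X ≐ e) ((0 , 1 , 0 , false) ∷ (0 , 0 , 0 , true) ∷ [])) (x²≢ε)
  kernel (2F , ı ∷ ı ∷ ı ∷ []) p = contradiction (consequence {R = substitute u (normalWord₂₄ (2F , ı ∷ ı ∷ ı ∷ [])) ≐ e ∷ relC₆C₂C₂} (p ∷ sat) (X ⁻ · Y · Z ≐ e) ((0 , 1 , 0 , true) ∷ (0 , 0 , 6 , false) ∷ (0 , 1 , 0 , true) ∷ [])) (primitive-≢ (X ⁻ · Y · Z ≐ e))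
  kernel (2F , ı ∷ ı ∷ o ∷ []) p = contradiction (consequence {R = substitute u (normalWord₂₄ (2F , ı ∷ ı ∷ o ∷ [])) ≐ e ∷ relC₆C₂C₂} (p ∷ sat) (X ⁻ · Y ≐ e) ((0 , 1 , 0 , true) ∷ (0 , 0 , 6 , false) ∷ (0 , 1 , 0 , true) ∷ [])) (primitive-≢ (X ⁻ · Y ≐ e))
  kernel (2F , ı ∷ o ∷ ı ∷ []) p = contradiction (consequence {R = substitute u (normalWord₂₄ (2F , ı ∷ o ∷ ı ∷ [])) ≐ e ∷ relC₆C₂C₂} (p ∷ sat) (X ⁻ · Z ≐ e) ((0 , 1 , 0 , true) ∷ (0 , 0 , 6 , false) ∷ (0 , 1 , 0 , true) ∷ [])) (primitive-≢ (X ⁻ · Z ≐ e))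
  kernel (2F , ı ∷ o ∷ o ∷ []) p = contradiction (consequence {R = substitute u (normalWord₂₄ (2F , ı ∷ o ∷ o ∷ [])) ≐ e ∷ relC₆C₂C₂} (p ∷ sat) (X ⁻ ≐ e) ((0 , 1 , 0 , true) ∷ (0 , 0 , 0 , false) ∷ (0 , 1 , 0 , true) ∷ [])) (primitive-≢ (X ⁻ ≐ e))
  kernel (2F , o ∷ ı ∷ ı ∷ []) p = contradiction (consequence {R = substitute u (normalWord₂₄ (2F , o ∷ ı ∷ ı ∷ [])) ≐ e ∷ relC₆C₂C₂} (p ∷ sat) (X · X · Y · Z ≐ e) ((0 , 0 , 6 , false) ∷ (0 , 1 , 0 , true) ∷ [])) (primitive-≢ (X · X · Y · Z ≐ e))
  kernel (2F , o ∷ ı ∷ o ∷ []) p = contradiction (consequence {R = substitute u (normalWord₂₄ (2F , o ∷ ı ∷ o ∷ [])) ≐ e ∷ relC₆C₂C₂} (p ∷ sat) (X · X · Y ≐ e) ((0 , 0 , 6 , false) ∷ (0 , 1 , 0 , true) ∷ [])) (primitive-≢ (X · X · Y ≐ e))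
  kernel (2F , o ∷ o ∷ ı ∷ []) p = contradiction (consequence {R = substitute u (normalWord₂₄ (2F , o ∷ o ∷ ı ∷ [])) ≐ e ∷ relC₆C₂C₂} (p ∷ sat) (X · X · Z ≐ e) ((0 , 0 , 6 , false) ∷ (0 , 1 , 0 , true) ∷ [])) (primitive-≢ (X · X · Z ≐ e))
  kernel (2F , o ∷ o ∷ o ∷ []) p = contradiction (consequence {R = substitute u (normalWord₂₄ (2F , o ∷ o ∷ o ∷ [])) ≐ e ∷ relC₆C₂C₂} (p ∷ sat) (X · X ≐ e) ((0 , 0 , 0 , false) ∷ (0 , 1 , 0 , true) ∷ [])) (x²≢ε)

-- Completing the abelian case

module Main (G : FinGroup) (rank : NotGeneratedByTwo G) where
  open GroupOf G
  open Generation G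
  open Pairs G
  open Cases G rank

  module Abelian (a : Fin 3 → C) (gn : Generates G a) (ni : NonInvolutions a)
    (xy : Commuting (a 0F) (a 1F)) (yz : Commuting (a 1F) (a 2F)) (xz : Commuting (a 0F) (a 2F)) where
    open Eval G a

    -- Beside the involutions `y′` and `z′`, an `x` of order 4 or 6 gives an exceptional group. For
    -- any other order the progression is run with `x`, `xy′` and `xz′`: its critical words
    -- `x²(xy′)²` and `x⁴(xy′)²` are `x⁴` and `x⁶`.
    split : ⟦ X · X · X ⟧ ≢ ε → ∀ y′ z′ → (gn′ : Generates G (triple a X y′ z′)) →
      ⟦ y′ · y′ ⟧ ≡ ε → ⟦ z′ · z′ ⟧ ≡ ε → ⟦ X · y′ ⟧ ≡ ⟦ y′ · X ⟧ → ⟦ X · z′ ⟧ ≡ ⟦ z′ · X ⟧ → ⟦ y′ · z′ ⟧ ≡ ⟦ z′ · y′ ⟧ →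
      HasORR G ⊎ Exceptional G
    split x³≢ε y′ z′ gn′ y² z² xy xz yz with ⟦ X · X · X · X ⟧ ≟ ε | ⟦ X · X · X · X · X · X ⟧ ≟ ε
    ... | yes x⁴ | _ = inj₂ (exceptionalC₄C₂C₂ G rank a′ gn′ (Eval.consequences G a′
          {R = X · X · X · X ≐ e ∷ Y · Y ≐ e ∷ Z · Z ≐ e ∷ X · Y ≐ Y · X ∷ X · Z ≐ Z · X ∷ Y · Z ≐ Z · Y ∷ []}
          (x⁴ ∷ y² ∷ z² ∷ xy ∷ xz ∷ yz ∷ []) relC4C2C2 (((0 , 0 , 0 , false) ∷ []) ∷ ((0 , 1 , 0 , false) ∷ []) ∷ ((0 , 2 , 0 , false) ∷ []) ∷ ((0 , 3 , 0 , false) ∷ []) ∷ ((0 , 4 , 0 , false) ∷ []) ∷ ((0 , 5 , 0 , false) ∷ []) ∷ [])) (ni 0F))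
      where a′ = triple a X y′ z′
    ... | no _ | yes x⁶ = inj₂ (exceptionalC₆C₂C₂ G rank (triple a X y′ z′) gn′ (x⁶ ∷ y² ∷ z² ∷ xy ∷ xz ∷ yz ∷ []) (ni 0F) x³≢ε)
    ... | no x⁴≢ε | no x⁶≢ε = inj₁ (Arithmetic.hasORR G rank (λ i → eval G a′ (u i))
          (change-generators gn′ u (lookup (X ∷ X ⁻ · Y ∷ X ⁻ · Z ∷ [])))
          (from (X · (X · Y) ≐ X · Y · X) ((1 , 2 , 0 , false) ∷ []))
          (ni 0F) x³≢ε
          (λ p → ni 0F (from′ (X · Y · (X · Y)) p (X · X ≐ e) ((1 , 3 , 0 , false) ∷ (0 , 0 , 0 , false) ∷ (0 , 1 , 0 , true) ∷ [])))
          (λ p → x⁴≢ε (from′ (X · X · (X · Y) · (X · Y)) p (X · X · X · X ≐ e) ((1 , 0 , 0 , false) ∷ (0 , 3 , 3 , true) ∷ (0 , 1 , 0 , true) ∷ [])))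
          (λ p → x⁶≢ε (from′ (X · X · X · X · (X · Y) · (X · Y)) p (X · X · X · X · X · X ≐ e) ((1 , 0 , 0 , false) ∷ (0 , 3 , 3 , true) ∷ (0 , 1 , 0 , true) ∷ [])))
          (λ p → ni 0F (from′ (X · Z · (X · Z)) p (X · X ≐ e) ((1 , 4 , 0 , false) ∷ (0 , 0 , 0 , false) ∷ (0 , 2 , 0 , true) ∷ []))))
      where
      a′ = triple a X y′ z′
      u : Fin 3 → Word 3
      u = lookup (X ∷ X · Y ∷ X · Z ∷ [])
      relations : List (Relation 3)
      relations = Y · Y ≐ e ∷ Z · Z ≐ e ∷ X · Y ≐ Y · X ∷ X · Z ≐ Z · X ∷ Y · Z ≐ Z · Y ∷ []
      sat : Satisfies G a′ relations
      sat = y² ∷ z² ∷ xy ∷ xz ∷ yz ∷ []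
      from : ∀ (r : Relation 3) ss → {_ : T (derives relations r ss)} → eval G a′ (proj₁ r) ≡ eval G a′ (proj₂ r)
      from r ss {t} = Eval.consequence G a′ {R = relations} sat r ss {t}
      from′ : ∀ v → eval G a′ v ≡ ε → ∀ (r : Relation 3) ss → {_ : T (derives (v ≐ e ∷ relations) r ss)} → eval G a′ (proj₁ r) ≡ eval G a′ (proj₂ r)
      from′ v p r ss {t} = Eval.consequence G a′ {R = v ≐ e ∷ relations} (p ∷ sat) r ss {t}

    -- The obstruction to a progression: `x²u²` or `x⁴u²` vanishes, that is, `xu` or `x²u` has
    -- trivial square. The Boolean tells which.
    Halving : Word 3 → Set
    Halving u = ∃ λ i → ⟦ bit X i · X · u · (bit X i · X · u) ⟧ ≡ ε

    halving : ∀ u → ⟦ X · u ⟧ ≡ ⟦ u · X ⟧ → Halving u ⊎ (⟦ X · X · u · u ⟧ ≢ ε × ⟦ X · X · X · X · u · u ⟧ ≢ ε)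
    halving u c with ⟦ X · X · u · u ⟧ ≟ ε | ⟦ X · X · X · X · u · u ⟧ ≟ ε
    ... | yes p | _ = inj₁ (false , (elements-consequence {R = X · Y ≐ Y · X ∷ X · X · Y · Y ≐ e ∷ []} (c ∷ p ∷ []) (e · X · Y · (e · X · Y) ≐ e) ((1 , 0 , 0 , true) ∷ (0 , 1 , 0 , false) ∷ [])))
      where open Eval G (lookup (⟦ X ⟧ ∷ ⟦ u ⟧ ∷ [])) using () renaming (consequence to elements-consequence)
    ... | no _ | yes p = inj₁ (true , (elements-consequence {R = X · Y ≐ Y · X ∷ X · X · X · X · Y · Y ≐ e ∷ []} (c ∷ p ∷ []) (X · X · Y · (X · X · Y) ≐ e) ((2 , 0 , 0 , true) ∷ (0 , 1 , 1 , false) ∷ (0 , 0 , 2 , false) ∷ [])))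
      where open Eval G (lookup (⟦ X ⟧ ∷ ⟦ u ⟧ ∷ [])) using () renaming (consequence to elements-consequence)
    ... | no p | no q = inj₂ (p , q)

    -- Either `y` or `z` can start a progression with difference `x`, or both can be multiplied by
    -- `x` or `x²` to become involutions, which is the situation of `split`.
    orr-or-exceptional : ⟦ X · X · X ⟧ ≢ ε → HasORR G ⊎ Exceptional G
    orr-or-exceptional x³≢ε with halving Y xy | halving Z xz
    ... | inj₂ (p , q) | _ = inj₁ (Arithmetic.hasORR G rank a gn xy (ni 0F) x³≢ε (ni 1F) p q (ni 2F))
    ... | inj₁ _ | inj₂ (p , q) = inj₁ (Arithmetic.hasORR G rank (triple a X Z Y) (change-generators gn (lookup (X ∷ Z ∷ Y ∷ [])) (lookup (X ∷ Z ∷ Y ∷ []))) xz (ni 0F) x³≢ε (ni 2F) p q (ni 1F))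
    ... | inj₁ (i , p) | inj₁ (j , q) = go i j p q
      where
      relations : List (Relation 3)
      relations = X · Y ≐ Y · X ∷ X · Z ≐ Z · X ∷ Y · Z ≐ Z · Y ∷ []
      sat : Satisfies G a relations
      sat = xy ∷ xz ∷ yz ∷ []
      go : ∀ i j → ⟦ bit X i · X · Y · (bit X i · X · Y) ⟧ ≡ ε → ⟦ bit X j · X · Z · (bit X j · X · Z) ⟧ ≡ ε → HasORR G ⊎ Exceptional G
      go true  true  p q = split x³≢ε (X · X · Y) (X · X · Z)
        (change-generators gn (lookup (X ∷ X · X · Y ∷ X · X · Z ∷ [])) (lookup (X ∷ X ⁻ · X ⁻ · Y ∷ X ⁻ · X ⁻ · Z ∷ []))) p q
        (consequence {R = relations} sat (X · (X · X · Y) ≐ X · X · Y · X) ((2 , 0 , 0 , false) ∷ []))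
        (consequence {R = relations} sat (X · (X · X · Z) ≐ X · X · Z · X) ((2 , 1 , 0 , false) ∷ []))
        (consequence {R = relations} sat (X · X · Y · (X · X · Z) ≐ X · X · Z · (X · X · Y)) ((6 , 0 , 2 , true) ∷ (4 , 1 , 0 , false) ∷ (2 , 0 , 0 , true) ∷ (3 , 2 , 0 , false) ∷ (2 , 1 , 0 , false) ∷ []))
      go true  false p q = split x³≢ε (X · X · Y) (e · X · Z)
        (change-generators gn (lookup (X ∷ X · X · Y ∷ e · X · Z ∷ [])) (lookup (X ∷ X ⁻ · X ⁻ · Y ∷ X ⁻ · Z ∷ []))) p q
        (consequence {R = relations} sat (X · (X · X · Y) ≐ X · X · Y · X) ((2 , 0 , 0 , false) ∷ []))
        (consequence {R = relations} sat (X · (e · X · Z) ≐ e · X · Z · X) ((1 , 1 , 0 , false) ∷ []))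
        (consequence {R = relations} sat (X · X · Y · (e · X · Z) ≐ e · X · Z · (X · X · Y)) ((2 , 0 , 0 , true) ∷ (3 , 2 , 0 , false) ∷ (2 , 1 , 0 , false) ∷ (1 , 1 , 0 , false) ∷ []))
      go false true  p q = split x³≢ε (e · X · Y) (X · X · Z)
        (change-generators gn (lookup (X ∷ e · X · Y ∷ X · X · Z ∷ [])) (lookup (X ∷ X ⁻ · Y ∷ X ⁻ · X ⁻ · Z ∷ []))) p q
        (consequence {R = relations} sat (X · (e · X · Y) ≐ e · X · Y · X) ((1 , 0 , 0 , false) ∷ []))
        (consequence {R = relations} sat (X · (X · X · Z) ≐ X · X · Z · X) ((2 , 1 , 0 , false) ∷ []))
        (consequence {R = relations} sat (e · X · Y · (X · X · Z) ≐ X · X · Z · (e · X · Y)) ((5 , 0 , 2 , true) ∷ (3 , 1 , 0 , false) ∷ (3 , 2 , 1 , false) ∷ (1 , 0 , 0 , true) ∷ []))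
      go false false p q = split x³≢ε (e · X · Y) (e · X · Z)
        (change-generators gn (lookup (X ∷ e · X · Y ∷ e · X · Z ∷ [])) (lookup (X ∷ X ⁻ · Y ∷ X ⁻ · Z ∷ []))) p q
        (consequence {R = relations} sat (X · (e · X · Y) ≐ e · X · Y · X) ((1 , 0 , 0 , false) ∷ []))
        (consequence {R = relations} sat (X · (e · X · Z) ≐ e · X · Z · X) ((1 , 1 , 0 , false) ∷ []))
        (consequence {R = relations} sat (e · X · Y · (e · X · Z) ≐ e · X · Z · (e · X · Y)) ((1 , 0 , 0 , true) ∷ (2 , 2 , 0 , false) ∷ (1 , 1 , 0 , false) ∷ []))

  -- A generator with nontrivial cube can serve as the difference of a progression. If there is
  -- none, all three generators have order 3.
  caseCCC : ∀ a → Generates G a → NonInvolutions a →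
            Commuting (a 0F) (a 1F) → Commuting (a 1F) (a 2F) → Commuting (a 0F) (a 2F) → HasORR G ⊎ Exceptional G
  caseCCC a gn ni xy yz xz with eval G a (X · X · X) ≟ ε | eval G a (Y · Y · Y) ≟ ε | eval G a (Z · Z · Z) ≟ ε
  ... | no x³≢ε | _ | _ = Abelian.orr-or-exceptional a gn ni xy yz xz x³≢ε
  ... | yes _ | no y³≢ε | _ = Abelian.orr-or-exceptional (triple a Y X Z) (change-generators gn (lookup (Y ∷ X ∷ Z ∷ [])) (lookup (Y ∷ X ∷ Z ∷ []))) (noninvolutions (ni 1F) (ni 0F) (ni 2F)) (sym xy) xz yz y³≢ε
  ... | yes _ | yes _ | no z³≢ε = Abelian.orr-or-exceptional (triple a Z Y X) (change-generators gn (lookup (Z ∷ Y ∷ X ∷ [])) (lookup (Z ∷ Y ∷ X ∷ []))) (noninvolutions (ni 2F) (ni 1F) (ni 0F)) (sym yz) (sym xy) (sym xz) z³≢ε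
  ... | yes x³ | yes y³ | yes z³ = inj₁ (ElementaryAbelian27.hasORR G rank a gn (x³ ∷ y³ ∷ z³ ∷ xy ∷ xz ∷ yz ∷ []))

  noninvolutory : ∀ a → Generates G a → NonInvolutions a → Outcome G
  noninvolutory a gn ni = inj₂ (Dispatch.orr-or-exceptional caseCCC a gn ni)

  -- Removing involutions from the generating triple

  module Involutory (a : Fin 3 → C) (gn : Generates G a) where
    open Eval G a

    -- The involution `z` may be traded for `zx`, `zy` or `zxy`. If all of these are involutions,
    -- `z` inverts `x`, `y` and `xy`, and inverting all three forces `x` and `y` to commute.
    oneInvolution : ⟦ X · X ⟧ ≢ ε → ⟦ Y · Y ⟧ ≢ ε → ⟦ Z · Z ⟧ ≡ ε → Outcome G
    oneInvolution x² y² z² with ⟦ Z · X · (Z · X) ⟧ ≟ ε | ⟦ Z · Y · (Z · Y) ⟧ ≟ ε | ⟦ Z · X · Y · (Z · X · Y) ⟧ ≟ ε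
    ... | no n | _ | _ = noninvolutory (triple a X Y (Z · X)) (change-generators gn (lookup (X ∷ Y ∷ Z · X ∷ [])) (lookup (X ∷ Y ∷ Z · X ⁻ ∷ []))) (noninvolutions x² y² n)
    ... | yes _ | no n | _ = noninvolutory (triple a X Y (Z · Y)) (change-generators gn (lookup (X ∷ Y ∷ Z · Y ∷ [])) (lookup (X ∷ Y ∷ Z · Y ⁻ ∷ []))) (noninvolutions x² y² n)
    ... | yes _ | yes _ | no n = noninvolutory (triple a X Y (Z · X · Y)) (change-generators gn (lookup (X ∷ Y ∷ Z · X · Y ∷ [])) (lookup (X ∷ Y ∷ Z · Y ⁻ · X ⁻ ∷ []))) (noninvolutions x² y² n)
    ... | yes p | yes q | yes r = inj₁ (inverted-abelian G a gn rank
            (consequences {R = Z · Z ≐ e ∷ Z · X · (Z · X) ≐ e ∷ Z · Y · (Z · Y) ≐ e ∷ Z · X · Y · (Z · X · Y) ≐ e ∷ []}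
              (z² ∷ p ∷ q ∷ r ∷ []) _ (((2 , 1 , 0 , true) ∷ (0 , 3 , 1 , false) ∷ (0 , 2 , 1 , true) ∷ (1 , 0 , 0 , false) ∷ []) ∷ ((0 , 0 , 0 , false) ∷ []) ∷ ((0 , 1 , 0 , false) ∷ []) ∷ ((0 , 2 , 0 , false) ∷ []) ∷ [])))

  open Involutory using (oneInvolution)

  module Involutory₂ (a : Fin 3 → C) (gn : Generates G a) where
    open Eval G a

    -- If no product of two generators removes an involution, `y` and `z` commute and both invert
    -- `x`. Then `yz` commutes with `x`, and `z` inverts the abelian group `⟨x, yz⟩`.
    twoInvolutions : ⟦ X · X ⟧ ≢ ε → ⟦ Y · Y ⟧ ≡ ε → ⟦ Z · Z ⟧ ≡ ε → Outcome G
    twoInvolutions x² y² z² with ⟦ X · Y · (X · Y) ⟧ ≟ ε | ⟦ X · Z · (X · Z) ⟧ ≟ ε | ⟦ Y · Z · (Y · Z) ⟧ ≟ ε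
    ... | no n | _ | _ = oneInvolution (triple a X (X · Y) Z) (change-generators gn (lookup (X ∷ X · Y ∷ Z ∷ [])) (lookup (X ∷ X ⁻ · Y ∷ Z ∷ []))) x² n z²
    ... | yes _ | no n | _ = oneInvolution (triple a X (X · Z) Y) (change-generators gn (lookup (X ∷ X · Z ∷ Y ∷ [])) (lookup (X ∷ Z ∷ X ⁻ · Y ∷ []))) x² n y²
    ... | yes _ | yes _ | no n = oneInvolution (triple a X (Y · Z) Z) (change-generators gn (lookup (X ∷ Y · Z ∷ Z ∷ [])) (lookup (X ∷ Y · Z ⁻ ∷ Z ∷ []))) x² n z²
    ... | yes p | yes q | yes r = inj₁ (inverted-abelian G (triple a X (Y · Z) Z) (change-generators gn (lookup (X ∷ Y · Z ∷ Z ∷ [])) (lookup (X ∷ Y · Z ⁻ ∷ Z ∷ []))) rank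
            (Eval.consequences G (triple a X (Y · Z) Z) {R = Z · Z ≐ e ∷ X · (Y · Z ⁻) · (X · (Y · Z ⁻)) ≐ e ∷ X · Z · (X · Z) ≐ e ∷ Y · Y ≐ e ∷ Y · Z ⁻ · (Y · Z ⁻) ≐ e ∷ []}
              (z² ∷ back (X · (Y · Z ⁻) · (X · (Y · Z ⁻)) ≐ X · Y · (X · Y)) p ∷ q ∷ r ∷ back (Y · Z ⁻ · (Y · Z ⁻) ≐ Y · Y) y² ∷ []) _
              (((2 , 2 , 1 , true) ∷ (2 , 0 , 0 , false) ∷ (0 , 1 , 0 , false) ∷ (0 , 4 , 0 , true) ∷ []) ∷ ((0 , 0 , 0 , false) ∷ []) ∷ ((0 , 2 , 1 , false) ∷ []) ∷ ((2 , 0 , 0 , false) ∷ (1 , 4 , 0 , false) ∷ (0 , 0 , 0 , false) ∷ []) ∷ [])))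
      where
      back : ∀ (r : Relation 3) → {_ : T (derives [] (substitute (lookup (X ∷ Y · Z ∷ Z ∷ [])) (proj₁ r) ≐ proj₂ r) [])} →
             ⟦ proj₂ r ⟧ ≡ ε → eval G (triple a X (Y · Z) Z) (proj₁ r) ≡ ε
      back r {t} p = trans (eval-substitute G a (lookup (X ∷ Y · Z ∷ Z ∷ [])) (proj₁ r))
        (trans (free-identity (substitute (lookup (X ∷ Y · Z ∷ Z ∷ [])) (proj₁ r) ≐ proj₂ r) {t}) p)

  open Involutory₂ using (twoInvolutions)

  module Involutory₃ (a : Fin 3 → C) (gn : Generates G a) where
    open Eval G a

    -- If all products of two generators are involutions as well, the group is an elementary abelian
    -- 2-group; conjugation by `z` and inversion are both trivial on `⟨x, y⟩`.
    threeInvolutions : ⟦ X · X ⟧ ≡ ε → ⟦ Y · Y ⟧ ≡ ε → ⟦ Z · Z ⟧ ≡ ε → Outcome G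
    threeInvolutions x² y² z² with ⟦ X · Y · (X · Y) ⟧ ≟ ε | ⟦ X · Z · (X · Z) ⟧ ≟ ε | ⟦ Y · Z · (Y · Z) ⟧ ≟ ε
    ... | no n | _ | _ = twoInvolutions (triple a (X · Y) Y Z) (change-generators gn (lookup (X · Y ∷ Y ∷ Z ∷ [])) (lookup (X · Y ⁻ ∷ Y ∷ Z ∷ []))) n y² z²
    ... | yes _ | no n | _ = twoInvolutions (triple a (X · Z) Y Z) (change-generators gn (lookup (X · Z ∷ Y ∷ Z ∷ [])) (lookup (X · Z ⁻ ∷ Y ∷ Z ∷ []))) n y² z²
    ... | yes _ | yes _ | no n = twoInvolutions (triple a (Y · Z) X Z) (change-generators gn (lookup (Y · Z ∷ X ∷ Z ∷ [])) (lookup (Y ∷ X · Z ⁻ ∷ Z ∷ []))) n x² z²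
    ... | yes p | yes q | yes r = inj₁ (inverted-abelian G a gn rank
            (consequences {R = X · X ≐ e ∷ Y · Y ≐ e ∷ Z · Z ≐ e ∷ X · Y · (X · Y) ≐ e ∷ X · Z · (X · Z) ≐ e ∷ Y · Z · (Y · Z) ≐ e ∷ []}
              (x² ∷ y² ∷ z² ∷ p ∷ q ∷ r ∷ []) _ (((2 , 0 , 0 , true) ∷ (0 , 3 , 0 , false) ∷ (0 , 1 , 0 , true) ∷ []) ∷ ((0 , 2 , 0 , false) ∷ []) ∷ ((0 , 4 , 1 , false) ∷ []) ∷ ((0 , 5 , 1 , false) ∷ []) ∷ [])))

  open Involutory₃ using (threeInvolutions)

  outcome : ∀ a → Generates G a → Outcome G
  outcome a gn with (a 0F ∙ a 0F) ≟ ε | (a 1F ∙ a 1F) ≟ ε | (a 2F ∙ a 2F) ≟ ε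
  ... | yes x² | yes y² | yes z² = threeInvolutions a gn x² y² z²
  ... | yes x² | yes y² | no z² = twoInvolutions (triple a Z X Y) (change-generators gn (lookup (Z ∷ X ∷ Y ∷ [])) (lookup (Y ∷ Z ∷ X ∷ []))) z² x² y²
  ... | yes x² | no y² | yes z² = twoInvolutions (triple a Y X Z) (change-generators gn (lookup (Y ∷ X ∷ Z ∷ [])) (lookup (Y ∷ X ∷ Z ∷ []))) y² x² z²
  ... | yes x² | no y² | no z² = oneInvolution (triple a Y Z X) (change-generators gn (lookup (Y ∷ Z ∷ X ∷ [])) (lookup (Z ∷ X ∷ Y ∷ []))) y² z² x²
  ... | no x² | yes y² | yes z² = twoInvolutions a gn x² y² z²
  ... | no x² | yes y² | no z² = oneInvolution (triple a X Z Y) (change-generators gn (lookup (X ∷ Z ∷ Y ∷ [])) (lookup (X ∷ Z ∷ Y ∷ []))) x² z² y²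
  ... | no x² | no y² | yes z² = oneInvolution a gn x² y² z²
  ... | no x² | no y² | no z² = noninvolutory a gn (noninvolutions x² y² z²)

-- Homomorphisms and digraph automorphisms that come from the group

module Homomorphism (G H : FinGroup) (h : Carrier G → Carrier H) (hom : IsHom G H h) where
  private
    module G = GroupOf G
    module H = GroupOf H
  open ≡-Reasoning

  hom-ε : h G.ε ≡ H.ε
  hom-ε = H.∙-cancelˡ (h G.ε) _ _ (begin
    h G.ε H.∙ h G.ε   ≡⟨ sym (hom G.ε G.ε) ⟩
    h (G.ε G.∙ G.ε)   ≡⟨ cong h (G.identityˡ G.ε) ⟩
    h G.ε             ≡⟨ sym (H.identityʳ _) ⟩
    h G.ε H.∙ H.ε     ∎)

  hom-⁻¹ : ∀ g → h (g G.⁻¹) ≡ h g H.⁻¹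
  hom-⁻¹ g = H.inverseˡ-unique _ _ (trans (sym (hom (g G.⁻¹) g)) (trans (cong h (G.inverseˡ g)) hom-ε))

  hom-eval : ∀ {k} {a : Fin k → Carrier G} {b : Fin k → Carrier H} → (∀ i → h (a i) ≡ b i) →
             ∀ u → h (eval G a u) ≡ eval H b u
  hom-eval p (var i) = p i
  hom-eval p e       = hom-ε
  hom-eval p (u · v) = trans (hom _ _) (cong₂ H._∙_ (hom-eval p u) (hom-eval p v))
  hom-eval p (u ⁻)   = trans (hom-⁻¹ _) (cong H._⁻¹ (hom-eval p u))

-- An automorphism of the group that preserves S is an automorphism of the digraph fixing ε.
module _ (G : FinGroup) (S : Subset (order G)) (regular : IsDRR G S) where
  open GroupOf G

  automorphism-trivial : ∀ {h h′} → IsHom G G h → (∀ x → h′ (h x) ≡ x) → (∀ x → h (h′ x) ≡ x) →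
                         (∀ {x} → x Sub.∈ S → h x Sub.∈ S) → (∀ {x} → h x Sub.∈ S → x Sub.∈ S) → ∀ x → h x ≡ x
  automorphism-trivial {h} {h′} hom left right into out x with regular (permutation h h′ right left) aut
    where
    open Homomorphism G G h hom
    quotient : ∀ x y → h (y ∙ x ⁻¹) ≡ h y ∙ h x ⁻¹
    quotient x y = trans (hom _ _) (cong (h y ∙_) (hom-⁻¹ x))
    aut : IsCayleyAut G S (permutation h h′ right left)
    aut x y = mk⇔ (λ p → subst (Sub._∈ S) (quotient x y) (into p)) (λ p → out (subst (Sub._∈ S) (sym (quotient x y)) p))
  ... | g , eq = trans (eq x) (trans (cong (x ∙_) g≡ε) (identityʳ x))
    where
    g≡ε : g ≡ ε
    g≡ε = trans (sym (identityˡ g)) (trans (sym (eq ε)) (Homomorphism.hom-ε G G h hom))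

-- Certificates for the absence of an ORR

-- The position of a pair `w, w⁻¹` relative to `S`: neither element, only `w`, or only `w⁻¹` belongs
-- to it. Both together are impossible, since `S` contains no element along with its inverse.
data Trit : Set where
  absent positive negative : Trit

sameTrit : Trit → Trit → Bool
sameTrit absent   absent   = true
sameTrit positive positive = true
sameTrit negative negative = true
sameTrit _        _        = false

sameTrit-sound : ∀ s t → T (sameTrit s t) → s ≡ t
sameTrit-sound absent   absent   _ = refl
sameTrit-sound positive positive _ = refl
sameTrit-sound negative negative _ = refl

withSign : Bool → Trit → Trit
withSign true  t        = t
withSign false absent   = absent
withSign false positive = negative
withSign false negative = positive

signed-word : ∀ {k} → Bool → Word k → Word k
signed-word true  u = u
signed-word false u = u ⁻

everyTrit : (n : ℕ) → (Vec Trit n → Bool) → Bool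
everyTrit zero    p = p []
everyTrit (suc n) p = everyTrit n (λ t → p (absent ∷ t)) ∧ (everyTrit n (λ t → p (positive ∷ t)) ∧ everyTrit n (λ t → p (negative ∷ t)))

everyTrit-sound : ∀ n p → T (everyTrit n p) → ∀ t → T (p t)
everyTrit-sound zero    p h []      = h
everyTrit-sound (suc n) p h (x ∷ t) with Equivalence.to (T-∧ {everyTrit n (λ t → p (absent ∷ t))}) h
... | h₁ , h′ with Equivalence.to (T-∧ {everyTrit n (λ t → p (positive ∷ t))}) h′
everyTrit-sound (suc n) p h (absent   ∷ t) | h₁ , h′ | h₂ , h₃ = everyTrit-sound n _ h₁ t
everyTrit-sound (suc n) p h (positive ∷ t) | h₁ , h′ | h₂ , h₃ = everyTrit-sound n _ h₂ t
everyTrit-sound (suc n) p h (negative ∷ t) | h₁ , h′ | h₂ , h₃ = everyTrit-sound n _ h₃ t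

-- An automorphism and its inverse, by images of the generators, with the induced signed permutation
-- of the pairs of non-involutions: (i , j , b) says that the pair i goes to the pair j, reversed if b is false.
record Candidate (k m : ℕ) : Set where
  constructor candidate
  field
    images inverses : Vec (Word k) k
    moved           : List (Fin m × Fin m × Bool)

action : ∀ {m} → List (Fin m × Fin m × Bool) → Fin m → Fin m × Bool
-- A pair that is not listed stays in place with its orientation.
action []                 j = j , true
action ((i , i′ , b) ∷ l) j = if ⌊ i ≟F j ⌋ then (i′ , b) else action l j

compatible : ∀ {m} → Vec Trit m → List (Fin m × Fin m × Bool) → Bool
compatible t []                 = true
compatible t ((i , i′ , b) ∷ l) = sameTrit (lookup t i′) (withSign b (lookup t i)) ∧ compatible t l

compatible-action : ∀ {m} (t : Vec Trit m) l → T (compatible t l) → ∀ j →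
                    lookup t (proj₁ (action l j)) ≡ withSign (proj₂ (action l j)) (lookup t j)
compatible-action t []                 c j = refl
compatible-action t ((i , i′ , b) ∷ l) c j with i ≟F j | Equivalence.to (T-∧ {sameTrit (lookup t i′) (withSign b (lookup t i))}) c
... | yes refl | p , _ = sameTrit-sound _ _ p
... | no _     | _ , q = compatible-action t l q j

-- A set disjoint from its inverse contains no involution, so it is determined by one trit for each
-- pair of mutually inverse non-involutions. The certificate claims that each of the `3 ^ pairs`
-- assignments is preserved by a listed automorphism. That the automorphism is not the identity is
-- reduced to a word in `displacements`, by which it multiplies some generator.
record Certificate (k : ℕ) : Set where
  field
    relations    : List (Relation k)
    sameWord     : Word k → Word k → Bool
    normalForms  : List (Word k)
    pairs        : ℕ
    representatives : Vec (Word k) pairs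
    candidates   : List (Candidate k pairs)
    displacements : List (Word k)

  classified : Word k → Bool
  classified u = sameWord (u · u) e ∨
    any (λ j → sameWord u (lookup representatives j) ∨ sameWord u (lookup representatives j ⁻)) (allFin pairs)

  respects : Vec (Word k) k → Bool
  respects f = all (λ r → sameWord (substitute (lookup f) (proj₁ r)) (substitute (lookup f) (proj₂ r))) relations

  undoes : Vec (Word k) k → Vec (Word k) k → Bool
  undoes f f′ = all (λ i → sameWord (substitute (lookup f′) (lookup f i)) (var i)) (allFin k)

  module _ (c : Candidate k pairs) where
    open Candidate c

    acts : Bool
    acts = all (λ j → sameWord (substitute (lookup images) (lookup representatives j))
      (signed-word (proj₂ (action moved j)) (lookup representatives (proj₁ (action moved j))))) (allFin pairs)

    moves : Bool
    moves = any (λ i → any (λ u → sameWord (lookup images i) (u · var i)) displacements) (allFin k)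

    admissible : Bool
    admissible = (respects images ∧ respects inverses) ∧ ((undoes images inverses ∧ undoes inverses images) ∧ (acts ∧ moves))

    preserves : Vec Trit pairs → Bool
    preserves t = compatible t moved

  covered : Bool
  covered = everyTrit pairs (λ t → any (λ c → preserves c t) candidates)

  valid : Bool
  valid = all classified normalForms ∧ (all admissible candidates ∧ covered)

-- The universal property turns images satisfying the relations into an endomorphism, and the listed
-- inverse makes it bijective. What evaluation cannot supply, the nontriviality of the
-- displacements, is assumed here.
module Refutation {k : ℕ} (cert : Certificate k) (valid : T (Certificate.valid cert)) (G : FinGroup)
  (a : Fin k → Carrier G) (gn : Generates G a)
  (universal : ∀ (H : FinGroup) (b : Fin k → Carrier H) → Satisfies H b (Certificate.relations cert) →
               Σ (Carrier G → Carrier H) λ f → IsHom G H f × (∀ i → f (a i) ≡ b i))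
  (sameWord-sound : ∀ u v → T (Certificate.sameWord cert u v) → eval G a u ≡ eval G a v)
  (normal-form : ∀ g → ∃ λ u → u ∈ Certificate.normalForms cert × eval G a u ≡ g)
  (displaced : All (λ u → eval G a u ≢ FinGroup.ε G) (Certificate.displacements cert))
  (S : Subset (order G)) (antisymmetric : ∀ s → s Sub.∈ S → ¬ ((FinGroup._⁻¹ G s) Sub.∈ S)) (regular : IsDRR G S) where
  open Certificate cert hiding (valid)
  open GroupOf G
  open Eval G a

  private
    valid₁ = proj₁ (Equivalence.to (T-∧ {all classified normalForms}) valid)
    valid₂ = proj₁ (Equivalence.to (T-∧ {all admissible candidates}) (proj₂ (Equivalence.to (T-∧ {all classified normalForms}) valid)))
    valid₃ = proj₂ (Equivalence.to (T-∧ {all admissible candidates}) (proj₂ (Equivalence.to (T-∧ {all classified normalForms}) valid)))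

    w : Fin pairs → Word k
    w = lookup representatives

  not-involution : ∀ {g} → g Sub.∈ S → g ∙ g ≢ ε
  not-involution {g} p eq = antisymmetric g p (subst (Sub._∈ S) (inverseˡ-unique g g eq) p)

  classification : ∀ g → (g ∙ g ≡ ε) ⊎ (∃ λ j → ∃ λ b → g ≡ ⟦ signed-word b (w j) ⟧)
  classification g with normal-form g
  ... | u , u∈ , refl with Equivalence.to (T-∨ {sameWord (u · u) e}) (all-∈ _ valid₁ u∈)
  ...   | inj₁ t = inj₁ (sameWord-sound (u · u) e t)
  ...   | inj₂ t with any-∈ _ {allFin pairs} t
  ...     | j , _ , t′ with Equivalence.to (T-∨ {sameWord u (w j)}) t′
  ...       | inj₁ p = inj₂ (j , true , sameWord-sound u (w j) p)
  ...       | inj₂ p = inj₂ (j , false , sameWord-sound u (w j ⁻) p)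

  trit : Fin pairs → Trit
  trit j with ⟦ w j ⟧ ∈? S | ⟦ w j ⁻ ⟧ ∈? S
  ... | yes _ | _     = positive
  ... | no _  | yes _ = negative
  ... | no _  | no _  = absent

  trit-∈ : ∀ b j → ⟦ signed-word b (w j) ⟧ Sub.∈ S → trit j ≡ withSign b positive
  trit-∈ b j p with ⟦ w j ⟧ ∈? S | ⟦ w j ⁻ ⟧ ∈? S
  trit-∈ true  j p | yes _ | _     = refl
  trit-∈ false j p | yes q | _     = contradiction p (antisymmetric _ q)
  trit-∈ true  j p | no n  | _     = contradiction p n
  trit-∈ false j p | no _  | yes _ = refl
  trit-∈ false j p | no _  | no n  = contradiction p n

  ∈-trit : ∀ b j → trit j ≡ withSign b positive → ⟦ signed-word b (w j) ⟧ Sub.∈ S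
  ∈-trit b j eq with ⟦ w j ⟧ ∈? S | ⟦ w j ⁻ ⟧ ∈? S
  ∈-trit true  j eq | yes p | _     = p
  ∈-trit false j () | yes _ | _
  ∈-trit true  j () | no _  | yes _
  ∈-trit false j eq | no _  | yes p = p
  ∈-trit true  j () | no _  | no _
  ∈-trit false j () | no _  | no _

  module _ (f : Vec (Word k) k) (r : T (respects f)) where
    private
      target : Fin k → C
      target i = ⟦ lookup f i ⟧

      satisfied : ∀ R → T (all (λ r → sameWord (substitute (lookup f) (proj₁ r)) (substitute (lookup f) (proj₂ r))) R) → Satisfies G target R
      satisfied []            t = []
      satisfied ((u , v) ∷ R) t with Equivalence.to (T-∧ {sameWord (substitute (lookup f) u) (substitute (lookup f) v)}) t
      ... | p , q = trans (eval-substitute G a (lookup f) u) (trans (sameWord-sound _ _ p) (sym (eval-substitute G a (lookup f) v))) ∷ satisfied R q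

      extension = universal G target (satisfied relations r)

    endomorphism : C → C
    endomorphism = proj₁ extension

    endomorphism-hom : IsHom G G endomorphism
    endomorphism-hom = proj₁ (proj₂ extension)

    endomorphism-eval : ∀ u → endomorphism ⟦ u ⟧ ≡ ⟦ substitute (lookup f) u ⟧
    endomorphism-eval u = trans (Homomorphism.hom-eval G G endomorphism endomorphism-hom (proj₂ (proj₂ extension)) u) (eval-substitute G a (lookup f) u)

  undone : ∀ f f′ (r : T (respects f)) (r′ : T (respects f′)) → T (undoes f f′) → ∀ g → endomorphism f′ r′ (endomorphism f r g) ≡ g
  undone f f′ r r′ t g with normal-form g
  ... | u , _ , refl = go u
    where
    h = endomorphism f r
    h′ = endomorphism f′ r′
    composite-hom : IsHom G G (λ g → h′ (h g))
    composite-hom g g′ = trans (cong h′ (endomorphism-hom f r g g′)) (endomorphism-hom f′ r′ (h g) (h g′))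
    go : ∀ u → h′ (h ⟦ u ⟧) ≡ ⟦ u ⟧
    go u = Homomorphism.hom-eval G G (λ g → h′ (h g)) composite-hom
      (λ i → trans (cong h′ (endomorphism-eval f r (var i))) (trans (endomorphism-eval f′ r′ (lookup f i)) (sameWord-sound _ _ (all-∈ _ t (∈-allFin i))))) u

  withSign-injective : ∀ b {s t} → withSign b s ≡ withSign b t → s ≡ t
  withSign-injective true  eq = eq
  withSign-injective false {absent}   {absent}   eq = refl
  withSign-injective false {positive} {positive} eq = refl
  withSign-injective false {negative} {negative} eq = refl

  withSign-positive : ∀ b c → withSign b (withSign c positive) ≡ withSign (not (b xor c)) positive
  withSign-positive true  true  = refl
  withSign-positive true  false = refl
  withSign-positive false true  = refl
  withSign-positive false false = refl

  signed-signed : ∀ b c u → ⟦ signed-word b (signed-word c u) ⟧ ≡ ⟦ signed-word (not (c xor b)) u ⟧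
  signed-signed true  true  u = refl
  signed-signed true  false u = refl
  signed-signed false true  u = refl
  signed-signed false false u = ⁻¹-involutive _

  module Preserving (c : Candidate k pairs) (adm : T (admissible c)) (pres : T (preserves c (Vec.tabulate trit))) where
    open Candidate c
    private
      adm₁ = Equivalence.to (T-∧ {respects images}) (proj₁ (Equivalence.to (T-∧ {respects images ∧ respects inverses}) adm))
      adm₂ = Equivalence.to (T-∧ {undoes images inverses ∧ undoes inverses images}) (proj₂ (Equivalence.to (T-∧ {respects images ∧ respects inverses}) adm))
      adm₃ = Equivalence.to (T-∧ {undoes images inverses}) (proj₁ adm₂)
      adm₄ = Equivalence.to (T-∧ {acts c}) (proj₂ adm₂)

      h = endomorphism images (proj₁ adm₁)
      hom = endomorphism-hom images (proj₁ adm₁)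
      open Homomorphism G G h hom

      σ : Fin pairs → Fin pairs
      σ j = proj₁ (action moved j)
      sign : Fin pairs → Bool
      sign j = proj₂ (action moved j)

      image : ∀ b j → h ⟦ signed-word b (w j) ⟧ ≡ ⟦ signed-word (not (sign j xor b)) (w (σ j)) ⟧
      image b j = trans (signs b) (signed-signed b (sign j) (w (σ j)))
        where
        base : h ⟦ w j ⟧ ≡ ⟦ signed-word (sign j) (w (σ j)) ⟧
        base = trans (endomorphism-eval images (proj₁ adm₁) (w j)) (sameWord-sound _ _ (all-∈ _ (proj₁ adm₄) (∈-allFin j)))
        signs : ∀ b → h ⟦ signed-word b (w j) ⟧ ≡ ⟦ signed-word b (signed-word (sign j) (w (σ j))) ⟧
        signs true  = base
        signs false = trans (hom-⁻¹ _) (cong _⁻¹ base)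

      invariant : ∀ j → trit (σ j) ≡ withSign (sign j) (trit j)
      invariant j = trans (sym (lookup∘tabulate trit (σ j)))
        (trans (compatible-action (Vec.tabulate trit) moved pres j) (cong (withSign (sign j)) (lookup∘tabulate trit j)))

      into : ∀ {x} → x Sub.∈ S → h x Sub.∈ S
      into {x} p with classification x
      ... | inj₁ eq = contradiction eq (not-involution p)
      ... | inj₂ (j , b , refl) = subst (Sub._∈ S) (sym (image b j)) (∈-trit _ (σ j)
              (trans (invariant j) (trans (cong (withSign (sign j)) (trit-∈ b j p)) (withSign-positive (sign j) b))))

      out : ∀ {x} → h x Sub.∈ S → x Sub.∈ S
      out {x} p with classification x
      ... | inj₁ eq = contradiction (trans (sym (hom x x)) (trans (cong h eq) hom-ε)) (not-involution p)
      ... | inj₂ (j , b , refl) = ∈-trit b j (withSign-injective (sign j)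
              (trans (sym (invariant j)) (trans (trit-∈ (not (sign j xor b)) (σ j) (subst (Sub._∈ S) (image b j) p)) (sym (withSign-positive (sign j) b)))))

      trivial : ∀ x → h x ≡ x
      trivial = automorphism-trivial G S regular hom
        (undone images inverses (proj₁ adm₁) (proj₂ adm₁) (proj₁ adm₃)) (undone inverses images (proj₂ adm₁) (proj₁ adm₁) (proj₂ adm₃)) into out

    absurd : ⊥
    absurd with any-∈ (λ i → any (λ u → sameWord (lookup images i) (u · var i)) displacements) {allFin k} (proj₂ adm₄)
    ... | i , _ , t with any-∈ (λ u → sameWord (lookup images i) (u · var i)) {displacements} t
    ...   | u , u∈ , t′ = All.lookup displaced u∈ (∙-cancelʳ (a i) _ _ (trans (sym (sameWord-sound _ _ t′))
            (trans (sym (endomorphism-eval images (proj₁ adm₁) (var i))) (trans (trivial (a i)) (sym (identityˡ _))))))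

  contradictory : ⊥
  contradictory with any-∈ (λ c → preserves c (Vec.tabulate trit)) {candidates} (everyTrit-sound pairs _ valid₃ (Vec.tabulate trit))
  ... | c , c∈ , pres = Preserving.absurd c (all-∈ _ valid₂ c∈) pres

-- Certificates for the four exceptional groups

allBits : List Bits
allBits = concatMap (λ i → concatMap (λ j → map (λ k → i ∷ j ∷ k ∷ []) (true ∷ false ∷ [])) (true ∷ false ∷ [])) (true ∷ false ∷ [])

∈-allBits : ∀ v → v ∈ allBits
∈-allBits (ı ∷ ı ∷ ı ∷ []) = here refl
∈-allBits (ı ∷ ı ∷ o ∷ []) = there (here refl)
∈-allBits (ı ∷ o ∷ ı ∷ []) = there (there (here refl))
∈-allBits (ı ∷ o ∷ o ∷ []) = there (there (there (here refl)))
∈-allBits (o ∷ ı ∷ ı ∷ []) = there (there (there (there (here refl))))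
∈-allBits (o ∷ ı ∷ o ∷ []) = there (there (there (there (there (here refl)))))
∈-allBits (o ∷ o ∷ ı ∷ []) = there (there (there (there (there (there (here refl))))))
∈-allBits (o ∷ o ∷ o ∷ []) = there (there (there (there (there (there (there (here refl)))))))

allNormal : List Normal
allNormal = concatMap (λ v → map (v ,_) allBits) allBits

∈-allNormal : ∀ n → n ∈ allNormal
∈-allNormal (v , n) = ∈-concatMap⁺ (λ v → map (v ,_) allBits) (lose (∈-allBits v) (∈-map⁺ (v ,_) (∈-allBits n)))

module QuadraticCertificate (κ : Commutators) (ker : Bits → Bool) where
  open Multiplication κ

  sameNormal : Word 3 → Word 3 → Bool
  sameNormal u v = inKernel ker (normal (u · v ⁻))

  module Soundness (G : FinGroup) (a : Fin 3 → Carrier G) (gn : Generates G a) (sat : Satisfies G a (quadratic κ))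
    (ker-sound : ∀ n → T (ker n) → eval G a (central n) ≡ FinGroup.ε G) where
    open GroupOf G
    open Eval G a
    open QuadraticGroup G κ a sat

    kernel-value : ∀ n → T (inKernel ker n) → value n ≡ ε
    kernel-value (o ∷ o ∷ o ∷ [] , n) t = trans (sym (value-central n)) (ker-sound n t)

    sameNormal-sound : ∀ u v → T (sameNormal u v) → ⟦ u ⟧ ≡ ⟦ v ⟧
    sameNormal-sound u v t = quotient-trivial (trans (sym (value-normal (u · v ⁻))) (kernel-value (normal (u · v ⁻)) t))

    normal-form : ∀ g → ∃ λ u → u ∈ map normalWord allNormal × ⟦ u ⟧ ≡ g
    normal-form g with value-⟨⟩ (gn g)
    ... | n , eq = normalWord n , ∈-map⁺ normalWord (∈-allNormal n) , eq

kerC₄C₂C₂ : Bits → Bool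
kerC₄C₂C₂ (i ∷ j ∷ k ∷ []) = not i

-- Of the three pairs of `xy`, `xz` and `xyz`, two agree in whether they meet `S`. An automorphism
-- fixing `x` exchanges those two, keeping or reversing orientation as needed: three choices of two
-- pairs, two signs each.
certificateC₄C₂C₂ : Certificate 3
certificateC₄C₂C₂ = record
  { relations = relC4C2C2
  ; sameWord = QuadraticCertificate.sameNormal κ₀ kerC₄C₂C₂
  ; normalForms = map normalWord allNormal
  ; pairs = 4
  ; representatives = (X) ∷ (X · Y) ∷ (X · Z) ∷ (X · Y · Z) ∷ []
  ; candidates =
      candidate (X ∷ Y ∷ (Y · Z) ∷ []) (X ∷ Y ∷ (Y · Z) ∷ [])
      ((2F , 3F , ı) ∷ (3F , 2F , ı) ∷ [])
    ∷ candidate (X ∷ Y ∷ (Y · Z · (X · X)) ∷ []) (X ∷ Y ∷ (Y · Z · (X · X)) ∷ [])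
      ((2F , 3F , o) ∷ (3F , 2F , o) ∷ [])
    ∷ candidate (X ∷ Z ∷ Y ∷ []) (X ∷ Z ∷ Y ∷ [])
      ((1F , 2F , ı) ∷ (2F , 1F , ı) ∷ [])
    ∷ candidate (X ∷ (Y · Z) ∷ Z ∷ []) (X ∷ (Y · Z) ∷ Z ∷ [])
      ((1F , 3F , ı) ∷ (3F , 1F , ı) ∷ [])
    ∷ candidate (X ∷ (Z · (X · X)) ∷ (Y · (X · X)) ∷ []) (X ∷ (Z · (X · X)) ∷ (Y · (X · X)) ∷ [])
      ((1F , 2F , o) ∷ (2F , 1F , o) ∷ [])
    ∷ candidate (X ∷ (Y · Z · (X · X)) ∷ Z ∷ []) (X ∷ (Y · Z · (X · X)) ∷ Z ∷ [])
      ((1F , 3F , o) ∷ (3F , 1F , o) ∷ []) ∷ []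
  ; displacements = Y ∷ Y · (X · X) ∷ Y · Z ∷ Z ∷ Y · Z · (X · X) ∷ Z · (X · X) ∷ []
  }

kerC₄C₂C₂-sound : ∀ H b → Satisfies H b relC4C2C2 → ∀ n → T (kerC₄C₂C₂ n) → eval H b (central n) ≡ FinGroup.ε H
kerC₄C₂C₂-sound H b satH (o ∷ ı ∷ ı ∷ []) _ = Eval.consequence H b satH (central (o ∷ ı ∷ ı ∷ []) ≐ e) ((2 , 2 , 0 , false) ∷ (0 , 1 , 0 , false) ∷ [])
kerC₄C₂C₂-sound H b satH (o ∷ ı ∷ o ∷ []) _ = Eval.consequence H b satH (central (o ∷ ı ∷ o ∷ []) ≐ e) ((0 , 1 , 0 , false) ∷ [])
kerC₄C₂C₂-sound H b satH (o ∷ o ∷ ı ∷ []) _ = Eval.consequence H b satH (central (o ∷ o ∷ ı ∷ []) ≐ e) ((0 , 2 , 0 , false) ∷ [])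
kerC₄C₂C₂-sound H b satH (o ∷ o ∷ o ∷ []) _ = Eval.consequence H b satH (central (o ∷ o ∷ o ∷ []) ≐ e) []

kerG1 : Bits → Bool
kerG1 (i ∷ j ∷ k ∷ []) = not (i xor j) ∧ not (j xor k)

-- The pairs form blocks `x, xy²`, then `y, yx²`, then `z, zx²`. If both or neither of the pairs in
-- a block meet `S`, one of the first six automorphisms exchanges them. Otherwise each block
-- contributes one element, and one of the last eight exchanges the blocks of `y` and `z`, reversing
-- in the first block only a pair that misses `S`.
certificateG1 : Certificate 3
certificateG1 = record
  { relations = relG1
  ; sameWord = QuadraticCertificate.sameNormal κOrder64 kerG1
  ; normalForms = map normalWord allNormal
  ; pairs = 6
  ; representatives = (X) ∷ (X · (Y · Y)) ∷ (Y) ∷ (Y · (X · X)) ∷ (Z) ∷ (Z · (X · X)) ∷ []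
  ; candidates =
      candidate (X ∷ Y ∷ (Z · (X · X)) ∷ []) (X ∷ Y ∷ (Z · (X · X)) ∷ [])
      ((4F , 5F , ı) ∷ (5F , 4F , ı) ∷ [])
    ∷ candidate (X ∷ Y ∷ (Z · (Y · Y)) ∷ []) (X ∷ Y ∷ (Z · (Y · Y)) ∷ [])
      ((4F , 5F , o) ∷ (5F , 4F , o) ∷ [])
    ∷ candidate (X ∷ (Y · (X · X)) ∷ Z ∷ []) (X ∷ (Y · (X · X)) ∷ Z ∷ [])
      ((2F , 3F , ı) ∷ (3F , 2F , ı) ∷ [])
    ∷ candidate (X ∷ (Y · (X · X) · (Y · Y)) ∷ Z ∷ []) (X ∷ (Y · (X · X) · (Y · Y)) ∷ Z ∷ [])
      ((2F , 3F , o) ∷ (3F , 2F , o) ∷ [])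
    ∷ candidate ((X · (Y · Y)) ∷ Y ∷ Z ∷ []) ((X · (Y · Y)) ∷ Y ∷ Z ∷ [])
      ((0F , 1F , ı) ∷ (1F , 0F , ı) ∷ [])
    ∷ candidate ((X · (X · X) · (Y · Y)) ∷ Y ∷ Z ∷ []) ((X · (X · X) · (Y · Y)) ∷ Y ∷ Z ∷ [])
      ((0F , 1F , o) ∷ (1F , 0F , o) ∷ [])
    ∷ candidate (X ∷ Z ∷ Y ∷ []) (X ∷ Z ∷ Y ∷ [])
      ((1F , 1F , o) ∷ (2F , 4F , ı) ∷ (3F , 5F , ı) ∷ (4F , 2F , ı) ∷ (5F , 3F , ı) ∷ [])
    ∷ candidate (X ∷ (Z · (X · X)) ∷ (Y · (X · X)) ∷ []) (X ∷ (Z · (X · X)) ∷ (Y · (X · X)) ∷ [])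
      ((1F , 1F , o) ∷ (2F , 5F , ı) ∷ (3F , 4F , ı) ∷ (4F , 3F , ı) ∷ (5F , 2F , ı) ∷ [])
    ∷ candidate (X ∷ (Z · (Y · Y)) ∷ (Y · (X · X) · (Y · Y)) ∷ []) (X ∷ (Z · (Y · Y)) ∷ (Y · (X · X) · (Y · Y)) ∷ [])
      ((1F , 1F , o) ∷ (2F , 5F , o) ∷ (3F , 4F , o) ∷ (4F , 3F , o) ∷ (5F , 2F , o) ∷ [])
    ∷ candidate (X ∷ (Z · (X · X) · (Y · Y)) ∷ (Y · (Y · Y)) ∷ []) (X ∷ (Z · (X · X) · (Y · Y)) ∷ (Y · (Y · Y)) ∷ [])
      ((1F , 1F , o) ∷ (2F , 4F , o) ∷ (3F , 5F , o) ∷ (4F , 2F , o) ∷ (5F , 3F , o) ∷ [])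
    ∷ candidate ((X · (X · X)) ∷ Z ∷ Y ∷ []) ((X · (X · X)) ∷ Z ∷ Y ∷ [])
      ((0F , 0F , o) ∷ (2F , 4F , ı) ∷ (3F , 5F , ı) ∷ (4F , 2F , ı) ∷ (5F , 3F , ı) ∷ [])
    ∷ candidate ((X · (X · X)) ∷ (Z · (X · X)) ∷ (Y · (X · X)) ∷ []) ((X · (X · X)) ∷ (Z · (X · X)) ∷ (Y · (X · X)) ∷ [])
      ((0F , 0F , o) ∷ (2F , 5F , ı) ∷ (3F , 4F , ı) ∷ (4F , 3F , ı) ∷ (5F , 2F , ı) ∷ [])
    ∷ candidate ((X · (X · X)) ∷ (Z · (Y · Y)) ∷ (Y · (X · X) · (Y · Y)) ∷ []) ((X · (X · X)) ∷ (Z · (Y · Y)) ∷ (Y · (X · X) · (Y · Y)) ∷ [])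
      ((0F , 0F , o) ∷ (2F , 5F , o) ∷ (3F , 4F , o) ∷ (4F , 3F , o) ∷ (5F , 2F , o) ∷ [])
    ∷ candidate ((X · (X · X)) ∷ (Z · (X · X) · (Y · Y)) ∷ (Y · (Y · Y)) ∷ []) ((X · (X · X)) ∷ (Z · (X · X) · (Y · Y)) ∷ (Y · (Y · Y)) ∷ [])
      ((0F , 0F , o) ∷ (2F , 4F , o) ∷ (3F , 5F , o) ∷ (4F , 2F , o) ∷ (5F , 3F , o) ∷ []) ∷ []
  ; displacements = (X · X) ∷ (Y · Y) ∷ (X · X) · (Y · Y) ∷ Y · Z · (X · X) · (Y · Y) ∷ Y · Z · (Y · Y) ∷ Y · Z · (X · X) ∷ Y · Z ∷ []
  }

kerG1-sound : ∀ H b → Satisfies H b relG1 → ∀ n → T (kerG1 n) → eval H b (central n) ≡ FinGroup.ε H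
kerG1-sound H b satH (ı ∷ ı ∷ ı ∷ []) _ = Eval.consequence H b satH (central (ı ∷ ı ∷ ı ∷ []) ≐ e) ((0 , 9 , 0 , false) ∷ [])
kerG1-sound H b satH (o ∷ o ∷ o ∷ []) _ = Eval.consequence H b satH (central (o ∷ o ∷ o ∷ []) ≐ e) []

kerG2 : Bits → Bool
kerG2 (i ∷ j ∷ k ∷ []) = not (i xor (j xor k))

-- The automorphisms fix `y` and act on `±x, ±z, ±xz` in `Q₈` as rotations of a cube. The trits of
-- `x`, `z` and `xz` form a vector with entries `0, 1, -1`; each such vector lies on an axis through
-- a face, an edge or a corner. The 13 candidates contain one rotation for each of the 3, 6 and 4
-- axes.
certificateG2 : Certificate 3
certificateG2 = record
  { relations = relG2
  ; sameWord = QuadraticCertificate.sameNormal κG2 kerG2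
  ; normalForms = map normalWord allNormal
  ; pairs = 4
  ; representatives = (X) ∷ (Y) ∷ (Z) ∷ (X · Z) ∷ []
  ; candidates =
      candidate (X ∷ Y ∷ (X · Z) ∷ []) (X ∷ Y ∷ (X · Z · (X · X)) ∷ [])
      ((2F , 3F , ı) ∷ (3F , 2F , o) ∷ [])
    ∷ candidate ((X · (X · X)) ∷ Y ∷ (X · Z) ∷ []) ((X · (X · X)) ∷ Y ∷ (X · Z) ∷ [])
      ((0F , 0F , o) ∷ (2F , 3F , ı) ∷ (3F , 2F , ı) ∷ [])
    ∷ candidate ((X · (X · X)) ∷ Y ∷ (X · Z · (X · X)) ∷ []) ((X · (X · X)) ∷ Y ∷ (X · Z · (X · X)) ∷ [])
      ((0F , 0F , o) ∷ (2F , 3F , o) ∷ (3F , 2F , o) ∷ [])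
    ∷ candidate (Z ∷ Y ∷ X ∷ []) (Z ∷ Y ∷ X ∷ [])
      ((0F , 2F , ı) ∷ (2F , 0F , ı) ∷ (3F , 3F , o) ∷ [])
    ∷ candidate (Z ∷ Y ∷ (X · (X · X)) ∷ []) ((Z · (X · X)) ∷ Y ∷ X ∷ [])
      ((0F , 2F , ı) ∷ (2F , 0F , o) ∷ [])
    ∷ candidate (Z ∷ Y ∷ (X · Z) ∷ []) ((X · Z) ∷ Y ∷ X ∷ [])
      ((0F , 2F , ı) ∷ (2F , 3F , ı) ∷ (3F , 0F , ı) ∷ [])
    ∷ candidate (Z ∷ Y ∷ (X · Z · (X · X)) ∷ []) ((X · Z · (X · X)) ∷ Y ∷ X ∷ [])
      ((0F , 2F , ı) ∷ (2F , 3F , o) ∷ (3F , 0F , o) ∷ [])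
    ∷ candidate ((Z · (X · X)) ∷ Y ∷ (X · (X · X)) ∷ []) ((Z · (X · X)) ∷ Y ∷ (X · (X · X)) ∷ [])
      ((0F , 2F , o) ∷ (2F , 0F , o) ∷ (3F , 3F , o) ∷ [])
    ∷ candidate ((Z · (X · X)) ∷ Y ∷ (X · Z) ∷ []) ((X · Z · (X · X)) ∷ Y ∷ (X · (X · X)) ∷ [])
      ((0F , 2F , o) ∷ (2F , 3F , ı) ∷ (3F , 0F , o) ∷ [])
    ∷ candidate ((Z · (X · X)) ∷ Y ∷ (X · Z · (X · X)) ∷ []) ((X · Z) ∷ Y ∷ (X · (X · X)) ∷ [])
      ((0F , 2F , o) ∷ (2F , 3F , o) ∷ (3F , 0F , ı) ∷ [])
    ∷ candidate ((X · Z) ∷ Y ∷ Z ∷ []) ((X · Z · (X · X)) ∷ Y ∷ Z ∷ [])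
      ((0F , 3F , ı) ∷ (3F , 0F , o) ∷ [])
    ∷ candidate ((X · Z) ∷ Y ∷ (Z · (X · X)) ∷ []) ((X · Z) ∷ Y ∷ (Z · (X · X)) ∷ [])
      ((0F , 3F , ı) ∷ (2F , 2F , o) ∷ (3F , 0F , ı) ∷ [])
    ∷ candidate ((X · Z · (X · X)) ∷ Y ∷ (Z · (X · X)) ∷ []) ((X · Z · (X · X)) ∷ Y ∷ (Z · (X · X)) ∷ [])
      ((0F , 3F , o) ∷ (2F , 2F , o) ∷ (3F , 0F , o) ∷ []) ∷ []
  ; displacements = X ∷ X · (X · X) ∷ X · Z ∷ X · Z · (X · X) ∷ Z · (X · X) ∷ Z ∷ []
  }

kerG2-sound : ∀ H b → Satisfies H b relG2 → ∀ n → T (kerG2 n) → eval H b (central n) ≡ FinGroup.ε H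
kerG2-sound H b satH (ı ∷ ı ∷ o ∷ []) _ = Eval.consequence H b satH (central (ı ∷ ı ∷ o ∷ []) ≐ e) ((2 , 9 , 0 , true) ∷ (0 , 0 , 0 , false) ∷ [])
kerG2-sound H b satH (ı ∷ o ∷ ı ∷ []) _ = Eval.consequence H b satH (central (ı ∷ o ∷ ı ∷ []) ≐ e) ((2 , 7 , 0 , true) ∷ (0 , 0 , 0 , false) ∷ [])
kerG2-sound H b satH (o ∷ ı ∷ ı ∷ []) _ = Eval.consequence H b satH (central (o ∷ ı ∷ ı ∷ []) ≐ e) ((0 , 9 , 0 , true) ∷ (2 , 7 , 0 , true) ∷ (0 , 0 , 0 , false) ∷ [])
kerG2-sound H b satH (o ∷ o ∷ o ∷ []) _ = Eval.consequence H b satH (central (o ∷ o ∷ o ∷ []) ≐ e) []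

C₄C₂C₂-noORR : ∀ G → NotGeneratedByTwo G → IsPresentedBy G 3 relC4C2C2 → ¬ HasORR G
C₄C₂C₂-noORR G rank (a , gn , sat , universal) (S , antisymmetric , regular) =
  Refutation.contradictory certificateC₄C₂C₂ tt G a gn universal sameNormal-sound normal-form
    ((λ p → Independence.primitive-≢ G rank a gn (Y ≐ e) (Eval.consequence G a {R = Y ≐ e ∷ relC4C2C2} (p ∷ sat) (Y ≐ e) ((0 , 0 , 0 , false) ∷ [])))
      ∷ (λ p → Independence.primitive-≢ G rank a gn (Y · X · X ≐ e) (Eval.consequence G a {R = Y · (X · X) ≐ e ∷ relC4C2C2} (p ∷ sat) (Y · X · X ≐ e) ((0 , 0 , 0 , false) ∷ [])))
      ∷ (λ p → Independence.primitive-≢ G rank a gn (Y · Z ≐ e) (Eval.consequence G a {R = Y · Z ≐ e ∷ relC4C2C2} (p ∷ sat) (Y · Z ≐ e) ((0 , 0 , 0 , false) ∷ [])))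
      ∷ (λ p → Independence.primitive-≢ G rank a gn (Z ≐ e) (Eval.consequence G a {R = Z ≐ e ∷ relC4C2C2} (p ∷ sat) (Z ≐ e) ((0 , 0 , 0 , false) ∷ [])))
      ∷ (λ p → Independence.primitive-≢ G rank a gn (Y · Z · X · X ≐ e) (Eval.consequence G a {R = Y · Z · (X · X) ≐ e ∷ relC4C2C2} (p ∷ sat) (Y · Z · X · X ≐ e) ((0 , 0 , 0 , false) ∷ [])))
      ∷ (λ p → Independence.primitive-≢ G rank a gn (Z · X · X ≐ e) (Eval.consequence G a {R = Z · (X · X) ≐ e ∷ relC4C2C2} (p ∷ sat) (Z · X · X ≐ e) ((0 , 0 , 0 , false) ∷ []))) ∷ [])
    S antisymmetric regular
  where open QuadraticCertificate.Soundness κ₀ kerC₄C₂C₂ G a gn (quadraticC₄C₂C₂ sat) (kerC₄C₂C₂-sound G a sat)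

G2-noORR : ∀ G → NotGeneratedByTwo G → IsPresentedBy G 3 relG2 → ¬ HasORR G
G2-noORR G rank (a , gn , sat , universal) (S , antisymmetric , regular) =
  Refutation.contradictory certificateG2 tt G a gn universal sameNormal-sound normal-form
    ((λ p → Independence.primitive-≢ G rank a gn (X ≐ e) (Eval.consequence G a {R = X ≐ e ∷ relG2} (p ∷ sat) (X ≐ e) ((0 , 0 , 0 , false) ∷ [])))
      ∷ (λ p → Independence.primitive-≢ G rank a gn (X ⁻ ≐ e) (Eval.consequence G a {R = X · (X · X) ≐ e ∷ relG2} (p ∷ sat) (X ⁻ ≐ e) ((0 , 1 , 0 , true) ∷ (0 , 0 , 0 , false) ∷ [])))
      ∷ (λ p → Independence.primitive-≢ G rank a gn (X · Z ≐ e) (Eval.consequence G a {R = X · Z ≐ e ∷ relG2} (p ∷ sat) (X · Z ≐ e) ((0 , 0 , 0 , false) ∷ [])))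
      ∷ (λ p → Independence.primitive-≢ G rank a gn (X ⁻ · Z ≐ e) (Eval.consequence G a {R = X · Z · (X · X) ≐ e ∷ relG2} (p ∷ sat) (X ⁻ · Z ≐ e) ((0 , 1 , 0 , true) ∷ (0 , 0 , 2 , false) ∷ [])))
      ∷ (λ p → Independence.primitive-≢ G rank a gn (Z · X · X ≐ e) (Eval.consequence G a {R = Z · (X · X) ≐ e ∷ relG2} (p ∷ sat) (Z · X · X ≐ e) ((0 , 0 , 0 , false) ∷ [])))
      ∷ (λ p → Independence.primitive-≢ G rank a gn (Z ≐ e) (Eval.consequence G a {R = Z ≐ e ∷ relG2} (p ∷ sat) (Z ≐ e) ((0 , 0 , 0 , false) ∷ []))) ∷ [])
    S antisymmetric regular
  where open QuadraticCertificate.Soundness κG2 kerG2 G a gn (quadraticG2 sat) (kerG2-sound G a sat)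

-- x, y and z can be permuted, so if x² is trivial then all squares are, and S is empty.
G1-noORR : ∀ G → NotGeneratedByTwo G → IsPresentedBy G 3 relG1 → ¬ HasORR G
G1-noORR G rank (a , gn , sat , universal) (S , antisymmetric , regular) = go (⟦ X · X ⟧ ≟ ε)
  where
  open GroupOf G
  open Eval G a
  open Independence G rank a gn
  open QuadraticCertificate.Soundness κOrder64 kerG1 G a gn (quadraticG1 sat) (kerG1-sound G a sat)
  open QuadraticGroup G κOrder64 a (quadraticG1 sat) using (value; value-⟨⟩; value-⊕; value-central)
  open Multiplication κOrder64 using (cocycle)

  module Permuted (u v w : Word 3) (sat′ : Satisfies G (λ i → ⟦ lookup (u ∷ v ∷ w ∷ []) i ⟧) relG1) where
    extension = universal G (λ i → ⟦ lookup (u ∷ v ∷ w ∷ []) i ⟧) sat′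
    h = proj₁ extension
    hom = proj₁ (proj₂ extension)
    h-eval : ∀ t → h ⟦ t ⟧ ≡ eval G (λ i → ⟦ lookup (u ∷ v ∷ w ∷ []) i ⟧) t
    h-eval = Homomorphism.hom-eval G G h hom (proj₂ (proj₂ extension))
    trivial-image : ∀ t → ⟦ t ⟧ ≡ ε → eval G (λ i → ⟦ lookup (u ∷ v ∷ w ∷ []) i ⟧) t ≡ ε
    trivial-image t p = trans (sym (h-eval t)) (trans (cong h p) (Homomorphism.hom-ε G G h hom))

  abstract
    satYXZ : Satisfies G (λ i → ⟦ lookup (Y ∷ X ∷ Z ∷ []) i ⟧) relG1
    satYXZ = consequence sat (Y ^ 4 ≐ e) ((0 , 1 , 0 , false) ∷ [])
      ∷ consequence sat (X ^ 4 ≐ e) ((0 , 0 , 0 , false) ∷ [])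
      ∷ consequence sat (Z ^ 4 ≐ e) ((0 , 2 , 0 , false) ∷ [])
      ∷ consequence sat ((Y · X) ^ 2 ≐ e) ((0 , 3 , 1 , false) ∷ [])
      ∷ consequence sat ((Y · X ⁻) ^ 2 ≐ e) ((0 , 4 , 0 , true) ∷ [])
      ∷ consequence sat ((Y · Z) ^ 2 ≐ e) ((0 , 7 , 0 , false) ∷ [])
      ∷ consequence sat ((Y · Z ⁻) ^ 2 ≐ e) ((0 , 8 , 0 , false) ∷ [])
      ∷ consequence sat ((X · Z) ^ 2 ≐ e) ((0 , 5 , 0 , false) ∷ [])
      ∷ consequence sat ((X · Z ⁻) ^ 2 ≐ e) ((0 , 6 , 0 , false) ∷ [])
      ∷ consequence sat (Y ^ 2 · X ^ 2 · Z ^ 2 ≐ e) ((4 , 2 , 0 , false) ∷ (2 , 0 , 0 , false) ∷ (2 , 9 , 2 , true) ∷ (0 , 1 , 0 , false) ∷ []) ∷ []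

    satZYX : Satisfies G (λ i → ⟦ lookup (Z ∷ Y ∷ X ∷ []) i ⟧) relG1
    satZYX = consequence sat (Z ^ 4 ≐ e) ((0 , 2 , 0 , false) ∷ [])
      ∷ consequence sat (Y ^ 4 ≐ e) ((0 , 1 , 0 , false) ∷ [])
      ∷ consequence sat (X ^ 4 ≐ e) ((0 , 0 , 0 , false) ∷ [])
      ∷ consequence sat ((Z · Y) ^ 2 ≐ e) ((0 , 7 , 1 , false) ∷ [])
      ∷ consequence sat ((Z · Y ⁻) ^ 2 ≐ e) ((0 , 8 , 0 , true) ∷ [])
      ∷ consequence sat ((Z · X) ^ 2 ≐ e) ((0 , 5 , 1 , false) ∷ [])
      ∷ consequence sat ((Z · X ⁻) ^ 2 ≐ e) ((0 , 6 , 0 , true) ∷ [])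
      ∷ consequence sat ((Y · X) ^ 2 ≐ e) ((0 , 3 , 1 , false) ∷ [])
      ∷ consequence sat ((Y · X ⁻) ^ 2 ≐ e) ((0 , 4 , 0 , true) ∷ [])
      ∷ consequence sat (Z ^ 2 · Y ^ 2 · X ^ 2 ≐ e) ((4 , 0 , 0 , false) ∷ (2 , 1 , 0 , false) ∷ (2 , 9 , 4 , true) ∷ (0 , 2 , 0 , false) ∷ []) ∷ []

  module YXZ = Permuted Y X Z satYXZ
  module ZYX = Permuted Z Y X satZYX

  go : Dec (⟦ X · X ⟧ ≡ ε) → ⊥
  go (no x²≢ε) = Refutation.contradictory certificateG1 tt G a gn universal sameNormal-sound normal-form
    (x²≢ε
      ∷ y²≢ε
      ∷ x²y²≢ε
      ∷ (λ p → primitive-≢ (Y ⁻ · Z · X · X ≐ e) (consequence {R = Y · Z · (X · X) · (Y · Y) ≐ e ∷ relG1} (p ∷ sat) (Y ⁻ · Z · X · X ≐ e) ((1 , 0 , 1 , false) ∷ (0 , 2 , 0 , true) ∷ [])))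
      ∷ (λ p → primitive-≢ (Y ⁻ · Z ≐ e) (consequence {R = Y · Z · (Y · Y) ≐ e ∷ relG1} (p ∷ sat) (Y ⁻ · Z ≐ e) ((0 , 2 , 0 , true) ∷ (0 , 0 , 2 , false) ∷ [])))
      ∷ (λ p → primitive-≢ (Y · Z · X · X ≐ e) (consequence {R = Y · Z · (X · X) ≐ e ∷ relG1} (p ∷ sat) (Y · Z · X · X ≐ e) ((0 , 0 , 0 , false) ∷ [])))
      ∷ (λ p → primitive-≢ (Y · Z ≐ e) (consequence {R = Y · Z ≐ e ∷ relG1} (p ∷ sat) (Y · Z ≐ e) ((0 , 0 , 0 , false) ∷ []))) ∷ []) S antisymmetric regular
    where
    y²≢ε : ⟦ Y · Y ⟧ ≢ ε
    y²≢ε p = x²≢ε (YXZ.trivial-image (Y · Y) p)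
    x²y²≢ε : ⟦ X · X · (Y · Y) ⟧ ≢ ε
    x²y²≢ε p = x²≢ε (ZYX.trivial-image (Z · Z) (consequence {R = X · X · (Y · Y) ≐ e ∷ relG1} (p ∷ sat) (Z · Z ≐ e) ((0 , 10 , 4 , false) ∷ (0 , 0 , 0 , true) ∷ [])))
  -- The presentation alone has not been shown to make `x²` nontrivial, so this case is refuted as
  -- well: the exchange of `x` and `y` preserves the empty set and moves `x`, since `x = y` would
  -- make a generator redundant.
  go (yes x²) = primitive-≢ (Y ≐ X) (trans (sym (YXZ.h-eval X)) (automorphism-trivial G S regular YXZ.hom involutive involutive
      (λ p → ⊥-elim (empty p)) (λ p → ⊥-elim (empty p)) (a 0F)))
    where
    y² : ⟦ Y · Y ⟧ ≡ ε
    y² = YXZ.trivial-image (X · X) x²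
    z² : ⟦ Z · Z ⟧ ≡ ε
    z² = ZYX.trivial-image (X · X) x²

    central-trivial : ∀ n → ⟦ central n ⟧ ≡ ε
    central-trivial (i ∷ j ∷ k ∷ []) = trans (cong₂ _∙_ (trans (cong₂ _∙_ (bits (X · X) x² i) (bits (Y · Y) y² j)) (identityˡ ε)) (bits (Z · Z) z² k)) (identityˡ ε)
      where
      bits : ∀ u → ⟦ u ⟧ ≡ ε → ∀ c → ⟦ bit u c ⟧ ≡ ε
      bits u p true  = p
      bits u p false = refl

    zero-part : ∀ v m → v ≡ Vec.replicate 3 false → value (v , m) ≡ ε
    zero-part _ m refl = trans (sym (value-central m)) (central-trivial m)

    square-value : ∀ n → value n ∙ value n ≡ ε
    square-value (v , m) = trans (sym (value-⊕ (v , m) (v , m))) (zero-part (v ⊞ v) (cocycle v v ⊞ (m ⊞ m)) (⊞-self v))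

    square : ∀ g → g ∙ g ≡ ε
    square g = subst (λ t → t ∙ t ≡ ε) (proj₂ (value-⟨⟩ (gn g))) (square-value (proj₁ (value-⟨⟩ (gn g))))

    empty : ∀ {x} → ¬ (x Sub.∈ S)
    empty {x} p = antisymmetric x p (subst (Sub._∈ S) (inverseˡ-unique x x (square x)) p)

    involutive-eval : ∀ u → YXZ.h (YXZ.h ⟦ u ⟧) ≡ ⟦ u ⟧
    involutive-eval = Homomorphism.hom-eval G G (λ g → YXZ.h (YXZ.h g))
      (λ g g′ → trans (cong YXZ.h (YXZ.hom g g′)) (YXZ.hom (YXZ.h g) (YXZ.h g′)))
      (λ { 0F → trans (cong YXZ.h (YXZ.h-eval X)) (YXZ.h-eval Y)
         ; 1F → trans (cong YXZ.h (YXZ.h-eval Y)) (YXZ.h-eval X)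
         ; 2F → trans (cong YXZ.h (YXZ.h-eval Z)) (YXZ.h-eval Z)})

    involutive : ∀ x → YXZ.h (YXZ.h x) ≡ x
    involutive x = subst (λ g → YXZ.h (YXZ.h g) ≡ g) (proj₂ (proj₂ (normal-form x))) (involutive-eval (proj₁ (normal-form x)))

normal₂₄ : String 4 → Normal₂₄
normal₂₄ []                = zero₂₄
normal₂₄ ((0F , true) ∷ w)  = (1F , o ∷ o ∷ o ∷ []) ⊞₃ normal₂₄ w
normal₂₄ ((0F , false) ∷ w) = (2F , o ∷ o ∷ o ∷ []) ⊞₃ normal₂₄ w
normal₂₄ ((1F , _) ∷ w)     = (0F , ı ∷ o ∷ o ∷ []) ⊞₃ normal₂₄ w
normal₂₄ ((2F , _) ∷ w)     = (0F , o ∷ ı ∷ o ∷ []) ⊞₃ normal₂₄ w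
normal₂₄ ((3F , _) ∷ w)     = (0F , o ∷ o ∷ ı ∷ []) ⊞₃ normal₂₄ w

isZero₂₄ : Normal₂₄ → Bool
isZero₂₄ (0F , v) = isZero v
isZero₂₄ _        = false

same₂₄ : Word 4 → Word 4 → Bool
same₂₄ u v = isZero₂₄ (normal₂₄ (flatten u ++ inverse (flatten v)))

all₂₄ : List Normal₂₄
all₂₄ = concatMap (λ i → map (i ,_) allBits) (allFin 3)

-- The eight pairs are those of `x v` for `v` in `C₂³`, so `S` amounts to a map from `C₂³` to three
-- values. The candidates are the 21 involutions of `GL(3,2)`, extended by fixing `x`; evaluation
-- confirms that each of the `3 ^ 8` maps is invariant under one of them.
certificate₂₄ : Certificate 4
certificate₂₄ = record
  { relations = relC3C2C2C2
  ; sameWord = same₂₄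
  ; normalForms = map normalWord₂₄ all₂₄
  ; pairs = 8
  ; representatives = (X) ∷ (X · Y) ∷ (X · Z) ∷ (X · Y · Z) ∷ (X · W) ∷ (X · Y · W) ∷ (X · Z · W) ∷ (X · Y · Z · W) ∷ []
  ; candidates =
      candidate (X ∷ Y ∷ Z ∷ (Y · W) ∷ []) (X ∷ Y ∷ Z ∷ (Y · W) ∷ [])
      ((4F , 5F , ı) ∷ (5F , 4F , ı) ∷ (6F , 7F , ı) ∷ (7F , 6F , ı) ∷ [])
    ∷ candidate (X ∷ Y ∷ W ∷ Z ∷ []) (X ∷ Y ∷ W ∷ Z ∷ [])
      ((2F , 4F , ı) ∷ (3F , 5F , ı) ∷ (4F , 2F , ı) ∷ (5F , 3F , ı) ∷ [])
    ∷ candidate (X ∷ Y ∷ (Z · W) ∷ W ∷ []) (X ∷ Y ∷ (Z · W) ∷ W ∷ [])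
      ((2F , 6F , ı) ∷ (3F , 7F , ı) ∷ (6F , 2F , ı) ∷ (7F , 3F , ı) ∷ [])
    ∷ candidate (X ∷ (Y · Z) ∷ Z ∷ W ∷ []) (X ∷ (Y · Z) ∷ Z ∷ W ∷ [])
      ((1F , 3F , ı) ∷ (3F , 1F , ı) ∷ (5F , 7F , ı) ∷ (7F , 5F , ı) ∷ [])
    ∷ candidate (X ∷ Z ∷ Y ∷ W ∷ []) (X ∷ Z ∷ Y ∷ W ∷ [])
      ((1F , 2F , ı) ∷ (2F , 1F , ı) ∷ (5F , 6F , ı) ∷ (6F , 5F , ı) ∷ [])
    ∷ candidate (X ∷ W ∷ Z ∷ Y ∷ []) (X ∷ W ∷ Z ∷ Y ∷ [])
      ((1F , 4F , ı) ∷ (3F , 6F , ı) ∷ (4F , 1F , ı) ∷ (6F , 3F , ı) ∷ [])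
    ∷ candidate (X ∷ Y ∷ (Y · W) ∷ (Y · Z) ∷ []) (X ∷ Y ∷ (Y · W) ∷ (Y · Z) ∷ [])
      ((2F , 5F , ı) ∷ (3F , 4F , ı) ∷ (4F , 3F , ı) ∷ (5F , 2F , ı) ∷ [])
    ∷ candidate (X ∷ W ∷ (Y · Z · W) ∷ Y ∷ []) (X ∷ W ∷ (Y · Z · W) ∷ Y ∷ [])
      ((1F , 4F , ı) ∷ (2F , 7F , ı) ∷ (4F , 1F , ı) ∷ (7F , 2F , ı) ∷ [])
    ∷ candidate (X ∷ Y ∷ (Y · Z) ∷ W ∷ []) (X ∷ Y ∷ (Y · Z) ∷ W ∷ [])
      ((2F , 3F , ı) ∷ (3F , 2F , ı) ∷ (6F , 7F , ı) ∷ (7F , 6F , ı) ∷ [])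
    ∷ candidate (X ∷ Y ∷ Z ∷ (Z · W) ∷ []) (X ∷ Y ∷ Z ∷ (Z · W) ∷ [])
      ((4F , 6F , ı) ∷ (5F , 7F , ı) ∷ (6F , 4F , ı) ∷ (7F , 5F , ı) ∷ [])
    ∷ candidate (X ∷ Y ∷ Z ∷ (Y · Z · W) ∷ []) (X ∷ Y ∷ Z ∷ (Y · Z · W) ∷ [])
      ((4F , 7F , ı) ∷ (5F , 6F , ı) ∷ (6F , 5F , ı) ∷ (7F , 4F , ı) ∷ [])
    ∷ candidate (X ∷ Y ∷ (Y · Z) ∷ (Y · W) ∷ []) (X ∷ Y ∷ (Y · Z) ∷ (Y · W) ∷ [])
      ((2F , 3F , ı) ∷ (3F , 2F , ı) ∷ (4F , 5F , ı) ∷ (5F , 4F , ı) ∷ [])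
    ∷ candidate (X ∷ Y ∷ (Y · Z · W) ∷ W ∷ []) (X ∷ Y ∷ (Y · Z · W) ∷ W ∷ [])
      ((2F , 7F , ı) ∷ (3F , 6F , ı) ∷ (6F , 3F , ı) ∷ (7F , 2F , ı) ∷ [])
    ∷ candidate (X ∷ Z ∷ Y ∷ (Y · Z · W) ∷ []) (X ∷ Z ∷ Y ∷ (Y · Z · W) ∷ [])
      ((1F , 2F , ı) ∷ (2F , 1F , ı) ∷ (4F , 7F , ı) ∷ (7F , 4F , ı) ∷ [])
    ∷ candidate (X ∷ (Y · Z) ∷ Z ∷ (Z · W) ∷ []) (X ∷ (Y · Z) ∷ Z ∷ (Z · W) ∷ [])
      ((1F , 3F , ı) ∷ (3F , 1F , ı) ∷ (4F , 6F , ı) ∷ (6F , 4F , ı) ∷ [])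
    ∷ candidate (X ∷ (Y · W) ∷ Z ∷ W ∷ []) (X ∷ (Y · W) ∷ Z ∷ W ∷ [])
      ((1F , 5F , ı) ∷ (3F , 7F , ı) ∷ (5F , 1F , ı) ∷ (7F , 3F , ı) ∷ [])
    ∷ candidate (X ∷ (Y · W) ∷ (Z · W) ∷ W ∷ []) (X ∷ (Y · W) ∷ (Z · W) ∷ W ∷ [])
      ((1F , 5F , ı) ∷ (2F , 6F , ı) ∷ (5F , 1F , ı) ∷ (6F , 2F , ı) ∷ [])
    ∷ candidate (X ∷ (Z · W) ∷ Z ∷ (Y · Z) ∷ []) (X ∷ (Z · W) ∷ Z ∷ (Y · Z) ∷ [])
      ((1F , 6F , ı) ∷ (3F , 4F , ı) ∷ (4F , 3F , ı) ∷ (6F , 1F , ı) ∷ [])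
    ∷ candidate (X ∷ (Z · W) ∷ (Y · W) ∷ W ∷ []) (X ∷ (Z · W) ∷ (Y · W) ∷ W ∷ [])
      ((1F , 6F , ı) ∷ (2F , 5F , ı) ∷ (5F , 2F , ı) ∷ (6F , 1F , ı) ∷ [])
    ∷ candidate (X ∷ (Y · Z · W) ∷ Z ∷ W ∷ []) (X ∷ (Y · Z · W) ∷ Z ∷ W ∷ [])
      ((1F , 7F , ı) ∷ (3F , 5F , ı) ∷ (5F , 3F , ı) ∷ (7F , 1F , ı) ∷ [])
    ∷ candidate (X ∷ (Y · Z · W) ∷ W ∷ Z ∷ []) (X ∷ (Y · Z · W) ∷ W ∷ Z ∷ [])
      ((1F , 7F , ı) ∷ (2F , 4F , ı) ∷ (4F , 2F , ı) ∷ (7F , 1F , ı) ∷ []) ∷ []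
  ; displacements = Y ∷ Z · W ∷ W ∷ Z ∷ Y · Z ∷ Y · W ∷ Y · Z · W ∷ []
  }

C₃C₂³-noORR : ∀ G → NotGeneratedByTwo G → IsPresentedBy G 4 relC3C2C2C2 → ¬ HasORR G
C₃C₂³-noORR G rank (a , gn , sat , universal) (S , antisymmetric , regular) =
  Refutation.contradictory certificate₂₄ tt G a gn universal same₂₄-sound normal-form displaced S antisymmetric regular
  where
  open GroupOf G
  open Eval G a
  open Group₂₄ G a sat
  open Generation G

  value-letter₂₄ : ∀ i b w → ⟪ w ⟫ ≡ value₂₄ (normal₂₄ w) → letter (i , b) ∙ ⟪ w ⟫ ≡ value₂₄ (normal₂₄ ((i , b) ∷ w))
  value-letter₂₄ 0F true  w p = sym (trans (value-⊞₃ (1F , o ∷ o ∷ o ∷ []) (normal₂₄ w)) (cong₂ _∙_ (value-generator₂₄ 0F) (sym p)))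
  value-letter₂₄ 0F false w p = sym (trans (value-⊞₃ (2F , o ∷ o ∷ o ∷ []) (normal₂₄ w)) (cong₂ _∙_
    (consequence sat (normalWord₂₄ (2F , o ∷ o ∷ o ∷ []) ≐ X ⁻) ((0 , 0 , 0 , false) ∷ [])) (sym p)))
  value-letter₂₄ 1F true  w p = sym (trans (value-⊞₃ (generator₂₄ 1F) (normal₂₄ w)) (cong₂ _∙_ (value-generator₂₄ 1F) (sym p)))
  value-letter₂₄ 1F false w p = sym (trans (value-⊞₃ (generator₂₄ 1F) (normal₂₄ w)) (cong₂ _∙_
    (consequence sat (normalWord₂₄ (generator₂₄ 1F) ≐ Y ⁻) ((0 , 1 , 0 , false) ∷ [])) (sym p)))
  value-letter₂₄ 2F true  w p = sym (trans (value-⊞₃ (generator₂₄ 2F) (normal₂₄ w)) (cong₂ _∙_ (value-generator₂₄ 2F) (sym p)))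
  value-letter₂₄ 2F false w p = sym (trans (value-⊞₃ (generator₂₄ 2F) (normal₂₄ w)) (cong₂ _∙_
    (consequence sat (normalWord₂₄ (generator₂₄ 2F) ≐ Z ⁻) ((0 , 2 , 0 , false) ∷ [])) (sym p)))
  value-letter₂₄ 3F true  w p = sym (trans (value-⊞₃ (generator₂₄ 3F) (normal₂₄ w)) (cong₂ _∙_ (value-generator₂₄ 3F) (sym p)))
  value-letter₂₄ 3F false w p = sym (trans (value-⊞₃ (generator₂₄ 3F) (normal₂₄ w)) (cong₂ _∙_
    (consequence sat (normalWord₂₄ (generator₂₄ 3F) ≐ W ⁻) ((0 , 3 , 0 , false) ∷ [])) (sym p)))

  value-normal₂₄ : ∀ w → ⟪ w ⟫ ≡ value₂₄ (normal₂₄ w)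
  value-normal₂₄ []            = sym value-zero₂₄
  value-normal₂₄ ((i , b) ∷ w) = value-letter₂₄ i b w (value-normal₂₄ w)

  value-isZero₂₄ : ∀ n → T (isZero₂₄ n) → value₂₄ n ≡ ε
  value-isZero₂₄ (0F , o ∷ o ∷ o ∷ []) _ = value-zero₂₄

  same₂₄-sound : ∀ u v → T (same₂₄ u v) → ⟦ u ⟧ ≡ ⟦ v ⟧
  same₂₄-sound u v t = quotient-trivial (trans (sym (⟪⟫-relator u v))
    (trans (value-normal₂₄ (flatten u ++ inverse (flatten v))) (value-isZero₂₄ (normal₂₄ (flatten u ++ inverse (flatten v))) t)))

  normal-form : ∀ g → ∃ λ u → u ∈ map normalWord₂₄ all₂₄ × ⟦ u ⟧ ≡ g
  normal-form g with value₂₄-⟨⟩ (gn g)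
  ... | (i , v) , eq = normalWord₂₄ (i , v) , ∈-map⁺ normalWord₂₄
        (∈-concatMap⁺ (λ i → map (i ,_) allBits) (lose (∈-allFin i) (∈-map⁺ (i ,_) (∈-allBits v)))) , eq

  -- Elements of orders 3 and 2 are both powers of their product, so one dependency among y, z, w leaves two generators.
  module Dependent (u v : Word 4) (basis′ : ∀ i → ∃ λ t → ⟦ substitute (lookup (X · u ∷ v ∷ [])) t ⟧ ≡ a i) where
    absurd : ⊥
    absurd = rank (b , λ g → ⟨⟩-map (λ i → subst (⟨_⟩ G b)
      (trans (eval-substitute G a (lookup (X · u ∷ v ∷ [])) (proj₁ (basis′ i))) (proj₂ (basis′ i))) (⟨⟩-eval b (proj₁ (basis′ i)))) (gn g))
      where
      b : Fin 2 → C
      b i = ⟦ lookup (X · u ∷ v ∷ []) i ⟧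

  displaced : All (λ u → ⟦ u ⟧ ≢ ε) (Certificate.displacements certificate₂₄)
  displaced =
      (λ p → Dependent.absurd Z W (λ { 0F → X · X · X · X , consequence {R = Y ≐ e ∷ relC3C2C2C2} (p ∷ sat) (X · Z · (X · Z) · (X · Z) · (X · Z) ≐ X) ((6 , 6 , 0 , false) ∷ (5 , 3 , 0 , false) ∷ (1 , 6 , 0 , true) ∷ (2 , 3 , 0 , false) ∷ (0 , 1 , 0 , false) ∷ [])
        ; 1F → e , consequence {R = Y ≐ e ∷ relC3C2C2C2} (p ∷ sat) (e ≐ Y) ((0 , 0 , 0 , true) ∷ [])
        ; 2F → X · X · X , consequence {R = Y ≐ e ∷ relC3C2C2C2} (p ∷ sat) (X · Z · (X · Z) · (X · Z) ≐ Z) ((1 , 6 , 0 , true) ∷ (2 , 3 , 0 , false) ∷ (0 , 1 , 0 , false) ∷ [])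
        ; 3F → Y , consequence {R = Y ≐ e ∷ relC3C2C2C2} (p ∷ sat) (W ≐ W) [] }))
      ∷ (λ p → Dependent.absurd Y W (λ { 0F → X · X · X · X , consequence {R = Z · W ≐ e ∷ relC3C2C2C2} (p ∷ sat) (X · Y · (X · Y) · (X · Y) · (X · Y) ≐ X) ((6 , 5 , 0 , false) ∷ (5 , 2 , 0 , false) ∷ (1 , 5 , 0 , true) ∷ (2 , 2 , 0 , false) ∷ (0 , 1 , 0 , false) ∷ [])
        ; 1F → X · X · X , consequence {R = Z · W ≐ e ∷ relC3C2C2C2} (p ∷ sat) (X · Y · (X · Y) · (X · Y) ≐ Y) ((1 , 5 , 0 , true) ∷ (2 , 2 , 0 , false) ∷ (0 , 1 , 0 , false) ∷ [])
        ; 2F → Y , consequence {R = Z · W ≐ e ∷ relC3C2C2C2} (p ∷ sat) (W ≐ Z) ((1 , 0 , 1 , true) ∷ (0 , 4 , 0 , false) ∷ [])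
        ; 3F → Y , consequence {R = Z · W ≐ e ∷ relC3C2C2C2} (p ∷ sat) (W ≐ W) [] }))
      ∷ (λ p → Dependent.absurd Y Z (λ { 0F → X · X · X · X , consequence {R = W ≐ e ∷ relC3C2C2C2} (p ∷ sat) (X · Y · (X · Y) · (X · Y) · (X · Y) ≐ X) ((6 , 5 , 0 , false) ∷ (5 , 2 , 0 , false) ∷ (1 , 5 , 0 , true) ∷ (2 , 2 , 0 , false) ∷ (0 , 1 , 0 , false) ∷ [])
        ; 1F → X · X · X , consequence {R = W ≐ e ∷ relC3C2C2C2} (p ∷ sat) (X · Y · (X · Y) · (X · Y) ≐ Y) ((1 , 5 , 0 , true) ∷ (2 , 2 , 0 , false) ∷ (0 , 1 , 0 , false) ∷ [])
        ; 2F → Y , consequence {R = W ≐ e ∷ relC3C2C2C2} (p ∷ sat) (Z ≐ Z) []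
        ; 3F → e , consequence {R = W ≐ e ∷ relC3C2C2C2} (p ∷ sat) (e ≐ W) ((0 , 0 , 0 , true) ∷ []) }))
      ∷ (λ p → Dependent.absurd Y W (λ { 0F → X · X · X · X , consequence {R = Z ≐ e ∷ relC3C2C2C2} (p ∷ sat) (X · Y · (X · Y) · (X · Y) · (X · Y) ≐ X) ((6 , 5 , 0 , false) ∷ (5 , 2 , 0 , false) ∷ (1 , 5 , 0 , true) ∷ (2 , 2 , 0 , false) ∷ (0 , 1 , 0 , false) ∷ [])
        ; 1F → X · X · X , consequence {R = Z ≐ e ∷ relC3C2C2C2} (p ∷ sat) (X · Y · (X · Y) · (X · Y) ≐ Y) ((1 , 5 , 0 , true) ∷ (2 , 2 , 0 , false) ∷ (0 , 1 , 0 , false) ∷ [])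
        ; 2F → e , consequence {R = Z ≐ e ∷ relC3C2C2C2} (p ∷ sat) (e ≐ Z) ((0 , 0 , 0 , true) ∷ [])
        ; 3F → Y , consequence {R = Z ≐ e ∷ relC3C2C2C2} (p ∷ sat) (W ≐ W) [] }))
      ∷ (λ p → Dependent.absurd Z W (λ { 0F → X · X · X · X , consequence {R = Y · Z ≐ e ∷ relC3C2C2C2} (p ∷ sat) (X · Z · (X · Z) · (X · Z) · (X · Z) ≐ X) ((6 , 6 , 0 , false) ∷ (5 , 3 , 0 , false) ∷ (1 , 6 , 0 , true) ∷ (2 , 3 , 0 , false) ∷ (0 , 1 , 0 , false) ∷ [])
        ; 1F → X · X · X , consequence {R = Y · Z ≐ e ∷ relC3C2C2C2} (p ∷ sat) (X · Z · (X · Z) · (X · Z) ≐ Y) ((1 , 6 , 0 , true) ∷ (2 , 3 , 0 , false) ∷ (0 , 1 , 0 , false) ∷ (1 , 2 , 0 , true) ∷ (0 , 0 , 1 , false) ∷ [])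
        ; 2F → X · X · X , consequence {R = Y · Z ≐ e ∷ relC3C2C2C2} (p ∷ sat) (X · Z · (X · Z) · (X · Z) ≐ Z) ((1 , 6 , 0 , true) ∷ (2 , 3 , 0 , false) ∷ (0 , 1 , 0 , false) ∷ [])
        ; 3F → Y , consequence {R = Y · Z ≐ e ∷ relC3C2C2C2} (p ∷ sat) (W ≐ W) [] }))
      ∷ (λ p → Dependent.absurd Z W (λ { 0F → X · X · X · X , consequence {R = Y · W ≐ e ∷ relC3C2C2C2} (p ∷ sat) (X · Z · (X · Z) · (X · Z) · (X · Z) ≐ X) ((6 , 6 , 0 , false) ∷ (5 , 3 , 0 , false) ∷ (1 , 6 , 0 , true) ∷ (2 , 3 , 0 , false) ∷ (0 , 1 , 0 , false) ∷ [])
        ; 1F → Y , consequence {R = Y · W ≐ e ∷ relC3C2C2C2} (p ∷ sat) (W ≐ Y) ((1 , 0 , 1 , true) ∷ (0 , 4 , 0 , false) ∷ [])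
        ; 2F → X · X · X , consequence {R = Y · W ≐ e ∷ relC3C2C2C2} (p ∷ sat) (X · Z · (X · Z) · (X · Z) ≐ Z) ((1 , 6 , 0 , true) ∷ (2 , 3 , 0 , false) ∷ (0 , 1 , 0 , false) ∷ [])
        ; 3F → Y , consequence {R = Y · W ≐ e ∷ relC3C2C2C2} (p ∷ sat) (W ≐ W) [] }))
      ∷ (λ p → Dependent.absurd Z W (λ { 0F → X · X · X · X , consequence {R = Y · Z · W ≐ e ∷ relC3C2C2C2} (p ∷ sat) (X · Z · (X · Z) · (X · Z) · (X · Z) ≐ X) ((6 , 6 , 0 , false) ∷ (5 , 3 , 0 , false) ∷ (1 , 6 , 0 , true) ∷ (2 , 3 , 0 , false) ∷ (0 , 1 , 0 , false) ∷ [])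
        ; 1F → X · X · X · Y , consequence {R = Y · Z · W ≐ e ∷ relC3C2C2C2} (p ∷ sat) (X · Z · (X · Z) · (X · Z) · W ≐ Y) ((5 , 0 , 1 , false) ∷ (5 , 2 , 0 , true) ∷ (1 , 6 , 0 , true) ∷ (2 , 3 , 0 , false) ∷ (0 , 1 , 0 , false) ∷ [])
        ; 2F → X · X · X , consequence {R = Y · Z · W ≐ e ∷ relC3C2C2C2} (p ∷ sat) (X · Z · (X · Z) · (X · Z) ≐ Z) ((1 , 6 , 0 , true) ∷ (2 , 3 , 0 , false) ∷ (0 , 1 , 0 , false) ∷ [])
        ; 3F → Y , consequence {R = Y · Z · W ≐ e ∷ relC3C2C2C2} (p ∷ sat) (W ≐ W) [] })) ∷ []

exceptional-noORR : ∀ G → NotGeneratedByTwo G → Exceptional G → ¬ HasORR G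
exceptional-noORR G rank (inj₁ p)               = C₄C₂C₂-noORR G rank p
exceptional-noORR G rank (inj₂ (inj₁ p))        = C₃C₂³-noORR G rank p
exceptional-noORR G rank (inj₂ (inj₂ (inj₁ p))) = G1-noORR G rank p
exceptional-noORR G rank (inj₂ (inj₂ (inj₂ p))) = G2-noORR G rank p

theorem4p9 : (G : FinGroup) → Rank G 3 →
    (GeneralizedDihedral G ⊎ HasORR G ⊎ Exceptional G)
    × ((GeneralizedDihedral G ⊎ Exceptional G) → ¬ HasORR G)
theorem4p9 G ((a , gn) , minimal) = Main.outcome G rank a gn , noORR
  where
  rank : NotGeneratedByTwo G
  rank = minimal 2 (s≤s (s≤s (s≤s z≤n)))

  noORR : GeneralizedDihedral G ⊎ Exceptional G → ¬ HasORR G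
  noORR (inj₁ gd) (S , antisymmetric , regular) = generalizedDihedral-noDRR G minimal gd S antisymmetric regular
  noORR (inj₂ ex) = exceptional-noORR G rank ex
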